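{- Let $G_1$ be a $(q_1,q_2)$-semi-regular bipartite graph with bipartition $V_1,V_2$, $|V_1|=n_1\le n_2=|V_2|$, $\nu_1=n_1+n_2$, and let $G_2$ be a $(q_3,q_4)$-semi-regular bipartite graph with bipartition $V_3,V_4$, $|V_3|=n_3\le n_4=|V_4|$, $\nu_2=n_3+n_4$. Write $spec(G_1)=\{\pm\lambda_1,\dots,\pm\lambda_{k_1},0^{(\nu_1-2k_1)}\}$ and $spec(G_2)=\{\pm\mu_1,\dots,\pm\mu_{k_2},0^{(\nu_2-2k_2)}\}$ where $k_1,k_2$ are the numbers of positive eigenvalues, $\sqrt{q_1q_2}=\lambda_1\ge\dots\ge\lambda_{k_1}>0$, $\sqrt{q_3q_4}=\mu_1\ge\dots\ge\mu_{k_2}>0$. Then the number of spanning trees of $G=G_1\vee G_2$ is $$\tau(G)=(q_1+q_2+\nu_2)(q_3+q_4+\nu_1)(q_1+\nu_2)^{n_1-k_1}(q_2+\nu_2)^{n_2-k_1}(q_3+\nu_1)^{n_3-k_2}(q_4+\nu_1)^{n_4-k_2}\prod_{i=2}^{k_1}\big[(q_1+\nu_2)(q_2+\nu_2)-\lambda_i^2\big]\prod_{j=2}^{k_2}\big[(q_3+\nu_1)(q_4+\nu_1)-\mu_j^2\big].$$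
   Context: A bipartite graph with bipartition $(V_1,V_2)$ is $(q_1,q_2)$-semi-regular if every vertex of $V_1$ has degree $q_1$ and every vertex of $V_2$ has degree $q_2$ ($q_1,q_2\ge1$). The join $G_1\vee G_2$ has vertex set $V(G_1)\sqcup V(G_2)$ and edge set $E(G_1)\cup E(G_2)\cup\{uv:u\in V(G_1),v\in V(G_2)\}$. $spec$ denotes the multiset of adjacency eigenvalues (exponents in parentheses denote multiplicities); $\tau(G)$ is the number of spanning trees of $G$. -}

module Defs where

open import Algebra.Bundles using (RawRing)
open import Data.Bool.Base using (Bool; true; false; if_then_else_)
import Data.Bool.Properties as Bool
open import Data.Empty using (⊥)
open import Data.Fin.Base as Fin using (Fin; zero; suc; splitAt; punchIn)
import Data.Fin.Properties as Fin
open import Data.Fin.Subset using (Subset; ∁; ∣_∣) renaming (_∈_ to _∈ˢ_)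
open import Data.Integer.Base using (+_)
open import Data.List.Base
  using (List; []; _∷_; _++_; _∷ʳ_; map; foldr; filter; length; lookup;
         allFin; cartesianProduct)
open import Data.List.Membership.Propositional using (_∈_)
open import Data.List.Membership.Propositional.Properties using (∈-lookup)
import Data.List.Membership.DecPropositional as DecMembership
import Data.List.Relation.Unary.All as All
open import Data.List.Relation.Unary.AllPairs using (_∷_)
open import Data.List.Relation.Unary.Any using (here; there)
open import Data.List.Relation.Unary.Linked using (Linked; linked?)
open import Data.List.Relation.Unary.Unique.Propositional using (Unique)
import Data.List.Relation.Unary.Unique.DecPropositional as DecUnique
open import Data.Nat.Base as ℕ using (ℕ; zero; suc; z≤n; s≤s)
import Data.Nat.Properties as ℕ
open import Data.Product.Base using (∃; ∃-syntax; _×_; _,_; proj₁; proj₂)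
open import Data.Product.Properties using (≡-dec)
open import Data.Rational.Base as ℚ using (ℚ; 0ℚ; 1ℚ; ½; Positive; positive)
import Data.Rational.Properties as ℚ
open import Data.Rational.Solver using (module +-*-Solver)
open import Data.Sum.Base using (_⊎_; inj₁; inj₂)
import Data.Vec.Base as Vec
open import Function.Base using (_∘_)
open import Level using (0ℓ)
open import Relation.Binary.Construct.Closure.ReflexiveTransitive
  using (Star; ε; _◅_; _◅◅_)
import Relation.Binary.Construct.Closure.ReflexiveTransitive as Star
open import Relation.Binary.PropositionalEquality
  using (_≡_; refl; sym; trans; cong; subst)
open import Relation.Nullary.Decidable
  using (Dec; yes; no; does; map′; ¬?; _×-dec_; _⊎-dec_)
open import Relation.Nullary.Negation using (¬_; contradiction)
open import Relation.Unary using (Pred; Decidable)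

-- Cauchy sequences of rationals; equality of reals is `_≃_` below.
record ℝ : Set where
  constructor mkℝ
  field
    seq    : ℕ → ℚ
    cauchy : ∀ δ → 0ℚ ℚ.< δ →
             ∃[ N ] ∀ m n → N ℕ.≤ m → N ℕ.≤ n →
               ℚ.∣ seq m ℚ.- seq n ∣ ℚ.< δ

open ℝ public

infix 4 _≃_ _≤ᵣ_ _<ᵣ_ _≥ᵣ_

_≃_ : ℝ → ℝ → Set
x ≃ y = ∀ δ → 0ℚ ℚ.< δ →
        ∃[ N ] ∀ n → N ℕ.≤ n → ℚ.∣ seq x n ℚ.- seq y n ∣ ℚ.< δ

_≤ᵣ_ : ℝ → ℝ → Set
x ≤ᵣ y = ∀ δ → 0ℚ ℚ.< δ →
         ∃[ N ] ∀ n → N ℕ.≤ n → seq x n ℚ.≤ seq y n ℚ.+ δ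

_≥ᵣ_ : ℝ → ℝ → Set
x ≥ᵣ y = y ≤ᵣ x

_<ᵣ_ : ℝ → ℝ → Set
x <ᵣ y = ∃[ δ ] 0ℚ ℚ.< δ ×
         ∃[ N ] ∀ n → N ℕ.≤ n → seq x n ℚ.+ δ ℚ.≤ seq y n

private

  half : ∀ δ → 0ℚ ℚ.< δ → ∃[ η ] 0ℚ ℚ.< η × η ℚ.+ η ≡ δ
  half δ 0<δ = ½ ℚ.* δ
    , subst (ℚ._< ½ ℚ.* δ) (ℚ.*-zeroʳ ½) (ℚ.*-monoʳ-<-pos ½ 0<δ)
    , trans (sym (ℚ.*-distribʳ-+ δ ½ ½)) (ℚ.*-identityˡ δ)

  ∣p-p∣≡0 : ∀ p → ℚ.∣ p ℚ.- p ∣ ≡ 0ℚ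
  ∣p-p∣≡0 p = cong ℚ.∣_∣ (ℚ.+-inverseʳ p)

  bounded : ∀ x → ∃[ K ] 0ℚ ℚ.< K ×
            ∃[ N ] ∀ n → N ℕ.≤ n → ℚ.∣ seq x n ∣ ℚ.≤ K
  bounded x with cauchy x 1ℚ (ℚ.positive⁻¹ 1ℚ)
  ... | N , near = K , 0<K , N , bound
    where
    a = seq x N
    K = 1ℚ ℚ.+ ℚ.∣ a ∣
    0<K : 0ℚ ℚ.< K
    0<K = ℚ.+-mono-<-≤ (ℚ.positive⁻¹ 1ℚ) (ℚ.0≤∣p∣ a)
    split : ∀ p q → p ≡ (p ℚ.- q) ℚ.+ q
    split = solve 2 (λ p q → p := (p :- q) :+ q) refl
      where open +-*-Solver
    bound : ∀ n → N ℕ.≤ n → ℚ.∣ seq x n ∣ ℚ.≤ K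
    bound n N≤n = begin
      ℚ.∣ seq x n ∣                   ≡⟨ cong ℚ.∣_∣ (split (seq x n) a) ⟩
      ℚ.∣ (seq x n ℚ.- a) ℚ.+ a ∣     ≤⟨ ℚ.∣p+q∣≤∣p∣+∣q∣ (seq x n ℚ.- a) a ⟩
      ℚ.∣ seq x n ℚ.- a ∣ ℚ.+ ℚ.∣ a ∣ ≤⟨ ℚ.+-monoˡ-≤ ℚ.∣ a ∣
                                          (ℚ.<⇒≤ (near n N N≤n ℕ.≤-refl)) ⟩
      K ∎
      where open ℚ.≤-Reasoning

fromℚ : ℚ → ℝ
fromℚ q = mkℝ (λ _ → q) λ δ 0<δ →
  0 , λ _ _ _ _ → subst (ℚ._< δ) (sym (∣p-p∣≡0 q)) 0<δ

fromℕ : ℕ → ℝ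
fromℕ n = fromℚ (+ n ℚ./ 1)

0ᵣ 1ᵣ : ℝ
0ᵣ = fromℚ 0ℚ
1ᵣ = fromℚ 1ℚ

infix  8 -ᵣ_
infixl 7 _*ᵣ_
infixl 6 _+ᵣ_ _-ᵣ_

_+ᵣ_ : ℝ → ℝ → ℝ
x +ᵣ y = mkℝ (λ n → seq x n ℚ.+ seq y n) close
  where
  regroup : ∀ a b c d → (a ℚ.+ b) ℚ.- (c ℚ.+ d) ≡ (a ℚ.- c) ℚ.+ (b ℚ.- d)
  regroup = solve 4 (λ a b c d → (a :+ b) :- (c :+ d) := (a :- c) :+ (b :- d)) refl
    where open +-*-Solver
  close : ∀ δ → 0ℚ ℚ.< δ → ∃[ N ] ∀ m n → N ℕ.≤ m → N ℕ.≤ n →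
          ℚ.∣ (seq x m ℚ.+ seq y m) ℚ.- (seq x n ℚ.+ seq y n) ∣ ℚ.< δ
  close δ 0<δ with half δ 0<δ
  ... | η , 0<η , η+η≡δ with cauchy x η 0<η | cauchy y η 0<η
  ... | M , nearx | N , neary = M ℕ.⊔ N , λ m n p q → begin-strict
    ℚ.∣ (seq x m ℚ.+ seq y m) ℚ.- (seq x n ℚ.+ seq y n) ∣
      ≡⟨ cong ℚ.∣_∣ (regroup (seq x m) (seq y m) (seq x n) (seq y n)) ⟩
    ℚ.∣ (seq x m ℚ.- seq x n) ℚ.+ (seq y m ℚ.- seq y n) ∣
      ≤⟨ ℚ.∣p+q∣≤∣p∣+∣q∣ (seq x m ℚ.- seq x n) (seq y m ℚ.- seq y n) ⟩
    ℚ.∣ seq x m ℚ.- seq x n ∣ ℚ.+ ℚ.∣ seq y m ℚ.- seq y n ∣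
      <⟨ ℚ.+-mono-< (nearx m n (ℕ.m⊔n≤o⇒m≤o M N p) (ℕ.m⊔n≤o⇒m≤o M N q))
                    (neary m n (ℕ.m⊔n≤o⇒n≤o M N p) (ℕ.m⊔n≤o⇒n≤o M N q)) ⟩
    η ℚ.+ η
      ≡⟨ η+η≡δ ⟩
    δ ∎
    where open ℚ.≤-Reasoning

-ᵣ_ : ℝ → ℝ
-ᵣ x = mkℝ (λ n → ℚ.- seq x n) close
  where
  regroup : ∀ a b → ℚ.- a ℚ.- ℚ.- b ≡ ℚ.- (a ℚ.- b)
  regroup = solve 2 (λ a b → (:- a) :- (:- b) := :- (a :- b)) refl
    where open +-*-Solver
  close : ∀ δ → 0ℚ ℚ.< δ → ∃[ N ] ∀ m n → N ℕ.≤ m → N ℕ.≤ n →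
          ℚ.∣ ℚ.- seq x m ℚ.- ℚ.- seq x n ∣ ℚ.< δ
  close δ 0<δ with cauchy x δ 0<δ
  ... | N , near = N , λ m n p q →
    subst (ℚ._< δ)
      (sym (trans (cong ℚ.∣_∣ (regroup (seq x m) (seq x n)))
                  (ℚ.∣-p∣≡∣p∣ (seq x m ℚ.- seq x n))))
      (near m n p q)

_-ᵣ_ : ℝ → ℝ → ℝ
x -ᵣ y = x +ᵣ (-ᵣ y)

_*ᵣ_ : ℝ → ℝ → ℝ
x *ᵣ y = mkℝ (λ n → seq x n ℚ.* seq y n) close
  where
  regroup : ∀ a b c d →
    a ℚ.* b ℚ.- c ℚ.* d ≡ a ℚ.* (b ℚ.- d) ℚ.+ d ℚ.* (a ℚ.- c)
  regroup = solve 4 (λ a b c d →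
    a :* b :- c :* d := a :* (b :- d) :+ d :* (a :- c)) refl
    where open +-*-Solver

  shrink : ∀ K → 0ℚ ℚ.< K → ∀ η → 0ℚ ℚ.< η → ∃[ ζ ] 0ℚ ℚ.< ζ × K ℚ.* ζ ≡ η
  shrink K 0<K η 0<η = K⁻¹ ℚ.* η
    , subst (ℚ._< K⁻¹ ℚ.* η) (ℚ.*-zeroʳ K⁻¹)
        (ℚ.*-monoʳ-<-pos K⁻¹ {{ℚ.1/pos⇒pos K}} 0<η)
    , trans (sym (ℚ.*-assoc K K⁻¹ η))
        (trans (cong (ℚ._* η) (ℚ.*-inverseʳ K)) (ℚ.*-identityˡ η))
    where
    instance
      K-pos : Positive K
      K-pos = positive 0<K
      K-nonZero : ℚ.NonZero K
      K-nonZero = ℚ.pos⇒nonZero K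
    K⁻¹ = ℚ.1/ K

  scale : ∀ {K ζ η} → 0ℚ ℚ.< K → K ℚ.* ζ ≡ η →
          ∀ p q → ℚ.∣ p ∣ ℚ.≤ K → ℚ.∣ q ∣ ℚ.< ζ → ℚ.∣ p ℚ.* q ∣ ℚ.< η
  scale {K} {ζ} {η} 0<K Kζ≡η p q p≤K q<ζ = begin-strict
    ℚ.∣ p ℚ.* q ∣       ≡⟨ ℚ.∣p*q∣≡∣p∣*∣q∣ p q ⟩
    ℚ.∣ p ∣ ℚ.* ℚ.∣ q ∣ ≤⟨ ℚ.*-monoʳ-≤-nonNeg ℚ.∣ q ∣
                             {{ℚ.nonNegative (ℚ.0≤∣p∣ q)}} p≤K ⟩
    K ℚ.* ℚ.∣ q ∣       <⟨ ℚ.*-monoʳ-<-pos K {{positive 0<K}} q<ζ ⟩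
    K ℚ.* ζ             ≡⟨ Kζ≡η ⟩
    η ∎
    where open ℚ.≤-Reasoning

  difference : ∀ {K L ζ ξ η δ} a b c d →
    0ℚ ℚ.< K → 0ℚ ℚ.< L → K ℚ.* ζ ≡ η → L ℚ.* ξ ≡ η → η ℚ.+ η ≡ δ →
    ℚ.∣ a ∣ ℚ.≤ K → ℚ.∣ d ∣ ℚ.≤ L → ℚ.∣ a ℚ.- c ∣ ℚ.< ξ → ℚ.∣ b ℚ.- d ∣ ℚ.< ζ →
    ℚ.∣ a ℚ.* b ℚ.- c ℚ.* d ∣ ℚ.< δ
  difference {η = η} {δ} a b c d 0<K 0<L Kζ≡η Lξ≡η η+η≡δ a≤K d≤L a-c<ξ b-d<ζ =
    begin-strict
    ℚ.∣ a ℚ.* b ℚ.- c ℚ.* d ∣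
      ≡⟨ cong ℚ.∣_∣ (regroup a b c d) ⟩
    ℚ.∣ a ℚ.* (b ℚ.- d) ℚ.+ d ℚ.* (a ℚ.- c) ∣
      ≤⟨ ℚ.∣p+q∣≤∣p∣+∣q∣ (a ℚ.* (b ℚ.- d)) (d ℚ.* (a ℚ.- c)) ⟩
    ℚ.∣ a ℚ.* (b ℚ.- d) ∣ ℚ.+ ℚ.∣ d ℚ.* (a ℚ.- c) ∣
      <⟨ ℚ.+-mono-< (scale 0<K Kζ≡η a (b ℚ.- d) a≤K b-d<ζ)
                    (scale 0<L Lξ≡η d (a ℚ.- c) d≤L a-c<ξ) ⟩
    η ℚ.+ η
      ≡⟨ η+η≡δ ⟩
    δ ∎
    where open ℚ.≤-Reasoning

  close : ∀ δ → 0ℚ ℚ.< δ → ∃[ N ] ∀ m n → N ℕ.≤ m → N ℕ.≤ n →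
          ℚ.∣ seq x m ℚ.* seq y m ℚ.- seq x n ℚ.* seq y n ∣ ℚ.< δ
  close δ 0<δ =
    let η , 0<η , η+η≡δ       = half δ 0<δ
        K , 0<K , M₁ , xbound = bounded x
        L , 0<L , M₂ , ybound = bounded y
        ζ , 0<ζ , Kζ≡η        = shrink K 0<K η 0<η
        ξ , 0<ξ , Lξ≡η        = shrink L 0<L η 0<η
        N₁ , nearx            = cauchy x ξ 0<ξ
        N₂ , neary            = cauchy y ζ 0<ζ
        M = M₁ ℕ.⊔ M₂
        N = N₁ ℕ.⊔ N₂
    in M ℕ.⊔ N , λ m n p q →
      let Mm = ℕ.m⊔n≤o⇒m≤o M N p
          Nm = ℕ.m⊔n≤o⇒n≤o M N p
          Mn = ℕ.m⊔n≤o⇒m≤o M N q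
          Nn = ℕ.m⊔n≤o⇒n≤o M N q
      in difference {K} {L} {ζ} {ξ} {η} {δ}
           (seq x m) (seq y m) (seq x n) (seq y n) 0<K 0<L Kζ≡η Lξ≡η η+η≡δ
           (xbound m (ℕ.m⊔n≤o⇒m≤o M₁ M₂ Mm))
           (ybound n (ℕ.m⊔n≤o⇒n≤o M₁ M₂ Mn))
           (nearx m n (ℕ.m⊔n≤o⇒m≤o N₁ N₂ Nm) (ℕ.m⊔n≤o⇒m≤o N₁ N₂ Nn))
           (neary m n (ℕ.m⊔n≤o⇒n≤o N₁ N₂ Nm) (ℕ.m⊔n≤o⇒n≤o N₁ N₂ Nn))

ℝ-rawRing : RawRing 0ℓ 0ℓ
ℝ-rawRing = record
  { Carrier = ℝ
  ; _≈_     = _≃_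
  ; _+_     = _+ᵣ_
  ; _*_     = _*ᵣ_
  ; -_      = -ᵣ_
  ; 0#      = 0ᵣ
  ; 1#      = 1ᵣ
  }

prodᵣ : List ℝ → ℝ
prodᵣ = foldr _*ᵣ_ 1ᵣ

module Determinant {c ℓ} (R : RawRing c ℓ) where

  open RawRing R
  open import Algebra.Definitions.RawSemiring rawSemiring using (sum; _^_)

  Matrix : ℕ → Set c
  Matrix n = Fin n → Fin n → Carrier

  -- Laplace expansion along the first row.
  det : ∀ {n} → Matrix n → Carrier
  det {zero}  M = 1#
  det {suc n} M = sum λ j →
    ((- 1#) ^ Fin.toℕ j * M zero j) * det (λ i k → M (suc i) (punchIn j k))

open Determinant ℝ-rawRing public using (Matrix; det)

record Graph (n : ℕ) : Set where
  field
    adj     : Fin n → Fin n → Bool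
    adj-sym : ∀ u v → adj u v ≡ adj v u
    no-loop : ∀ v → adj v v ≡ false

open Graph public

degree : ∀ {n} → Graph n → Fin n → ℕ
degree G v = ∣ Vec.tabulate (adj G v) ∣

record SemiRegular {n} (G : Graph n) (V₁ V₂ : Subset n) (q₁ q₂ : ℕ) : Set where
  field
    partition : V₂ ≡ ∁ V₁
    bipartite : ∀ u v → adj G u v ≡ true →
                (u ∈ˢ V₁ × v ∈ˢ V₂) ⊎ (u ∈ˢ V₂ × v ∈ˢ V₁)
    q₁≥1      : 1 ℕ.≤ q₁
    q₂≥1      : 1 ℕ.≤ q₂
    degree₁   : ∀ v → v ∈ˢ V₁ → degree G v ≡ q₁
    degree₂   : ∀ v → v ∈ˢ V₂ → degree G v ≡ q₂

infixr 6 _∨_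

_∨_ : ∀ {m n} → Graph m → Graph n → Graph (m ℕ.+ n)
_∨_ {m} {n} G H = record
  { adj     = λ u v → adj′ (splitAt m u) (splitAt m v)
  ; adj-sym = λ u v → sym′ (splitAt m u) (splitAt m v)
  ; no-loop = λ v → loop′ (splitAt m v)
  }
  where
  adj′ : Fin m ⊎ Fin n → Fin m ⊎ Fin n → Bool
  adj′ (inj₁ u) (inj₁ v) = adj G u v
  adj′ (inj₁ u) (inj₂ v) = true
  adj′ (inj₂ u) (inj₁ v) = true
  adj′ (inj₂ u) (inj₂ v) = adj H u v
  sym′ : ∀ a b → adj′ a b ≡ adj′ b a
  sym′ (inj₁ u) (inj₁ v) = adj-sym G u v
  sym′ (inj₁ u) (inj₂ v) = refl
  sym′ (inj₂ u) (inj₁ v) = refl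
  sym′ (inj₂ u) (inj₂ v) = adj-sym H u v
  loop′ : ∀ a → adj′ a a ≡ false
  loop′ (inj₁ v) = no-loop G v
  loop′ (inj₂ v) = no-loop H v

adjacencyMatrix : ∀ {n} → Graph n → Matrix n
adjacencyMatrix G u v = if adj G u v then 1ᵣ else 0ᵣ

scalarMatrix : ∀ {n} → ℝ → Matrix n
scalarMatrix x u v = if does (u Fin.≟ v) then x else 0ᵣ

charPoly : ∀ {n} → Graph n → ℝ → ℝ
charPoly G x = det λ u v → scalarMatrix x u v -ᵣ adjacencyMatrix G u v

-- θ lists the n eigenvalues of G, each repeated according to its
-- multiplicity as a root of the characteristic polynomial.
Spec : ∀ {n} → Graph n → List ℝ → Set
Spec {n} G θ =
  length θ ≡ n ×
  (∀ x → charPoly G x ≃ prodᵣ (map (λ t → x -ᵣ t) θ))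

-- A spanning subgraph on Fin n is given by its list of edges, each of
-- which may be traversed in both directions.

module _ {n : ℕ} where

  Edge : Set
  Edge = Fin n × Fin n

  Joined : List Edge → Fin n → Fin n → Set
  Joined F u v = (u , v) ∈ F ⊎ (v , u) ∈ F

  Connected : List Edge → Set
  Connected F = ∀ u v → Star (Joined F) u v

  IsCycle : List Edge → List (Fin n) → Set
  IsCycle F []       = ⊥
  IsCycle F (v ∷ vs) =
    2 ℕ.≤ length vs × Unique (v ∷ vs) × Linked (Joined F) (v ∷ (vs ∷ʳ v))

  Acyclic : List Edge → Set
  Acyclic F = ¬ ∃ (IsCycle F)

  IsTree : List Edge → Set
  IsTree F = Connected F × Acyclic F

  private

    joined? : ∀ F u v → Dec (Joined F u v)
    joined? F u v = ((u , v) ∈? F) ⊎-dec ((v , u) ∈? F)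
      where open DecMembership (≡-dec (Fin._≟_ {n}) Fin._≟_)

    weaken : ∀ {e F u v} → Star (Joined F) u v → Star (Joined (e ∷ F)) u v
    weaken = Star.map λ { (inj₁ p) → inj₁ (there p) ; (inj₂ p) → inj₂ (there p) }

    Via : Edge → List Edge → Fin n → Fin n → Set
    Via (a , b) F u v =
      Star (Joined F) u v ⊎
      (Star (Joined F) u a × Star (Joined F) b v) ⊎
      (Star (Joined F) u b × Star (Joined F) a v)

    via⇒path : ∀ {e F u v} → Via e F u v → Star (Joined (e ∷ F)) u v
    via⇒path (inj₁ p)              = weaken p
    via⇒path (inj₂ (inj₁ (p , q))) = weaken p ◅◅ inj₁ (here refl) ◅ weaken q
    via⇒path (inj₂ (inj₂ (p , q))) = weaken p ◅◅ inj₂ (here refl) ◅ weaken q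

    cons-via : ∀ {e F u w v} → Joined (e ∷ F) u w → Via e F w v → Via e F u v
    cons-via (inj₁ (there s))   (inj₁ p)              = inj₁ (inj₁ s ◅ p)
    cons-via (inj₁ (there s))   (inj₂ (inj₁ (p , q))) = inj₂ (inj₁ (inj₁ s ◅ p , q))
    cons-via (inj₁ (there s))   (inj₂ (inj₂ (p , q))) = inj₂ (inj₂ (inj₁ s ◅ p , q))
    cons-via (inj₂ (there s))   (inj₁ p)              = inj₁ (inj₂ s ◅ p)
    cons-via (inj₂ (there s))   (inj₂ (inj₁ (p , q))) = inj₂ (inj₁ (inj₂ s ◅ p , q))
    cons-via (inj₂ (there s))   (inj₂ (inj₂ (p , q))) = inj₂ (inj₂ (inj₂ s ◅ p , q))
    cons-via (inj₁ (here refl)) (inj₁ p)              = inj₂ (inj₁ (ε , p))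
    cons-via (inj₁ (here refl)) (inj₂ (inj₁ (p , q))) = inj₂ (inj₁ (ε , q))
    cons-via (inj₁ (here refl)) (inj₂ (inj₂ (p , q))) = inj₁ q
    cons-via (inj₂ (here refl)) (inj₁ p)              = inj₂ (inj₂ (ε , p))
    cons-via (inj₂ (here refl)) (inj₂ (inj₁ (p , q))) = inj₁ q
    cons-via (inj₂ (here refl)) (inj₂ (inj₂ (p , q))) = inj₂ (inj₂ (ε , q))

    path⇒via : ∀ {e F u v} → Star (Joined (e ∷ F)) u v → Via e F u v
    path⇒via ε       = inj₁ ε
    path⇒via (s ◅ p) = cons-via s (path⇒via p)

    path? : ∀ F u v → Dec (Star (Joined F) u v)
    path? [] u v = map′ (λ { refl → ε }) empty (u Fin.≟ v)
      where
      empty : ∀ {u v} → Star (Joined []) u v → u ≡ v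
      empty ε               = refl
      empty (inj₁ () ◅ _)
      empty (inj₂ () ◅ _)
    path? (e@(a , b) ∷ F) u v = map′ via⇒path path⇒via
      (path? F u v ⊎-dec (path? F u a ×-dec path? F b v)
                   ⊎-dec (path? F u b ×-dec path? F a v))

    connected? : Decidable Connected
    connected? F = Fin.all? λ u → Fin.all? λ v → path? F u v

    isCycle? : ∀ F → Decidable (IsCycle F)
    isCycle? F []       = no λ ()
    isCycle? F (v ∷ vs) =
      (2 ℕ.≤? length vs) ×-dec unique? (v ∷ vs) ×-dec linked? (joined? F) (v ∷ (vs ∷ʳ v))
      where open DecUnique (Fin._≟_ {n}) using (unique?)

    lookup-injective : ∀ {xs : List (Fin n)} → Unique xs →
                       ∀ {i j} → lookup xs i ≡ lookup xs j → i ≡ j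
    lookup-injective {x ∷ xs} (x∉ ∷ u) {zero}  {zero}  eq = refl
    lookup-injective {x ∷ xs} (x∉ ∷ u) {zero}  {suc j} eq =
      contradiction eq (All.lookup x∉ (∈-lookup {xs = xs} j))
    lookup-injective {x ∷ xs} (x∉ ∷ u) {suc i} {zero}  eq =
      contradiction (sym eq) (All.lookup x∉ (∈-lookup {xs = xs} i))
    lookup-injective {x ∷ xs} (x∉ ∷ u) {suc i} {suc j} eq =
      cong suc (lookup-injective u eq)

    unique⇒short : ∀ {xs : List (Fin n)} → Unique xs → length xs ℕ.≤ n
    unique⇒short u = Fin.injective⇒≤ (lookup-injective u)

    cycle⇒short : ∀ {F} c → IsCycle F c → length c ℕ.≤ n
    cycle⇒short (v ∷ vs) (_ , u , _) = unique⇒short u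

    anyShort? : ∀ k {P : Pred (List (Fin n)) 0ℓ} → Decidable P →
                Dec (∃[ xs ] length xs ℕ.≤ k × P xs)
    anyShort? zero {P} P? = map′ (λ p → [] , z≤n , p) nil (P? [])
      where
      nil : (∃[ xs ] length xs ℕ.≤ 0 × P xs) → P []
      nil ([] , _ , p) = p
    anyShort? (suc k) {P} P? = map′ to from
      (P? [] ⊎-dec Fin.any? λ x → anyShort? k (P? ∘ (x ∷_)))
      where
      to : P [] ⊎ (∃[ x ] ∃[ xs ] length xs ℕ.≤ k × P (x ∷ xs)) →
           ∃[ xs ] length xs ℕ.≤ suc k × P xs
      to (inj₁ p)                = [] , z≤n , p
      to (inj₂ (x , xs , l , p)) = x ∷ xs , s≤s l , p
      from : (∃[ xs ] length xs ℕ.≤ suc k × P xs) →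
             P [] ⊎ (∃[ x ] ∃[ xs ] length xs ℕ.≤ k × P (x ∷ xs))
      from ([] , _ , p)           = inj₁ p
      from (x ∷ xs , s≤s l , p)   = inj₂ (x , xs , l , p)

    acyclic? : Decidable Acyclic
    acyclic? F = ¬? (map′ (λ (c , _ , p) → c , p)
                          (λ (c , p) → c , cycle⇒short c p , p)
                          (anyShort? n (isCycle? F)))

  isTree? : Decidable IsTree
  isTree? F = connected? F ×-dec acyclic? F

sublists : ∀ {a} {A : Set a} → List A → List (List A)
sublists []       = [] ∷ []
sublists (x ∷ xs) = sublists xs ++ map (x ∷_) (sublists xs)

-- Each edge occurs exactly once, as the pair (u , v) with u < v.
edges : ∀ {n} → Graph n → List (Edge {n})
edges {n} G = filter (λ (u , v) → (u Fin.<? v) ×-dec (adj G u v Bool.≟ true))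
                     (cartesianProduct (allFin n) (allFin n))

-- Since `edges G` has no repetitions, its sublists are its subsets.
τ : ∀ {n} → Graph n → ℕ
τ G = length (filter isTree? (sublists (edges G)))

{-# OPTIONS --safe #-}

-- For vectors u and z, a graph on at least one vertex with Laplacian L and τ
-- spanning trees satisfies det (u zᵀ + L) = (Σ u) (Σ z) τ.  This follows by
-- deletion and contraction: an edge changes L by a rank-one matrix, and the
-- resulting change of the determinant is the determinant belonging to the
-- contracted graph.  For the join of G₁ and G₂ let u and z be the indicators of
-- V(G₁) and V(G₂); then u zᵀ cancels an off-diagonal block of L and
--   ν₁ ν₂ τ = det (ν₂ + L₁) det (ν₁ + L₂).
-- For a semi-regular bipartite graph, ν + L has the form [[a, -B], [-Bᵀ, b]].
-- Its determinant F a b satisfies s^n₂ F (s a) b = s^n₁ F a (s b), so that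
-- F (s² b) b is determined by F x x, the characteristic polynomial at x = s b.
-- Since F is polynomial, F a b = a^(n₁ - k) b^(n₂ - k) ∏ (a b - λᵢ²) for all a.
-- The factor of the largest eigenvalue is ν (q₁ + q₂ + ν), which cancels ν₁ ν₂.

module Submission where

open import Algebra.Bundles using (CommutativeRing)
open import Data.Bool.Base using (Bool; true; false; not; if_then_else_)
import Data.Bool.Properties as Bool
open import Data.Empty using (⊥)
open import Data.Fin.Base as Fin
  using (Fin; zero; suc; toℕ; punchIn; punchOut; pinch; splitAt; _↑ˡ_; _↑ʳ_)
import Data.Fin.Properties as Fin
open import Data.Fin.Subset using (Subset; ∣_∣) renaming (_∈_ to _∈ˢ_)
import Data.Fin.Subset.Properties as Subset
open import Data.Integer.Base as ℤ using (+_)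
import Data.Integer.Properties as ℤ
open import Data.List.Base
  using (List; []; _∷_; _++_; _∷ʳ_; map; filter; foldr; length; replicate; tabulate;
         allFin; cartesianProduct)
open import Data.List.Membership.Propositional using (_∈_)
open import Data.List.Membership.Propositional.Properties
  using (∈-map⁺; ∈-map⁻; ∈-∃++; ∈-++⁻; ∈-++⁺ˡ; ∈-++⁺ʳ)
import Data.List.Membership.DecPropositional as DecMembership
open import Data.List.Properties
  using (length-map; length-++; length-replicate; filter-accept; filter-reject; filter-++;
         map-++; map-id)
open import Data.List.Relation.Unary.All as All using (All; []; _∷_)
import Data.List.Relation.Unary.All.Properties as All
open import Data.List.Relation.Unary.AllPairs using ([]; _∷_)
open import Data.List.Relation.Unary.Any using (here; there)
open import Data.List.Relation.Unary.Linked as Linked using (Linked; [-]; _∷_)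
open import Data.List.Relation.Unary.Unique.Propositional using (Unique)
import Data.List.Relation.Unary.Unique.Propositional.Properties as Unique
open import Data.Nat.Base as ℕ using (ℕ; zero; suc; z≤n; s≤s)
import Data.Nat.Coprimality as Coprime
import Data.Nat.Properties as ℕ
import Data.Nat.Solver as ℕ-Solver
open import Data.Product.Base using (∃-syntax; _×_; _,_; proj₁; proj₂)
open import Data.Rational.Base as ℚ using (ℚ; 0ℚ; 1ℚ; ½; positive; nonNegative)
import Data.Rational.Properties as ℚ
import Data.Rational.Solver as ℚ-Solver
open import Data.Sum.Base using (_⊎_; inj₁; inj₂; [_,_]′)
import Data.Vec.Base as Vec
import Data.Vec.Properties as Vec
open import Function.Base using (_∘_; id; const)
open import Function.Bundles using (_⇔_; mk⇔; Equivalence)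
open import Level using (0ℓ)
open import Relation.Binary.Construct.Closure.ReflexiveTransitive as Closure
  using (Star; kleisliStar)
open import Relation.Binary.Definitions using (tri<; tri≈; tri>)
open import Relation.Binary.PropositionalEquality as ≡ using (_≡_; _≢_)
open import Relation.Nullary.Decidable
  using (Dec; yes; no; does; dec-true; dec-false; map′; _×-dec_)
open import Relation.Nullary.Negation using (¬_; contradiction)
open import Relation.Unary using (Pred; Decidable)
open import Defs hiding (Matrix; det)

-- Equality of Cauchy reals is undecidable, and reciprocals and square roots would have to be
-- constructed. The algebra is therefore done over any commutative ring, and division is replaced by
-- cancelling elements that are not zero divisors; in ℝ the positive numbers are such. The
-- characteristic polynomial gives F x x, and reaching F a b through it would take x = √(a b). This
-- is why a is restricted to s² b, where the root is s b. For positive integers s and b these values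
-- of a form an increasing sequence of integers, enough to determine a polynomial function of a. The
-- exponents are truncated differences, so k ≤ n₁ must be proved; it comes from the same scaling
-- law, evaluated at s = 0. Contraction creates loops and parallel edges, so the recursion runs over
-- edge lists. Acyclicity is useless there: a cycle has at least three vertices and does not see
-- repeated edges. Trees are therefore first recounted as connected edge lists with one edge fewer
-- than vertices, a criterion that contraction respects.

private
  module ℕS = ℕ-Solver.+-*-Solver

-- Finite sums, exchange of index pairs and signs

module Determinants {c ℓ} (R : CommutativeRing c ℓ) where

  open CommutativeRing R hiding (zero)
  open Determinant rawRing using (Matrix; det)
  open import Algebra.Properties.Semiring.Sum semiring
    using (sum; sum-cong-≋; sum-replicate-zero; ∑-distrib-+; ∑-comm; sum-remove;
           *-distribˡ-sum; *-distribʳ-sum)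
  open import Algebra.Properties.CommutativeMonoid.Sum *-commutativeMonoid public
    using () renaming (sum to product)
  open import Algebra.Properties.Semiring.Exp semiring using (_^_; ^-homo-*)
  open import Algebra.Properties.Ring ring
    using (-1*x≈-x; -‿involutive)
  open import Algebra.Solver.Ring.NaturalCoefficients.Default commutativeSemiring
    using (solve; _:=_; _:+_; _:*_; con)
  open import Relation.Binary.Reasoning.Setoid setoid

  sum-cong : ∀ {n} {f g : Fin n → Carrier} → (∀ i → f i ≈ g i) → sum f ≈ sum g
  sum-cong = sum-cong-≋

  sum-zero : ∀ {n} {f : Fin n → Carrier} → (∀ i → f i ≈ 0#) → sum f ≈ 0#
  sum-zero {n} f≈0 = trans (sum-cong f≈0) (sum-replicate-zero n)

  sum² : ∀ {m n} → (Fin m → Fin n → Carrier) → Carrier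
  sum² g = sum λ i → sum (g i)

  sum²-cong : ∀ {m n} {f g : Fin m → Fin n → Carrier} →
              (∀ i j → f i j ≈ g i j) → sum² f ≈ sum² g
  sum²-cong f≈g = sum-cong λ i → sum-cong (f≈g i)

  δ : ∀ {n} → Fin n → Fin n → Carrier
  δ i j = if does (i Fin.≟ j) then 1# else 0#

  δ-refl : ∀ {n} (i : Fin n) → δ i i ≈ 1#
  δ-refl i rewrite dec-true (i Fin.≟ i) ≡.refl = refl

  δ-≢ : ∀ {n} {i j : Fin n} → i ≢ j → δ i j ≈ 0#
  δ-≢ {i = i} {j} i≢j rewrite dec-false (i Fin.≟ j) i≢j = refl

  δ-sym : ∀ {n} (i j : Fin n) → δ i j ≈ δ j i
  δ-sym i j with i Fin.≟ j
  ... | yes ≡.refl = sym (δ-refl i)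
  ... | no i≢j = sym (δ-≢ (i≢j ∘ ≡.sym))

  sum-δ : ∀ {n} (a : Fin n) (f : Fin n → Carrier) → sum (λ i → δ i a * f i) ≈ f a
  sum-δ {suc n} a f = begin
    sum (λ i → δ i a * f i)
      ≈⟨ sum-remove {i = a} (λ i → δ i a * f i) ⟩
    δ a a * f a + sum (λ i → δ (punchIn a i) a * f (punchIn a i))
      ≈⟨ +-cong (trans (*-congʳ (δ-refl a)) (*-identityˡ _))
                (sum-zero λ i → trans (*-congʳ (δ-≢ (Fin.punchInᵢ≢i a i))) (zeroˡ _)) ⟩
    f a + 0#
      ≈⟨ +-identityʳ _ ⟩
    f a ∎

  -- An ordered pair of distinct indices is j together with l, standing for
  -- punchIn j l; exchanging its components gives punchIn j l and pinch l j.
  private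
    sum²-split : ∀ {m n} (g : Fin (suc m) → Fin (suc n) → Carrier) →
      sum² g ≈ sum (g zero) + (sum (λ j → g (suc j) zero)
                               + sum² (λ j l → g (suc j) (suc l)))
    sum²-split g = +-congˡ (∑-distrib-+ (λ j → g (suc j) zero)
                                        (λ j → sum λ l → g (suc j) (suc l)))

  sum²-exchange : ∀ {n} (g : Fin (suc n) → Fin n → Carrier) →
    sum² g ≈ sum² (λ j l → g (punchIn j l) (pinch l j))
  sum²-exchange {zero}  g = refl
  sum²-exchange {suc n} g = begin
    sum² g
      ≈⟨ sum²-split g ⟩
    sum (g zero) + (sum (λ j → g (suc j) zero) + sum² (λ j l → g (suc j) (suc l)))
      ≈⟨ solve 3 (λ a b c → a :+ (b :+ c) := b :+ (a :+ c)) refl _ _ _ ⟩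
    sum (λ j → g (suc j) zero) + (sum (g zero) + sum² (λ j l → g (suc j) (suc l)))
      ≈⟨ +-congˡ (+-congˡ (sum²-exchange λ j l → g (suc j) (suc l))) ⟩
    sum (λ j → g (suc j) zero)
      + (sum (g zero) + sum² (λ j l → g (suc (punchIn j l)) (suc (pinch l j))))
      ≈⟨ sum²-split (λ j l → g (punchIn j l) (pinch l j)) ⟨
    sum² (λ j l → g (punchIn j l) (pinch l j)) ∎

  -- The exchange has no fixed points, so the terms cancel in pairs: those of `g zero` against those
  -- of column `zero`, the rest by recursion. Comparing the sum with its exchanged form as a whole
  -- would only show that twice the sum vanishes.
  sum²-alternating : ∀ {n} (g : Fin (suc n) → Fin n → Carrier) →
    (∀ j l → g j l + g (punchIn j l) (pinch l j) ≈ 0#) → sum² g ≈ 0#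
  sum²-alternating {zero}  g alt = +-identityʳ 0#
  sum²-alternating {suc n} g alt = begin
    sum² g
      ≈⟨ sum²-split g ⟩
    sum (g zero) + (sum (λ j → g (suc j) zero) + sum² (λ j l → g (suc j) (suc l)))
      ≈⟨ +-assoc _ _ _ ⟨
    sum (g zero) + sum (λ j → g (suc j) zero) + sum² (λ j l → g (suc j) (suc l))
      ≈⟨ +-cong (sym (∑-distrib-+ (g zero) (λ j → g (suc j) zero)))
                (sum²-alternating (λ j l → g (suc j) (suc l)) λ j l → alt (suc j) (suc l)) ⟩
    sum (λ j → g zero j + g (suc j) zero) + 0#
      ≈⟨ +-congʳ (sum-zero (alt zero)) ⟩
    0# + 0#
      ≈⟨ +-identityʳ 0# ⟩
    0# ∎

  sgn : ℕ → Carrier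
  sgn i = (- 1#) ^ i

  -1*-1≈1 : - 1# * - 1# ≈ 1#
  -1*-1≈1 = trans (-1*x≈-x (- 1#)) (-‿involutive 1#)

  sgn-double : ∀ i → sgn (i ℕ.+ i) ≈ 1#
  sgn-double zero    = refl
  sgn-double (suc i) = begin
    - 1# * sgn (i ℕ.+ suc i)    ≡⟨ ≡.cong (λ k → - 1# * sgn k) (ℕ.+-suc i i) ⟩
    - 1# * (- 1# * sgn (i ℕ.+ i)) ≈⟨ *-assoc _ _ _ ⟨
    - 1# * - 1# * sgn (i ℕ.+ i)  ≈⟨ *-cong -1*-1≈1 (sgn-double i) ⟩
    1# * 1#                      ≈⟨ *-identityˡ 1# ⟩
    1# ∎

  -- For j ≤ l the pair (j, l) becomes (l + 1, j), otherwise (l, j - 1). Either way the sum j + l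
  -- changes by exactly one.
  sgn-exchange : ∀ {n} (j : Fin (suc n)) (l : Fin n) →
    sgn (toℕ (punchIn j l)) * sgn (toℕ (pinch l j))
      ≈ - 1# * (sgn (toℕ j) * sgn (toℕ l))
  sgn-exchange {suc n} zero l =
    solve 2 (λ e x → (e :* x) :* con 1 := e :* (con 1 :* x)) refl (- 1#) (sgn (toℕ l))
  sgn-exchange {suc n} (suc j) zero = begin
    1# * sgn (toℕ j)                       ≈⟨ *-congʳ -1*-1≈1 ⟨
    - 1# * - 1# * sgn (toℕ j)
      ≈⟨ solve 2 (λ e x → e :* e :* x := e :* ((e :* x) :* con 1)) refl (- 1#) (sgn (toℕ j)) ⟩
    - 1# * (- 1# * sgn (toℕ j) * 1#) ∎
  sgn-exchange {suc n} (suc j) (suc l) = begin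
    - 1# * sgn (toℕ (punchIn j l)) * (- 1# * sgn (toℕ (pinch l j)))
      ≈⟨ solve 3 (λ e x y → e :* x :* (e :* y) := e :* e :* (x :* y)) refl (- 1#) _ _ ⟩
    - 1# * - 1# * (sgn (toℕ (punchIn j l)) * sgn (toℕ (pinch l j)))
      ≈⟨ *-congˡ (sgn-exchange j l) ⟩
    - 1# * - 1# * (- 1# * (sgn (toℕ j) * sgn (toℕ l)))
      ≈⟨ solve 3 (λ e x y → e :* e :* (e :* (x :* y)) := e :* ((e :* x) :* (e :* y)))
               refl (- 1#) _ _ ⟩
    - 1# * (- 1# * sgn (toℕ j) * (- 1# * sgn (toℕ l))) ∎

  -- The same two columns are deleted in either order, which identifies the twofold minors of the
  -- two expansions.
  punchIn-exchange : ∀ {n} (j : Fin (suc (suc n))) (l : Fin (suc n)) (k : Fin n) →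
    punchIn (punchIn j l) (punchIn (pinch l j) k) ≡ punchIn j (punchIn l k)
  punchIn-exchange zero    l       k       = ≡.refl
  punchIn-exchange (suc j) zero    k       = ≡.refl
  punchIn-exchange (suc j) (suc l) zero    = ≡.refl
  punchIn-exchange (suc j) (suc l) (suc k) = ≡.cong suc (punchIn-exchange j l k)

  punchIn-pinch : ∀ {n} (j : Fin (suc n)) (l : Fin n) →
    punchIn (punchIn j l) (pinch l j) ≡ j
  punchIn-pinch {suc n} zero    l       = ≡.refl
  punchIn-pinch {suc n} (suc j) zero    = ≡.refl
  punchIn-pinch {suc n} (suc j) (suc l) = ≡.cong suc (punchIn-pinch j l)

  -- Laplace expansion along any row and along the first column

  minor : ∀ {n} → Matrix (suc n) → Fin (suc n) → Fin (suc n) → Matrix n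
  minor M i j k l = M (punchIn i k) (punchIn j l)

  det-cong : ∀ {n} {A B : Matrix n} → (∀ i j → A i j ≈ B i j) → det A ≈ det B
  det-cong {zero}  A≈B = refl
  det-cong {suc n} A≈B = sum-cong λ j →
    *-cong (*-congˡ {sgn (toℕ j)} (A≈B zero j)) (det-cong λ i k → A≈B (suc i) (punchIn j k))

  cofactorExpansion : ∀ {n} → Matrix (suc n) → Fin (suc n) → Carrier
  cofactorExpansion M i =
    sum λ j → (sgn (toℕ i ℕ.+ toℕ j) * M i j) * det (minor M i j)

  private
    -- The terms of the expansion along row 0 and then row suc i, and along
    -- row suc i and then row 0.
    module _ {n} (M : Matrix (suc (suc n))) (i : Fin (suc n)) where

      X : Fin (suc (suc n)) → Fin (suc n) → Carrier
      X j l = det (minor (minor M zero j) i l)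

      top lower : Fin (suc (suc n)) → Fin (suc n) → Carrier
      top j l = (sgn (toℕ j) * M zero j)
              * ((sgn (toℕ i ℕ.+ toℕ l) * M (suc i) (punchIn j l)) * X j l)
      lower j l = (sgn (suc (toℕ i) ℕ.+ toℕ j) * M (suc i) j)
                * ((sgn (toℕ l) * M zero (punchIn j l)) * X j l)

      top-exchange : ∀ j l → top (punchIn j l) (pinch l j) ≈ lower j l
      top-exchange j l = begin
        top (punchIn j l) (pinch l j)
          ≈⟨ *-congˡ (*-cong
               (*-cong (^-homo-* (- 1#) (toℕ i) (toℕ (pinch l j)))
                       (reflexive (≡.cong (M (suc i)) (punchIn-pinch j l))))
               (det-cong λ a b → reflexive
                 (≡.cong (M (suc (punchIn i a))) (punchIn-exchange j l b)))) ⟩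
        sgn (toℕ (punchIn j l)) * M zero (punchIn j l)
          * (sgn (toℕ i) * sgn (toℕ (pinch l j)) * M (suc i) j * X j l)
          ≈⟨ solve 6 (λ s t u x y z → s :* x :* (u :* t :* y :* z)
                                    := (s :* t) :* (x :* (u :* y :* z)))
               refl (sgn (toℕ (punchIn j l))) (sgn (toℕ (pinch l j))) (sgn (toℕ i)) _ _ _ ⟩
        sgn (toℕ (punchIn j l)) * sgn (toℕ (pinch l j))
          * (M zero (punchIn j l) * (sgn (toℕ i) * M (suc i) j * X j l))
          ≈⟨ *-congʳ (sgn-exchange j l) ⟩
        - 1# * (sgn (toℕ j) * sgn (toℕ l))
          * (M zero (punchIn j l) * (sgn (toℕ i) * M (suc i) j * X j l))
          ≈⟨ solve 7 (λ e s t u x y z → e :* (s :* t) :* (x :* (u :* y :* z))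
                                      := e :* (u :* s) :* y :* (t :* x :* z))
               refl (- 1#) (sgn (toℕ j)) (sgn (toℕ l)) (sgn (toℕ i)) _ _ _ ⟩
        - 1# * (sgn (toℕ i) * sgn (toℕ j)) * M (suc i) j
          * (sgn (toℕ l) * M zero (punchIn j l) * X j l)
          ≈⟨ *-congʳ (*-congʳ (*-congˡ (^-homo-* (- 1#) (toℕ i) (toℕ j)))) ⟨
        lower j l ∎

  -- Mutual recursion with `expand-top`. After the expansion along row 0, the old row `suc i` is row
  -- `i` of every minor, where the induction hypothesis applies. Exchanging the two deleted columns
  -- then yields the terms of an expansion that starts with row `suc i`.
  expand-row : ∀ {n} (M : Matrix (suc n)) i → det M ≈ cofactorExpansion M i
  private
    expand-top : ∀ {n} (M : Matrix (suc (suc n))) i → det M ≈ sum² (top M i)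

  expand-row         M zero    = refl
  expand-row {suc n} M (suc i) = begin
    det M
      ≈⟨ expand-top M i ⟩
    sum² (top M i)
      ≈⟨ sum²-exchange (top M i) ⟩
    sum² (λ j l → top M i (punchIn j l) (pinch l j))
      ≈⟨ sum²-cong (top-exchange M i) ⟩
    sum² (lower M i)
      ≈⟨ sum-cong (λ j → *-distribˡ-sum (sgn (suc (toℕ i) ℕ.+ toℕ j) * M (suc i) j)
           λ l → (sgn (toℕ l) * M zero (punchIn j l)) * X M i j l) ⟨
    cofactorExpansion M (suc i) ∎

  expand-top M i = sum-cong λ j →
    trans (*-congˡ {sgn (toℕ j) * M zero j} (expand-row (minor M zero j) i))
          (*-distribˡ-sum (sgn (toℕ j) * M zero j) λ l →
            (sgn (toℕ i ℕ.+ toℕ l) * M (suc i) (punchIn j l)) * X M i j l)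

  private
    -- Exchanging the deleted columns keeps the twofold minor and flips the sign. The two entries
    -- trade rows, which makes no difference when the rows are equal, so the double sum is
    -- alternating.
    det-equal-top : ∀ {n} (M : Matrix (suc n)) i →
      (∀ k → M zero k ≈ M (suc i) k) → det M ≈ 0#
    det-equal-top {suc n} M i eq = trans (expand-top M i)
      (sum²-alternating (top M i) λ j l →
        trans (+-congˡ (trans (top-exchange M i j l) (lower≈-top j l))) (-‿inverseʳ _))
      where
      lower≈-top : ∀ j l → lower M i j l ≈ - top M i j l
      lower≈-top j l = begin
        lower M i j l
          ≈⟨ *-cong (*-cong (*-congˡ (^-homo-* (- 1#) (toℕ i) (toℕ j))) (sym (eq j)))
                    (*-congʳ (*-congˡ (eq (punchIn j l)))) ⟩
        - 1# * (sgn (toℕ i) * sgn (toℕ j)) * M zero j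
          * (sgn (toℕ l) * M (suc i) (punchIn j l) * X M i j l)
          ≈⟨ solve 7 (λ e s t u x y z → e :* (u :* s) :* x :* (t :* y :* z)
                                      := e :* (s :* x :* (u :* t :* y :* z)))
               refl (- 1#) (sgn (toℕ j)) (sgn (toℕ l)) (sgn (toℕ i)) _ _ _ ⟩
        - 1# * (sgn (toℕ j) * M zero j
          * (sgn (toℕ i) * sgn (toℕ l) * M (suc i) (punchIn j l) * X M i j l))
          ≈⟨ -1*x≈-x _ ⟩
        - (sgn (toℕ j) * M zero j
          * (sgn (toℕ i) * sgn (toℕ l) * M (suc i) (punchIn j l) * X M i j l))
          ≈⟨ -‿cong (*-congˡ (*-congʳ (*-congʳ (^-homo-* (- 1#) (toℕ i) (toℕ l))))) ⟨
        - top M i j l ∎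

  det-equal-rows : ∀ {n} (M : Matrix n) {i j} → i ≢ j →
    (∀ k → M i k ≈ M j k) → det M ≈ 0#
  det-equal-rows M {zero}  {zero}  i≢j eq = contradiction ≡.refl i≢j
  det-equal-rows M {zero}  {suc j} i≢j eq = det-equal-top M j eq
  det-equal-rows M {suc i} {zero}  i≢j eq = det-equal-top M i (sym ∘ eq)
  det-equal-rows M {suc i} {suc j} i≢j eq = sum-zero λ k →
    trans (*-congˡ {sgn (toℕ k) * M zero k} (det-equal-rows (minor M zero k) (i≢j ∘ ≡.cong suc)
                                   (eq ∘ punchIn k)))
          (zeroʳ _)

  -- The corner entry contributes the same term to both expansions. In every other term the minor is
  -- expanded along its first column by induction, and the double sum is read in the other order.
  expand-column : ∀ {n} (M : Matrix (suc n)) →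
    det M ≈ sum λ i → (sgn (toℕ i) * M i zero) * det (minor M i zero)
  expand-column {zero}  M = refl
  expand-column {suc n} M = +-congˡ (begin
    sum (λ j → a j * det (minor M zero (suc j)))
      ≈⟨ sum-cong (λ j → trans (*-congˡ (expand-column (minor M zero (suc j))))
                               (*-distribˡ-sum (a j) λ i → (sgn (toℕ i) * M (suc i) zero) * D i j)) ⟩
    sum² (λ j i → a j * ((sgn (toℕ i) * M (suc i) zero) * D i j))
      ≈⟨ ∑-comm (λ j i → a j * ((sgn (toℕ i) * M (suc i) zero) * D i j)) ⟩
    sum² (λ i j → a j * ((sgn (toℕ i) * M (suc i) zero) * D i j))
      ≈⟨ sum²-cong (λ i j →
           solve 6 (λ e s t x y z → e :* s :* x :* (t :* y :* z)
                                  := e :* t :* y :* (s :* x :* z))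
             refl (- 1#) (sgn (toℕ j)) (sgn (toℕ i)) (M zero (suc j)) (M (suc i) zero) (D i j)) ⟩
    sum² (λ i j → b i * ((sgn (toℕ j) * M zero (suc j)) * D i j))
      ≈⟨ sum-cong (λ i → *-distribˡ-sum (b i) λ j → (sgn (toℕ j) * M zero (suc j)) * D i j) ⟨
    sum (λ i → b i * det (minor M (suc i) zero)) ∎)
    where
    a b : Fin (suc n) → Carrier
    a j = sgn (suc (toℕ j)) * M zero (suc j)
    b i = sgn (suc (toℕ i)) * M (suc i) zero
    D : Fin (suc n) → Fin (suc n) → Carrier
    D i j = det (λ k l → M (suc (punchIn i k)) (suc (punchIn j l)))

  det-transpose : ∀ {n} (M : Matrix n) → det (λ i j → M j i) ≈ det M
  det-transpose {zero}  M = refl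
  det-transpose {suc n} M = begin
    det (λ i j → M j i)
      ≈⟨ sum-cong (λ j → *-congˡ {sgn (toℕ j) * M j zero} (det-transpose (minor M j zero))) ⟩
    sum (λ i → (sgn (toℕ i) * M i zero) * det (minor M i zero))
      ≈⟨ expand-column M ⟨
    det M ∎

  det-row-+ : ∀ {n} (A B C : Matrix n) r →
    (∀ j → C r j ≈ A r j + B r j) →
    (∀ i → i ≢ r → ∀ j → C i j ≈ A i j) → (∀ i → i ≢ r → ∀ j → C i j ≈ B i j) →
    det C ≈ det A + det B
  det-row-+ {suc n} A B C r C≈A+B C≈A C≈B = begin
    det C
      ≈⟨ expand-row C r ⟩
    cofactorExpansion C r
      ≈⟨ sum-cong (λ j → trans
           (*-congʳ (trans (*-congˡ {sgn (toℕ r ℕ.+ toℕ j)} (C≈A+B j)) (distribˡ _ _ _)))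
           (trans (distribʳ _ _ _)
             (+-cong (*-congˡ (det-cong λ k l → C≈A (punchIn r k) (Fin.punchInᵢ≢i r k) (punchIn j l)))
                     (*-congˡ (det-cong λ k l → C≈B (punchIn r k) (Fin.punchInᵢ≢i r k) (punchIn j l)))))) ⟩
    sum (λ j → (sgn (toℕ r ℕ.+ toℕ j) * A r j) * det (minor A r j)
             + (sgn (toℕ r ℕ.+ toℕ j) * B r j) * det (minor B r j))
      ≈⟨ ∑-distrib-+ (λ j → (sgn (toℕ r ℕ.+ toℕ j) * A r j) * det (minor A r j))
                     (λ j → (sgn (toℕ r ℕ.+ toℕ j) * B r j) * det (minor B r j)) ⟩
    cofactorExpansion A r + cofactorExpansion B r
      ≈⟨ +-cong (expand-row A r) (expand-row B r) ⟨
    det A + det B ∎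

  -- Row operations, scaling and block triangular matrices

  replaceRow : ∀ {n} → Matrix n → Fin n → (Fin n → Carrier) → Matrix n
  replaceRow M r v i j = if does (i Fin.≟ r) then v j else M i j

  replaceRow-at : ∀ {n} (M : Matrix n) r v j → replaceRow M r v r j ≈ v j
  replaceRow-at M r v j rewrite dec-true (r Fin.≟ r) ≡.refl = refl

  replaceRow-≢ : ∀ {n} (M : Matrix n) {r} v {i} → i ≢ r → ∀ j → replaceRow M r v i j ≈ M i j
  replaceRow-≢ M {r} v {i} i≢r j rewrite dec-false (i Fin.≟ r) i≢r = refl

  det-row-update : ∀ {n} (M : Matrix n) r v →
    det (λ i j → M i j + δ i r * v j) ≈ det M + det (replaceRow M r v)
  det-row-update M r v = det-row-+ M (replaceRow M r v) _ r
    (λ j → +-congˡ (trans (trans (*-congʳ (δ-refl r)) (*-identityˡ _))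
                          (sym (replaceRow-at M r v j))))
    unchanged
    (λ i i≢r j → trans (unchanged i i≢r j) (sym (replaceRow-≢ M v i≢r j)))
    where
    unchanged : ∀ i → i ≢ r → ∀ j → M i j + δ i r * v j ≈ M i j
    unchanged i i≢r j = trans (+-congˡ (trans (*-congʳ (δ-≢ i≢r)) (zeroˡ _))) (+-identityʳ _)

  det-add-row : ∀ {n} (M : Matrix n) {a b} → a ≢ b →
    det (λ i j → M i j + δ i a * M b j) ≈ det M
  det-add-row M {a} {b} a≢b = begin
    det (λ i j → M i j + δ i a * M b j)
      ≈⟨ det-row-update M a (M b) ⟩
    det M + det (replaceRow M a (M b))
      ≈⟨ +-congˡ (det-equal-rows (replaceRow M a (M b)) a≢b λ k →
           trans (replaceRow-at M a (M b) k) (sym (replaceRow-≢ M (M b) (a≢b ∘ ≡.sym) k))) ⟩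
    det M + 0#
      ≈⟨ +-identityʳ _ ⟩
    det M ∎

  -- By linearity in row `b`, the increment is a determinant whose row `b` is a unit vector; only
  -- the diagonal cofactor survives, and its sign is positive.
  det-add-unit : ∀ {n} (M : Matrix (suc n)) b →
    det (λ i j → M i j + δ i b * δ j b) ≈ det M + det (minor M b b)
  det-add-unit M b = trans (det-row-update M b (λ j → δ j b)) (+-congˡ (begin
    det N
      ≈⟨ expand-row N b ⟩
    sum (λ j → (sgn (toℕ b ℕ.+ toℕ j) * N b j) * det (minor N b j))
      ≈⟨ sum-cong (λ j → trans
           (*-cong (*-congˡ {sgn (toℕ b ℕ.+ toℕ j)} (replaceRow-at M b (λ j → δ j b) j))
             (det-cong λ k l → replaceRow-≢ M (λ j → δ j b) (Fin.punchInᵢ≢i b k) (punchIn j l)))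
           (solve 3 (λ x y z → x :* y :* z := y :* (x :* z)) refl _ _ _)) ⟩
    sum (λ j → δ j b * (sgn (toℕ b ℕ.+ toℕ j) * det (minor M b j)))
      ≈⟨ sum-δ b (λ j → sgn (toℕ b ℕ.+ toℕ j) * det (minor M b j)) ⟩
    sgn (toℕ b ℕ.+ toℕ b) * det (minor M b b)
      ≈⟨ trans (*-congʳ (sgn-double (toℕ b))) (*-identityˡ _) ⟩
    det (minor M b b) ∎))
    where N = replaceRow M b (λ j → δ j b)

  det-scale-rows : ∀ {n} (s : Fin n → Carrier) (M : Matrix n) →
    det (λ i j → s i * M i j) ≈ product s * det M
  det-scale-rows {zero}  s M = sym (*-identityˡ 1#)
  det-scale-rows {suc n} s M = trans
    (sum-cong λ j → trans
      (*-congˡ {sgn (toℕ j) * (s zero * M zero j)} (det-scale-rows (s ∘ suc) (minor M zero j)))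
      (solve 5 (λ e s m p d → e :* (s :* m) :* (p :* d) := s :* p :* (e :* m :* d))
         refl (sgn (toℕ j)) (s zero) (M zero j) (product (s ∘ suc)) _))
    (sym (*-distribˡ-sum (product s) λ j → (sgn (toℕ j) * M zero j) * det (minor M zero j)))

  det-scale-columns : ∀ {n} (s : Fin n → Carrier) (M : Matrix n) →
    det (λ i j → s j * M i j) ≈ product s * det M
  det-scale-columns s M = begin
    det (λ i j → s j * M i j)    ≈⟨ det-transpose (λ i j → s j * M i j) ⟨
    det (λ i j → s i * M j i)    ≈⟨ det-scale-rows s (λ i j → M j i) ⟩
    product s * det (λ i j → M j i) ≈⟨ *-congˡ (det-transpose M) ⟩
    product s * det M ∎

  sum-split : ∀ m {n} (f : Fin (m ℕ.+ n) → Carrier) →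
    sum f ≈ sum (λ i → f (i ↑ˡ n)) + sum (λ j → f (m ↑ʳ j))
  sum-split zero    f = sym (+-identityˡ _)
  sum-split (suc m) f = trans (+-congˡ (sum-split m (f ∘ suc))) (sym (+-assoc _ _ _))

  punchIn-↑ˡ : ∀ {m} n (j : Fin (suc m)) k → punchIn (j ↑ˡ n) (k ↑ˡ n) ≡ punchIn j k ↑ˡ n
  punchIn-↑ˡ n zero    k       = ≡.refl
  punchIn-↑ˡ n (suc j) zero    = ≡.refl
  punchIn-↑ˡ n (suc j) (suc k) = ≡.cong suc (punchIn-↑ˡ n j k)

  punchIn-↑ʳ : ∀ {m n} (j : Fin (suc m)) (k : Fin n) →
    punchIn (j ↑ˡ n) (m ↑ʳ k) ≡ suc m ↑ʳ k
  punchIn-↑ʳ         zero    k = ≡.refl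
  punchIn-↑ʳ {suc m} (suc j) k = ≡.cong suc (punchIn-↑ʳ j k)

  -- Induction on `m`: row zero is supported on the first block of columns, and deleting it together
  -- with such a column leaves a matrix of the same shape.
  det-block-triangular : ∀ m {n} (M : Matrix (m ℕ.+ n)) →
    (∀ i j → M (i ↑ˡ n) (m ↑ʳ j) ≈ 0#) →
    det M ≈ det {m} (λ i j → M (i ↑ˡ n) (j ↑ˡ n)) * det {n} (λ i j → M (m ↑ʳ i) (m ↑ʳ j))
  det-block-triangular zero        M upper = sym (*-identityˡ _)
  det-block-triangular (suc m) {n} M upper = begin
    det M
      ≈⟨ sum-split (suc m) (λ j → (sgn (toℕ j) * M zero j) * det (minor M zero j)) ⟩
    sum (λ j → (sgn (toℕ (j ↑ˡ n)) * M zero (j ↑ˡ n)) * det (minor M zero (j ↑ˡ n)))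
      + sum (λ j → (sgn (toℕ (suc m ↑ʳ j)) * M zero (suc m ↑ʳ j)) * det (minor M zero (suc m ↑ʳ j)))
      ≈⟨ +-cong (sum-cong left) (sum-zero right) ⟩
    sum (λ j → (sgn (toℕ j) * A zero j) * det (minor A zero j) * det B) + 0#
      ≈⟨ +-identityʳ _ ⟩
    sum (λ j → (sgn (toℕ j) * A zero j) * det (minor A zero j) * det B)
      ≈⟨ *-distribʳ-sum (det B) (λ j → (sgn (toℕ j) * A zero j) * det (minor A zero j)) ⟨
    det A * det B ∎
    where
    A : Matrix (suc m)
    A i j = M (i ↑ˡ n) (j ↑ˡ n)
    B : Matrix n
    B i j = M (suc m ↑ʳ i) (suc m ↑ʳ j)
    right : ∀ j → (sgn (toℕ (suc m ↑ʳ j)) * M zero (suc m ↑ʳ j)) * det (minor M zero (suc m ↑ʳ j)) ≈ 0#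
    right j = trans (*-congʳ (trans (*-congˡ (upper zero j)) (zeroʳ _))) (zeroˡ _)
    left : ∀ j → (sgn (toℕ (j ↑ˡ n)) * M zero (j ↑ˡ n)) * det (minor M zero (j ↑ˡ n))
               ≈ (sgn (toℕ j) * A zero j) * det (minor A zero j) * det B
    left j = begin
      (sgn (toℕ (j ↑ˡ n)) * M zero (j ↑ˡ n)) * det (minor M zero (j ↑ˡ n))
        ≈⟨ *-cong (*-congʳ (reflexive (≡.cong sgn (Fin.toℕ-↑ˡ j n))))
             (det-block-triangular m (minor M zero (j ↑ˡ n)) λ i k →
               trans (reflexive (≡.cong (M (suc i ↑ˡ n)) (punchIn-↑ʳ j k))) (upper (suc i) k)) ⟩
      (sgn (toℕ j) * A zero j)
        * (det (λ i k → M (suc i ↑ˡ n) (punchIn (j ↑ˡ n) (k ↑ˡ n)))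
           * det (λ i k → M (suc m ↑ʳ i) (punchIn (j ↑ˡ n) (m ↑ʳ k))))
        ≈⟨ *-congˡ (*-cong
             (det-cong λ i k → reflexive (≡.cong (M (suc i ↑ˡ n)) (punchIn-↑ˡ n j k)))
             (det-cong λ i k → reflexive (≡.cong (M (suc m ↑ʳ i)) (punchIn-↑ʳ j k)))) ⟩
      (sgn (toℕ j) * A zero j) * (det (minor A zero j) * det B)
        ≈⟨ *-assoc _ _ _ ⟨
      (sgn (toℕ j) * A zero j) * det (minor A zero j) * det B ∎

-- Contraction, connectivity and counting of spanning trees

module SpanningTrees where

  open Closure using (ε; _◅_; _◅◅_)
  open ≡ using (refl; sym; trans; cong; subst; module ≡-Reasoning)

  private
    variable
      n k : ℕ

  -- The vertices of the contracted graph are those other than `b`, numbered through `punchIn b`.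
  -- Giving the other endpoint as `a` in this numbering makes it different from `b` by construction.
  contract : Fin (suc n) → Fin n → Fin (suc n) → Fin n
  contract b a u with b Fin.≟ u
  ... | yes _   = a
  ... | no  b≢u = punchOut b≢u

  contract-self : ∀ (b : Fin (suc n)) a → contract b a b ≡ a
  contract-self b a with b Fin.≟ b
  ... | yes _   = refl
  ... | no  b≢b = contradiction refl b≢b

  contract-punchIn : ∀ (b : Fin (suc n)) a i → contract b a (punchIn b i) ≡ i
  contract-punchIn b a i with b Fin.≟ punchIn b i
  ... | yes b≡  = contradiction (sym b≡) (Fin.punchInᵢ≢i b i)
  ... | no  b≢  = trans (Fin.punchOut-cong b refl) (Fin.punchOut-punchIn b)

  data PunchView (b : Fin (suc n)) : Fin (suc n) → Set where
    itself : PunchView b b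
    other  : ∀ i → PunchView b (punchIn b i)

  punchView : ∀ (b u : Fin (suc n)) → PunchView b u
  punchView b u with b Fin.≟ u
  ... | yes refl = itself
  ... | no  b≢u  = subst (PunchView b) (Fin.punchIn-punchOut b≢u) (other (punchOut b≢u))

  contractEdges : Fin (suc n) → Fin n → List (Edge {suc n}) → List (Edge {n})
  contractEdges b a = map λ (u , v) → contract b a u , contract b a v

  Path : List (Edge {n}) → Fin n → Fin n → Set
  Path S = Star (Joined S)

  joined-sym : ∀ {S : List (Edge {n})} {u v} → Joined S u v → Joined S v u
  joined-sym (inj₁ p) = inj₂ p
  joined-sym (inj₂ p) = inj₁ p

  joined-∷ : ∀ {e} {S : List (Edge {n})} {u v} → Joined S u v → Joined (e ∷ S) u v
  joined-∷ (inj₁ p) = inj₁ (there p)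
  joined-∷ (inj₂ p) = inj₂ (there p)

  path-sym : ∀ {S : List (Edge {n})} {u v} → Path S u v → Path S v u
  path-sym = Closure.reverse joined-sym

  path-[] : ∀ {u v : Fin n} → Path [] u v → u ≡ v
  path-[] ε            = refl
  path-[] (inj₁ () ◅ _)
  path-[] (inj₂ () ◅ _)

  module _ (b : Fin (suc n)) (a : Fin n) (S : List (Edge {suc n})) where

    private
      c : Fin (suc n) → Fin n
      c = contract b a
      S⁺ = (punchIn b a , b) ∷ S

      ends-agree : c (punchIn b a) ≡ c b
      ends-agree = trans (contract-punchIn b a a) (sym (contract-self b a))

      project : ∀ {u v} → Joined S⁺ u v → Path (contractEdges b a S) (c u) (c v)
      project (inj₁ (here refl)) = subst (Path _ _) ends-agree ε
      project (inj₂ (here refl)) = subst (Path _ _) (sym ends-agree) ε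
      project (inj₁ (there p))   = inj₁ (∈-map⁺ _ p) ◅ ε
      project (inj₂ (there p))   = inj₂ (∈-map⁺ _ p) ◅ ε

      to-representative : ∀ u → Path S⁺ u (punchIn b (c u))
      to-representative u with punchView b u
      ... | itself  = subst (Path S⁺ b ∘ punchIn b) (sym (contract-self b a))
                            (inj₂ (here refl) ◅ ε)
      ... | other i = subst (Path S⁺ (punchIn b i) ∘ punchIn b)
                            (sym (contract-punchIn b a i)) ε

      lift : ∀ {i j} → Joined (contractEdges b a S) i j → Path S⁺ (punchIn b i) (punchIn b j)
      lift (inj₁ p) with ∈-map⁻ _ p
      ... | (u , v) , uv∈S , refl =
        path-sym (to-representative u) ◅◅ inj₁ (there uv∈S) ◅ to-representative v
      lift (inj₂ p) with ∈-map⁻ _ p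
      ... | (u , v) , uv∈S , refl =
        path-sym (to-representative v) ◅◅ inj₂ (there uv∈S) ◅ to-representative u

    -- Every vertex reaches the representative of its class by at most the added edge, so an edge of
    -- the contracted list lifts to a path between representatives. Conversely the added edge
    -- projects to the empty path.
    connected-contract : Connected S⁺ ⇔ Connected (contractEdges b a S)
    connected-contract = mk⇔
      (λ conn i j → subst₂′ (contract-punchIn b a i) (contract-punchIn b a j)
                      (kleisliStar c project (conn (punchIn b i) (punchIn b j))))
      (λ conn u v → to-representative u
                    ◅◅ kleisliStar (punchIn b) lift (conn (c u) (c v))
                    ◅◅ path-sym (to-representative v))
      where
      subst₂′ : ∀ {i i′ j j′} → i ≡ i′ → j ≡ j′ →
                Path (contractEdges b a S) i j → Path (contractEdges b a S) i′ j′
      subst₂′ refl refl p = p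

  connected-drop-loop : ∀ {x} {S : List (Edge {n})} → Connected ((x , x) ∷ S) → Connected S
  connected-drop-loop {S = S} conn u v = kleisliStar id step (conn u v)
    where
    step : ∀ {u v} → Joined (_ ∷ S) u v → Path S u v
    step (inj₁ (here refl)) = ε
    step (inj₂ (here refl)) = ε
    step (inj₁ (there p))   = inj₁ p ◅ ε
    step (inj₂ (there p))   = inj₂ p ◅ ε

  connected-∷ : ∀ {e} {S : List (Edge {n})} → Connected S → Connected (e ∷ S)
  connected-∷ conn u v = Closure.map joined-∷ (conn u v)

  module _ {x y : Fin (suc n)} (y≢x : y ≢ x) (S : List (Edge {suc n})) where

    connected-contract-≢ : Connected ((x , y) ∷ S) ⇔ Connected (contractEdges y (punchOut y≢x) S)
    connected-contract-≢ =
      subst (λ x → Connected ((x , y) ∷ S) ⇔ Connected (contractEdges y (punchOut y≢x) S))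
            (Fin.punchIn-punchOut y≢x) (connected-contract y (punchOut y≢x) S)

  connected⇒≤ : (S : List (Edge {n})) → Connected S → n ℕ.≤ suc (length S)
  connected⇒≤ {zero}  S conn = z≤n
  connected⇒≤ {suc n} = bound
    where
    bound : (S : List (Edge {suc n})) → Connected S → suc n ℕ.≤ suc (length S)
    bound [] conn = s≤s (single conn)
      where
      single : ∀ {n} → Connected {suc n} [] → n ℕ.≤ 0
      single {zero}  conn = z≤n
      single {suc n} conn with path-[] (conn zero (suc zero))
      ... | ()
    bound ((x , y) ∷ S) conn with y Fin.≟ x
    ... | yes refl = ℕ.m≤n⇒m≤1+n (bound S (connected-drop-loop conn))
    ... | no  y≢x  = s≤s (subst (λ l → n ℕ.≤ suc l) (length-map _ S)
        (connected⇒≤ (contractEdges y (punchOut y≢x) S)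
                     (Equivalence.to (connected-contract-≢ y≢x S) conn)))

  connected? : (S : List (Edge {n})) → Dec (Connected S)
  connected? {zero}  S = yes λ ()
  connected? {suc n} = decide
    where
    decide : (S : List (Edge {suc n})) → Dec (Connected S)
    decide [] = single n
      where
      single : ∀ n → Dec (Connected {suc n} [])
      single zero    = yes λ { zero zero → ε }
      single (suc n) = no λ conn → contradiction (path-[] (conn zero (suc zero))) λ ()
    decide ((x , y) ∷ S) with y Fin.≟ x
    ... | yes refl = map′ connected-∷ connected-drop-loop (decide S)
    ... | no  y≢x  = map′ (Equivalence.from iff) (Equivalence.to iff)
                          (connected? (contractEdges y (punchOut y≢x) S))
      where iff = connected-contract-≢ y≢x S

  -- `IsTree` would misjudge the loops and parallel edges that contraction creates, since its cycles
  -- have at least three vertices. Counting edges treats them correctly.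
  SpanningTree : List (Edge {n}) → Set
  SpanningTree {n} S = Connected S × suc (length S) ≡ n

  spanningTree? : Decidable (SpanningTree {n})
  spanningTree? {n} S = connected? S ×-dec (suc (length S) ℕ.≟ n)

  module _ {A : Set} where

    count : {P : Pred A 0ℓ} → Decidable P → List A → ℕ
    count P? xs = length (filter P? xs)

    count-++ : {P : Pred A 0ℓ} (P? : Decidable P) → ∀ xs ys →
               count P? (xs ++ ys) ≡ count P? xs ℕ.+ count P? ys
    count-++ P? xs ys = trans (cong length (filter-++ P? xs ys)) (length-++ (filter P? xs))

  count-map : ∀ {A B : Set} {P : Pred B 0ℓ} {Q : Pred A 0ℓ} (P? : Decidable P) (Q? : Decidable Q)
              (f : A → B) {xs} → All (λ x → P (f x) ⇔ Q x) xs →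
              count P? (map f xs) ≡ count Q? xs
  count-map P? Q? f []                    = refl
  count-map P? Q? f (_∷_ {x} {xs} iff iffs) with Q? x
  ... | yes q = trans (cong length (filter-accept P? (Equivalence.from iff q)))
                      (cong suc (count-map P? Q? f iffs))
  ... | no ¬q = trans (cong length (filter-reject P? (¬q ∘ Equivalence.to iff)))
                      (count-map P? Q? f iffs)

  count-none : ∀ {A : Set} {P : Pred A 0ℓ} (P? : Decidable P) → (∀ x → ¬ P x) →
               ∀ xs → count P? xs ≡ 0
  count-none P? ¬P []       = refl
  count-none P? ¬P (x ∷ xs) = trans (cong length (filter-reject P? (¬P x))) (count-none P? ¬P xs)

  All-const : ∀ {A : Set} {P : Pred A 0ℓ} → (∀ x → P x) → ∀ xs → All P xs
  All-const p xs = All.tabulate λ {x} _ → p x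

  map-compose-∷ : ∀ {A B : Set} (f : A → B) x (xss : List (List A)) →
    map (map f) (map (x ∷_) xss) ≡ map (f x ∷_) (map (map f) xss)
  map-compose-∷ f x []         = refl
  map-compose-∷ f x (xs ∷ xss) = cong (_ ∷_) (map-compose-∷ f x xss)

  sublists-map : ∀ {A B : Set} (f : A → B) xs → sublists (map f xs) ≡ map (map f) (sublists xs)
  sublists-map f []       = refl
  sublists-map f (x ∷ xs) rewrite sublists-map f xs =
    trans (cong (map (map f) (sublists xs) ++_) (sym (map-compose-∷ f x (sublists xs))))
          (sym (map-++ (map f) (sublists xs) _))

  treeCount : List (Edge {n}) → ℕ
  treeCount E = count spanningTree? (sublists E)

  treeCount-[] : ∀ {n} → treeCount {suc (suc n)} [] ≡ 0
  treeCount-[] {n} = cong length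
    (filter-reject (spanningTree? {suc (suc n)}) {x = []} {xs = []} λ { (_ , ()) })

  -- No spanning tree contains the loop: its other n - 2 edges would already connect all n vertices.
  treeCount-loop : ∀ x (E : List (Edge {n})) → treeCount ((x , x) ∷ E) ≡ treeCount E
  treeCount-loop {n} x E = begin
    treeCount ((x , x) ∷ E)
      ≡⟨ count-++ spanningTree? (sublists E) _ ⟩
    treeCount E ℕ.+ count spanningTree? (map ((x , x) ∷_) (sublists E))
      ≡⟨ cong (treeCount E ℕ.+_) (trans
           (count-map spanningTree? (λ _ → no id) ((x , x) ∷_)
             (All-const (λ S → mk⇔ (λ (conn , len) → too-short S conn len) λ ()) (sublists E)))
           (count-none (λ _ → no id) (λ _ ()) (sublists E))) ⟩
    treeCount E ℕ.+ 0
      ≡⟨ ℕ.+-identityʳ _ ⟩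
    treeCount E ∎
    where
    open ≡-Reasoning
    too-short : ∀ S → Connected ((x , x) ∷ S) → suc (suc (length S)) ≡ n → ⊥
    too-short S conn len = ℕ.1+n≰n (subst (ℕ._≤ suc (length S)) (sym len)
      (connected⇒≤ S (connected-drop-loop conn)))

  -- Contraction acts on the list entry by entry, so edges that become parallel remain separate
  -- entries and distinct trees remain distinct.
  treeCount-contract : ∀ (b : Fin (suc n)) a (E : List (Edge {suc n})) →
    treeCount ((punchIn b a , b) ∷ E) ≡ treeCount E ℕ.+ treeCount (contractEdges b a E)
  treeCount-contract {n} b a E = begin
    treeCount ((punchIn b a , b) ∷ E)
      ≡⟨ count-++ spanningTree? (sublists E) _ ⟩
    treeCount E ℕ.+ count spanningTree? (map ((punchIn b a , b) ∷_) (sublists E))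
      ≡⟨ cong (treeCount E ℕ.+_) (trans
           (count-map spanningTree? (spanningTree? ∘ contractEdges b a) _
             (All-const iff (sublists E)))
           (sym (count-map spanningTree? (spanningTree? ∘ contractEdges b a) (contractEdges b a)
             (All-const (λ S → mk⇔ id id) (sublists E))))) ⟩
    treeCount E ℕ.+ count spanningTree? (map (contractEdges b a) (sublists E))
      ≡⟨ cong (λ Ss → treeCount E ℕ.+ count spanningTree? Ss) (sublists-map _ E) ⟨
    treeCount E ℕ.+ treeCount (contractEdges b a E) ∎
    where
    open ≡-Reasoning
    iff : ∀ S → SpanningTree ((punchIn b a , b) ∷ S) ⇔ SpanningTree (contractEdges b a S)
    iff S = mk⇔
      (λ (conn , len) → Equivalence.to (connected-contract b a S) conn
                      , trans (cong suc (length-map _ S)) (ℕ.suc-injective len))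
      (λ (conn , len) → Equivalence.from (connected-contract b a S) conn
                      , cong suc (trans (cong suc (sym (length-map _ S))) len))

  -- Agreement of trees with connected edge lists of n - 1 edges

  data Walk {A : Set} (R : A → A → Set) : A → List A → A → Set where
    []  : ∀ {a} → Walk R a [] a
    _∷_ : ∀ {a w ws b} → R a w → Walk R w ws b → Walk R a (w ∷ ws) b

  walk-map : ∀ {A : Set} {R Q : A → A → Set} → (∀ {u v} → R u v → Q u v) →
             ∀ {a ws b} → Walk R a ws b → Walk Q a ws b
  walk-map f []       = []
  walk-map f (r ∷ w)  = f r ∷ walk-map f w

  walk-close : ∀ {A : Set} {R : A → A → Set} {a ws b c} →
               Walk R a ws b → R b c → Linked R (a ∷ (ws ∷ʳ c))
  walk-close []      r = r ∷ [-]
  walk-close (q ∷ w) r = q ∷ walk-close w r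

  walk-suffix : ∀ {A : Set} {R : A → A → Set} {x a ws b} →
                Walk R a ws b → Unique (a ∷ ws) → x ∈ (a ∷ ws) →
                ∃[ vs ] Walk R x vs b × Unique (x ∷ vs)
  walk-suffix w       u       (here refl) = _ , w , u
  walk-suffix (r ∷ w) (_ ∷ u) (there x∈)  = walk-suffix w u x∈

  -- Loop erasure: if the new starting vertex already occurs on the walk, the walk is cut back to
  -- start at that occurrence.
  simple-walk : ∀ {S : List (Edge {n})} {a b} → Path S a b →
                ∃[ ws ] Walk (Joined S) a ws b × Unique (a ∷ ws)
  simple-walk ε = [] , [] , [] ∷ []
  simple-walk {n} (_◅_ {i = a} {j = v} r p) with simple-walk p
  ... | ws , w , u with DecMembership._∈?_ (Fin._≟_ {n}) a (v ∷ ws)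
  ...   | yes a∈ = walk-suffix w u a∈
  ...   | no  a∉ = v ∷ ws , r ∷ w , All.¬Any⇒All¬ (v ∷ ws) a∉ ∷ u

  Simple : List (Edge {n}) → Set
  Simple F = All (λ (u , v) → u Fin.< v) F × Unique F

  -- The edge closes a simple walk between its ends to a cycle, provided that the walk has at least
  -- two steps. Shorter walks are excluded by `Simple`: the ordering of the ends rules out a loop
  -- and a reversed copy of the edge, uniqueness a second copy.
  acyclic⇒no-path : ∀ {a b} {F : List (Edge {n})} → Simple ((a , b) ∷ F) →
                    Acyclic ((a , b) ∷ F) → ¬ Path F a b
  acyclic⇒no-path {a = a} {b} (a<b ∷ ordered , ab∉F ∷ _) acyclic path with simple-walk path
  ... | [] , [] , _ = Fin.<-irrefl refl a<b
  ... | _ ∷ [] , inj₁ ab∈F ∷ [] , _ = All.lookup ab∉F ab∈F refl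
  ... | _ ∷ [] , inj₂ ba∈F ∷ [] , _ = Fin.<-asym a<b (All.lookup ordered ba∈F)
  ... | ws@(_ ∷ _ ∷ _) , w , u = acyclic
    ( a ∷ ws , s≤s (s≤s z≤n) , u
    , walk-close (walk-map joined-∷ w) (inj₂ (here refl)) )

  acyclic-tail : ∀ {e} {F : List (Edge {n})} → Acyclic (e ∷ F) → Acyclic F
  acyclic-tail acyclic (v ∷ vs , len , u , linked) =
    acyclic (v ∷ vs , len , u , Linked.map joined-∷ linked)

  -- The components of a forest as an explicit quotient with representatives. For connected `F` the
  -- size is 1, and `euler` then gives the number of edges.
  record Components (F : List (Edge {n})) : Set where
    field
      {size}    : ℕ
      label     : Fin n → Fin size
      root      : Fin size → Fin n
      label-root : ∀ i → label (root i) ≡ i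
      joined⇒≡  : ∀ {u v} → Joined F u v → label u ≡ label v
      to-root   : ∀ u → Path F u (root (label u))
      euler     : length F ℕ.+ size ≡ n

  -- Acyclicity puts the ends of each new edge into different components. Merging the two is a
  -- contraction of the label set, which lowers `size` by one while the number of edges grows by
  -- one.
  components : ∀ {F : List (Edge {n})} → Simple F → Acyclic F → Components F
  components {F = []} _ _ = record
    { label = id ; root = id ; label-root = λ _ → refl
    ; joined⇒≡ = λ { (inj₁ ()) ; (inj₂ ()) }
    ; to-root = λ _ → ε ; euler = refl }
  components {n} {F = (x , y) ∷ F} simple@(_ ∷ ordered , _ ∷ unique) acyclic =
    merge (components (ordered , unique) (acyclic-tail acyclic))
    where
    merge : Components F → Components ((x , y) ∷ F)
    merge record { size = zero ; label = label } with label x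
    ... | ()
    merge record { size = suc k ; label = label ; root = root ; label-root = label-root
                 ; joined⇒≡ = joined⇒≡ ; to-root = to-root ; euler = euler } = record
      { label      = contract b a ∘ label
      ; root       = root ∘ punchIn b
      ; label-root = λ i → trans (cong (contract b a) (label-root (punchIn b i)))
                                 (contract-punchIn b a i)
      ; joined⇒≡   = joined
      ; to-root    = to-root′
      ; euler      = trans (sym (ℕ.+-suc (length F) k)) euler
      }
      where
      b = label y
      b≢ : b ≢ label x
      b≢ eq = acyclic⇒no-path simple acyclic
        (to-root x ◅◅ subst (λ i → Path F (root i) y) eq (path-sym (to-root y)))
      a = punchOut b≢
      a-x : punchIn b a ≡ label x
      a-x = Fin.punchIn-punchOut b≢
      ends : contract b a (label x) ≡ contract b a (label y)
      ends = trans (cong (contract b a) (sym a-x))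
                   (trans (contract-punchIn b a a) (sym (contract-self b a)))
      joined : ∀ {u v} → Joined ((x , y) ∷ F) u v →
               contract b a (label u) ≡ contract b a (label v)
      joined (inj₁ (here refl)) = ends
      joined (inj₂ (here refl)) = sym ends
      joined (inj₁ (there p))   = cong (contract b a) (joined⇒≡ (inj₁ p))
      joined (inj₂ (there p))   = cong (contract b a) (joined⇒≡ (inj₂ p))
      weaken : ∀ {u v} → Path F u v → Path ((x , y) ∷ F) u v
      weaken = Closure.map joined-∷
      to-root′ : ∀ u → Path ((x , y) ∷ F) u (root (punchIn b (contract b a (label u))))
      to-root′ u with label u | punchView b (label u) | to-root u
      -- A vertex of the absorbed component goes to `y`, crosses the new edge to `x`, and continues
      -- to the root of `x`.
      ... | _ | itself  | path rewrite contract-self b a =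
        weaken path ◅◅ weaken (path-sym (to-root y))
        ◅◅ inj₂ (here refl) ◅ subst (Path _ x ∘ root) (sym a-x) (weaken (to-root x))
      ... | _ | other i | path rewrite contract-punchIn b a i = weaken path

  tree⇒spanningTree : ∀ {F : List (Edge {suc n})} → Simple F → IsTree F → SpanningTree F
  tree⇒spanningTree {n} {F} simple (conn , acyclic) = conn , trans (ℕ.+-comm 1 (length F))
    (trans (cong (length F ℕ.+_) (sym size≡1)) euler)
    where
    open Components (components simple acyclic)
    constant : ∀ {u v} → Path F u v → label u ≡ label v
    constant ε       = refl
    constant (r ◅ p) = trans (joined⇒≡ r) (constant p)
    one : ∀ k → Fin k → (∀ (i j : Fin k) → i ≡ j) → k ≡ 1
    one (suc zero)    _ _  = refl
    one (suc (suc k)) _ eq with eq zero (suc zero)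
    ... | ()
    size≡1 : size ≡ 1
    size≡1 = one size (label zero) λ i j →
      trans (sym (label-root i)) (trans (constant (conn (root i) (root j))) (label-root j))

  module _ {F ys zs : List (Edge {n})} {e : Edge {n}} (split : F ≡ ys ++ e ∷ zs) where

    private
      drop-edge : ∀ {f} → f ∈ F → f ≡ e ⊎ f ∈ ys ++ zs
      drop-edge f∈F with ∈-++⁻ ys (subst (_ ∈_) split f∈F)
      ... | inj₁ f∈ys         = inj₂ (∈-++⁺ˡ f∈ys)
      ... | inj₂ (here f≡e)   = inj₁ f≡e
      ... | inj₂ (there f∈zs) = inj₂ (∈-++⁺ʳ ys f∈zs)

    -- The rest of the cycle replaces the deleted edge. Each of its edges has an endpoint different
    -- from `v` and `w`, by way of the third vertex `x`, hence is not `e` in either orientation and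
    -- survives in `ys ++ zs`.
    cycle-edge-redundant : ∀ {v w x rest} →
      e ≡ (v , w) ⊎ e ≡ (w , v) → Unique (v ∷ w ∷ x ∷ rest) →
      Linked (Joined F) (w ∷ x ∷ (rest ∷ʳ v)) → Connected F → Connected (ys ++ zs)
    cycle-edge-redundant {v} {w} {x} {rest} e≡
      ((v≢w ∷ v≢x ∷ v∉rest) ∷ (w≢x ∷ w∉rest) ∷ _) (w~x ∷ linked) conn p q =
      kleisliStar id reroute (conn p q)
      where
      Off : Fin n → Set
      Off u = v ≢ u × w ≢ u

      not-e : ∀ {p q} → Off p ⊎ Off q → (p , q) ≢ e × (q , p) ≢ e
      not-e off = from-ends e≡ off
        where
        from-ends : ∀ {p q} → e ≡ (v , w) ⊎ e ≡ (w , v) → Off p ⊎ Off q →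
                    (p , q) ≢ e × (q , p) ≢ e
        from-ends (inj₁ refl) (inj₁ (v≢ , w≢)) = (λ { refl → v≢ refl }) , λ { refl → w≢ refl }
        from-ends (inj₁ refl) (inj₂ (v≢ , w≢)) = (λ { refl → w≢ refl }) , λ { refl → v≢ refl }
        from-ends (inj₂ refl) (inj₁ (v≢ , w≢)) = (λ { refl → w≢ refl }) , λ { refl → v≢ refl }
        from-ends (inj₂ refl) (inj₂ (v≢ , w≢)) = (λ { refl → v≢ refl }) , λ { refl → w≢ refl }

      keep : ∀ {p q} → Off p ⊎ Off q → Joined F p q → Joined (ys ++ zs) p q
      keep off (inj₁ pq∈F) with drop-edge pq∈F
      ... | inj₁ pq≡e = contradiction pq≡e (proj₁ (not-e off))
      ... | inj₂ pq∈  = inj₁ pq∈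
      keep off (inj₂ qp∈F) with drop-edge qp∈F
      ... | inj₁ qp≡e = contradiction qp≡e (proj₂ (not-e off))
      ... | inj₂ qp∈  = inj₂ qp∈

      onwards : ∀ {u us} → All Off (u ∷ us) → Linked (Joined F) (u ∷ (us ∷ʳ v)) →
                Path (ys ++ zs) u v
      onwards {us = []}    (off ∷ _)    (r ∷ [-]) = keep (inj₁ off) r ◅ ε
      onwards {us = _ ∷ _} (off ∷ offs) (r ∷ l)   = keep (inj₁ off) r ◅ onwards offs l

      around : Path (ys ++ zs) w v
      around = keep (inj₂ (v≢x , w≢x)) w~x
             ◅ onwards ((v≢x , w≢x) ∷ All.zip (v∉rest , w∉rest)) linked

      endpoints : ∀ {p q} → (p , q) ≡ e → Path (ys ++ zs) p q
      endpoints = from-ends e≡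
        where
        from-ends : ∀ {p q} → e ≡ (v , w) ⊎ e ≡ (w , v) → (p , q) ≡ e → Path (ys ++ zs) p q
        from-ends (inj₁ refl) refl = path-sym around
        from-ends (inj₂ refl) refl = around

      reroute : ∀ {p q} → Joined F p q → Path (ys ++ zs) p q
      reroute (inj₁ pq∈F) with drop-edge pq∈F
      ... | inj₁ pq≡e = endpoints pq≡e
      ... | inj₂ pq∈  = inj₁ pq∈ ◅ ε
      reroute (inj₂ qp∈F) with drop-edge qp∈F
      ... | inj₁ qp≡e = path-sym (endpoints qp≡e)
      ... | inj₂ qp∈  = inj₂ qp∈ ◅ ε

  -- An edge on a cycle could be deleted, and the remaining n - 2 edges would still connect n
  -- vertices.
  spanningTree⇒tree : ∀ {F : List (Edge {n})} → SpanningTree F → IsTree F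
  spanningTree⇒tree {n} {F} (conn , len) = conn , acyclic
    where
    no-cycle-edge : ∀ {e v w x rest} → e ∈ F → e ≡ (v , w) ⊎ e ≡ (w , v) →
      Unique (v ∷ w ∷ x ∷ rest) → ¬ Linked (Joined F) (w ∷ x ∷ (rest ∷ʳ v))
    no-cycle-edge e∈F e≡ u linked with ∈-∃++ e∈F
    ... | ys , zs , refl = ℕ.1+n≰n (subst (ℕ._≤ suc (length (ys ++ zs))) n≡
        (connected⇒≤ (ys ++ zs) (cycle-edge-redundant {ys = ys} refl e≡ u linked conn)))
      where
      n≡ : n ≡ suc (suc (length (ys ++ zs)))
      n≡ = trans (sym len) (cong suc (trans (length-++ ys)
             (trans (ℕ.+-suc (length ys) (length zs)) (cong suc (sym (length-++ ys))))))

    acyclic : Acyclic F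
    acyclic (v ∷ [] , () , _)
    acyclic (v ∷ w ∷ [] , s≤s () , _)
    acyclic (v ∷ w ∷ x ∷ rest , _ , u , inj₁ vw∈F ∷ linked) = no-cycle-edge vw∈F (inj₁ refl) u linked
    acyclic (v ∷ w ∷ x ∷ rest , _ , u , inj₂ wv∈F ∷ linked) = no-cycle-edge wv∈F (inj₂ refl) u linked

  All-sublists : ∀ {A : Set} {P : Pred A 0ℓ} {xs} → All P xs → All (All P) (sublists xs)
  All-sublists []         = [] ∷ []
  All-sublists (p ∷ ps) = All.++⁺ (All-sublists ps) (All.map⁺ (All.map (p ∷_) (All-sublists ps)))

  Unique-sublists : ∀ {A : Set} {xs : List A} → Unique xs → All Unique (sublists xs)
  Unique-sublists []        = [] ∷ []
  Unique-sublists (x∉ ∷ u) = All.++⁺ (Unique-sublists u)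
    (All.map⁺ (All.zipWith (λ (x∉ys , uys) → x∉ys ∷ uys) (All-sublists x∉ , Unique-sublists u)))

  edge? : ∀ {n} (G : Graph n) → Decidable λ ((u , v) : Edge {n}) → u Fin.< v × adj G u v ≡ true
  edge? G (u , v) = (u Fin.<? v) ×-dec (adj G u v Bool.≟ true)

  edges-simple : ∀ {n} (G : Graph n) → Simple (edges G)
  edges-simple {n} G =
      All.map proj₁ (All.all-filter (edge? G) (cartesianProduct (allFin n) (allFin n)))
    , Unique.filter⁺ (edge? G) (Unique.cartesianProduct⁺ (Unique.allFin⁺ n) (Unique.allFin⁺ n))

  τ-treeCount : ∀ {n} (G : Graph (suc n)) → τ G ≡ treeCount (edges G)
  τ-treeCount G = trans (cong (count isTree?) (sym (map-id (sublists (edges G)))))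
    (count-map isTree? spanningTree? id
      (All.zipWith (λ simple → mk⇔ (tree⇒spanningTree simple) spanningTree⇒tree)
        (All-sublists (proj₁ (edges-simple G)) , Unique-sublists (proj₂ (edges-simple G)))))

open SpanningTrees

-- The weighted matrix-tree theorem by deletion and contraction

module MatrixTree {c ℓ} (R : CommutativeRing c ℓ) where

  open CommutativeRing R hiding (zero)
  open Determinant rawRing using (Matrix; det)
  open Determinants R
  open import Algebra.Properties.Semiring.Sum semiring
    using (sum; sum-replicate; ∑-distrib-+; ∑-comm; sum-remove; *-distribˡ-sum)
  open import Algebra.Properties.Semiring.Mult semiring
    using (×-homo-+) renaming (_×_ to _·_)
  open import Algebra.Properties.Ring ring using (-1*x≈-x)
  open import Algebra.Solver.Ring.NaturalCoefficients.Default commutativeSemiring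
    using (solve; _:=_; _:+_; _:*_; con)
  open import Relation.Binary.Reasoning.Setoid setoid

  ι : ℕ → Carrier
  ι n = n · 1#

  x+-1*x≈0 : ∀ x → x + - 1# * x ≈ 0#
  x+-1*x≈0 x = trans (+-congˡ (-1*x≈-x x)) (-‿inverseʳ x)

  edgeVector : ∀ {n} → Edge {n} → Fin n → Carrier
  edgeVector (u , v) i = δ i u + - 1# * δ i v

  -- Built from the edge list, so that a loop contributes zero, parallel edges add up, and
  -- contraction of the matrix corresponds to `contractEdges`.
  weightedLaplacian : ∀ {n} (u z : Fin n → Carrier) → List (Edge {n}) → Matrix n
  weightedLaplacian u z []      i j = u i * z j
  weightedLaplacian u z (e ∷ E) i j = edgeVector e i * edgeVector e j + weightedLaplacian u z E i j

  δ-injective : ∀ {m n} (f : Fin m → Fin n) → (∀ {i j} → f i ≡ f j → i ≡ j) →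
                ∀ i j → δ (f i) (f j) ≈ δ i j
  δ-injective f inj i j with i Fin.≟ j
  ... | yes ≡.refl = δ-refl (f i)
  ... | no  i≢j    = δ-≢ (i≢j ∘ inj)

  δ-punchIn : ∀ {n} (b : Fin (suc n)) i j → δ (punchIn b i) (punchIn b j) ≈ δ i j
  δ-punchIn b = δ-injective (punchIn b) λ {i} {j} → Fin.punchIn-injective b i j

  module _ {n} (b : Fin (suc n)) (a : Fin n) where

    private
      x : Fin (suc n)
      x = punchIn b a

      x≢b : x ≢ b
      x≢b = Fin.punchInᵢ≢i b a

    shift : (Fin (suc n) → Carrier) → Fin (suc n) → Carrier
    shift w i = w i + δ i x * w b

    -- Adds row b to row x, then column b to column x.
    shiftMatrix : Matrix (suc n) → Matrix (suc n)
    shiftMatrix G i j = (G i j + δ i x * G b j) + δ j x * (G i b + δ i x * G b b)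

    push : (Fin (suc n) → Carrier) → Fin n → Carrier
    push w i = shift w (punchIn b i)

    contractMatrix : Matrix (suc n) → Matrix n
    contractMatrix G = minor (shiftMatrix G) b b

    det-shift : ∀ G → det (shiftMatrix G) ≈ det G
    det-shift G = begin
      det (shiftMatrix G)
        ≈⟨ det-transpose (shiftMatrix G) ⟨
      det (λ i j → G′ j i + δ i x * G′ j b)
        ≈⟨ det-add-row (λ i j → G′ j i) x≢b ⟩
      det (λ i j → G′ j i)
        ≈⟨ det-transpose G′ ⟩
      det G′
        ≈⟨ det-add-row G x≢b ⟩
      det G ∎
      where
      G′ : Matrix (suc n)
      G′ i j = G i j + δ i x * G b j

    shift-outer : ∀ u z i j → shiftMatrix (λ i j → u i * z j) i j ≈ shift u i * shift z j
    shift-outer u z i j =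
      solve 6 (λ u z ub zb d e → (u :* z :+ d :* (ub :* z)) :+ e :* (u :* zb :+ d :* (ub :* zb))
                               := (u :+ d :* ub) :* (z :+ e :* zb))
        refl (u i) (z j) (u b) (z b) (δ i x) (δ j x)

    shift-+ : ∀ G H i j → shiftMatrix (λ i j → G i j + H i j) i j
                        ≈ shiftMatrix G i j + shiftMatrix H i j
    shift-+ G H i j =
      solve 10 (λ p q r s t u v w d e →
          ((p :+ t) :+ d :* (q :+ u)) :+ e :* ((r :+ v) :+ d :* (s :+ w))
        := ((p :+ d :* q) :+ e :* (r :+ d :* s)) :+ ((t :+ d :* u) :+ e :* (v :+ d :* w)))
        refl (G i j) (G b j) (G i b) (G b b) (H i j) (H b j) (H i b) (H b b) (δ i x) (δ j x)

    shift-edge : ∀ i → shift (edgeVector (x , b)) i ≈ - 1# * δ i b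
    shift-edge i = begin
      (δ i x + - 1# * δ i b) + δ i x * (δ b x + - 1# * δ b b)
        ≈⟨ +-congˡ (*-congˡ (+-cong (δ-≢ (x≢b ∘ ≡.sym)) (*-congˡ (δ-refl b)))) ⟩
      (δ i x + - 1# * δ i b) + δ i x * (0# + - 1# * 1#)
        ≈⟨ solve 3 (λ e d f → (d :+ e :* f) :+ d :* (con 0 :+ e :* con 1)
                            := (d :+ e :* d) :+ e :* f) refl (- 1#) (δ i x) (δ i b) ⟩
      (δ i x + - 1# * δ i x) + - 1# * δ i b
        ≈⟨ +-congʳ (x+-1*x≈0 (δ i x)) ⟩
      0# + - 1# * δ i b
        ≈⟨ +-identityˡ _ ⟩
      - 1# * δ i b ∎

    -- The row and column operations turn the edge vector, a difference of the unit vectors at `x`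
    -- and `b`, into minus the unit vector at `b`. The edge then adds 1 to a single diagonal entry,
    -- and the determinant grows by the corresponding minor.
    det-edge : ∀ G →
      det (λ i j → edgeVector (x , b) i * edgeVector (x , b) j + G i j)
        ≈ det G + det (contractMatrix G)
    det-edge G = begin
      det (λ i j → w i * w j + G i j)
        ≈⟨ det-shift (λ i j → w i * w j + G i j) ⟨
      det (shiftMatrix (λ i j → w i * w j + G i j))
        ≈⟨ det-cong (λ i j → trans (shift-+ (λ i j → w i * w j) G i j)
             (trans (+-congʳ (trans (shift-outer w w i j) (square i j))) (+-comm _ _))) ⟩
      det (λ i j → shiftMatrix G i j + δ i b * δ j b)
        ≈⟨ det-add-unit (shiftMatrix G) b ⟩
      det (shiftMatrix G) + det (contractMatrix G)
        ≈⟨ +-congʳ (det-shift G) ⟩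
      det G + det (contractMatrix G) ∎
      where
      w = edgeVector (x , b)
      square : ∀ i j → shift w i * shift w j ≈ δ i b * δ j b
      square i j = begin
        shift w i * shift w j
          ≈⟨ *-cong (shift-edge i) (shift-edge j) ⟩
        (- 1# * δ i b) * (- 1# * δ j b)
          ≈⟨ solve 3 (λ e d f → (e :* d) :* (e :* f) := (e :* e) :* (d :* f)) refl (- 1#) _ _ ⟩
        (- 1# * - 1#) * (δ i b * δ j b)
          ≈⟨ trans (*-congʳ -1*-1≈1) (*-identityˡ _) ⟩
        δ i b * δ j b ∎

    push-δ : ∀ u i → push (λ j → δ j u) i ≈ δ i (contract b a u)
    push-δ u i with punchView b u
    ... | itself = begin
      δ (punchIn b i) b + δ (punchIn b i) x * δ b b
        ≈⟨ +-cong (δ-≢ (Fin.punchInᵢ≢i b i)) (trans (*-cong (δ-punchIn b i a) (δ-refl b)) (*-identityʳ _)) ⟩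
      0# + δ i a
        ≈⟨ +-identityˡ _ ⟩
      δ i a
        ≡⟨ ≡.cong (δ i) (≡.sym (contract-self b a)) ⟩
      δ i (contract b a b) ∎
    ... | other k = begin
      δ (punchIn b i) (punchIn b k) + δ (punchIn b i) x * δ b (punchIn b k)
        ≈⟨ +-cong (δ-punchIn b i k)
             (trans (*-congˡ (δ-≢ (Fin.punchInᵢ≢i b k ∘ ≡.sym))) (zeroʳ _)) ⟩
      δ i k + 0#
        ≈⟨ +-identityʳ _ ⟩
      δ i k
        ≡⟨ ≡.cong (δ i) (≡.sym (contract-punchIn b a k)) ⟩
      δ i (contract b a (punchIn b k)) ∎

    push-edge : ∀ u v i → push (edgeVector (u , v)) i ≈ edgeVector (contract b a u , contract b a v) i
    push-edge u v i = trans
      (solve 6 (λ e p q r s d → (p :+ e :* q) :+ d :* (r :+ e :* s)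
                              := (p :+ d :* r) :+ e :* (q :+ d :* s))
        refl (- 1#) (δ (punchIn b i) u) (δ (punchIn b i) v) (δ b u) (δ b v) (δ (punchIn b i) x))
      (+-cong (push-δ u i) (*-congˡ (push-δ v i)))

    contract-laplacian : ∀ u z E i j → contractMatrix (weightedLaplacian u z E) i j
      ≈ weightedLaplacian (push u) (push z) (contractEdges b a E) i j
    contract-laplacian u z []            i j = shift-outer u z (punchIn b i) (punchIn b j)
    contract-laplacian u z ((p , q) ∷ E) i j = begin
      shiftMatrix (λ i j → w i * w j + weightedLaplacian u z E i j) (punchIn b i) (punchIn b j)
        ≈⟨ shift-+ (λ i j → w i * w j) (weightedLaplacian u z E) (punchIn b i) (punchIn b j) ⟩
      shiftMatrix (λ i j → w i * w j) (punchIn b i) (punchIn b j)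
        + contractMatrix (weightedLaplacian u z E) i j
        ≈⟨ +-cong (trans (shift-outer w w (punchIn b i) (punchIn b j))
                         (*-cong (push-edge p q i) (push-edge p q j)))
                  (contract-laplacian u z E i j) ⟩
      weightedLaplacian (push u) (push z) (contractEdges b a ((p , q) ∷ E)) i j ∎
      where w = edgeVector (p , q)

    sum-push : ∀ w → sum (push w) ≈ sum w
    sum-push w = begin
      sum (λ i → w (punchIn b i) + δ (punchIn b i) x * w b)
        ≈⟨ ∑-distrib-+ (w ∘ punchIn b) (λ i → δ (punchIn b i) x * w b) ⟩
      sum (w ∘ punchIn b) + sum (λ i → δ (punchIn b i) x * w b)
        ≈⟨ +-congˡ (trans (sum-cong λ i → *-congʳ {w b} (δ-punchIn b i a)) (sum-δ a (λ _ → w b))) ⟩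
      sum (w ∘ punchIn b) + w b
        ≈⟨ +-comm _ _ ⟩
      w b + sum (w ∘ punchIn b)
        ≈⟨ sum-remove {i = b} w ⟨
      sum w ∎

  det-outer : ∀ {n} (u z : Fin (suc (suc n)) → Carrier) → det (λ i j → u i * z j) ≈ 0#
  det-outer u z = trans (det-scale-rows u (λ _ j → z j))
    (trans (*-congˡ (det-equal-rows (λ _ j → z j) {zero} {suc zero} (λ ()) λ k → refl)) (zeroʳ _))

  private
    edgeVector-loop : ∀ {n} (x i : Fin n) → edgeVector (x , x) i ≈ 0#
    edgeVector-loop x i = x+-1*x≈0 (δ i x)

  module _ {n} (u z : Fin n → Carrier) where

    TreeFormula : List (Edge {n}) → Set ℓ
    TreeFormula E = det (weightedLaplacian u z E) ≈ sum u * sum z * ι (treeCount E)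

    treeFormula-loop : ∀ x E → TreeFormula E → TreeFormula ((x , x) ∷ E)
    treeFormula-loop x E ih = begin
      det (weightedLaplacian u z ((x , x) ∷ E))
        ≈⟨ det-cong (λ i j → trans (+-congʳ (trans (*-congʳ (edgeVector-loop x i)) (zeroˡ _)))
                                   (+-identityˡ _)) ⟩
      det (weightedLaplacian u z E)
        ≈⟨ ih ⟩
      sum u * sum z * ι (treeCount E)
        ≡⟨ ≡.cong (λ t → sum u * sum z * ι t) (≡.sym (treeCount-loop x E)) ⟩
      sum u * sum z * ι (treeCount ((x , x) ∷ E)) ∎

  treeFormula-contract : ∀ {n} (u z : Fin (suc n) → Carrier) b a E → TreeFormula u z E →
    TreeFormula (push b a u) (push b a z) (contractEdges b a E) →
    TreeFormula u z ((punchIn b a , b) ∷ E)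
  treeFormula-contract u z b a E deletion contraction = begin
    det (weightedLaplacian u z ((punchIn b a , b) ∷ E))
      ≈⟨ det-edge b a (weightedLaplacian u z E) ⟩
    det (weightedLaplacian u z E) + det (contractMatrix b a (weightedLaplacian u z E))
      ≈⟨ +-cong deletion (trans (det-cong (contract-laplacian b a u z E)) contraction) ⟩
    sum u * sum z * ι (treeCount E)
      + sum (push b a u) * sum (push b a z) * ι (treeCount (contractEdges b a E))
      ≈⟨ +-congˡ (*-congʳ (*-cong (sum-push b a u) (sum-push b a z))) ⟩
    sum u * sum z * ι (treeCount E) + sum u * sum z * ι (treeCount (contractEdges b a E))
      ≈⟨ distribˡ _ _ _ ⟨
    sum u * sum z * (ι (treeCount E) + ι (treeCount (contractEdges b a E)))
      ≈⟨ *-congˡ (×-homo-+ 1# (treeCount E) (treeCount (contractEdges b a E))) ⟨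
    sum u * sum z * ι (treeCount E ℕ.+ treeCount (contractEdges b a E))
      ≡⟨ ≡.cong (λ t → sum u * sum z * ι t) (≡.sym (treeCount-contract b a E)) ⟩
    sum u * sum z * ι (treeCount ((punchIn b a , b) ∷ E)) ∎

  -- The weights stay general because contraction replaces them by `push`; it preserves their sums,
  -- and the formula involves nothing else. With one vertex every edge is a loop; with more vertices
  -- and no edges the matrix has rank at most one and there is no tree.
  matrixTree : ∀ {n} (u z : Fin (suc n) → Carrier) E → TreeFormula u z E
  matrixTree {zero} u z [] =
    solve 2 (λ u z → con 1 :* (u :* z) :* con 1 :+ con 0
                   := (u :+ con 0) :* (z :+ con 0) :* (con 1 :+ con 0)) refl (u zero) (z zero)
  matrixTree {zero} u z ((zero , zero) ∷ E) = treeFormula-loop u z zero E (matrixTree u z E)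
  matrixTree {suc n} u z = formula
    where
    formula : ∀ E → TreeFormula u z E
    formula [] = begin
      det (λ i j → u i * z j)    ≈⟨ det-outer u z ⟩
      0#                         ≈⟨ zeroʳ _ ⟨
      sum u * sum z * ι 0        ≡⟨ ≡.cong (λ t → sum u * sum z * ι t) (≡.sym (treeCount-[] {n})) ⟩
      sum u * sum z * ι (treeCount {suc (suc n)} []) ∎
    formula ((x , y) ∷ E) with y Fin.≟ x
    ... | yes ≡.refl = treeFormula-loop u z x E (formula E)
    ... | no  y≢x = ≡.subst (λ x → TreeFormula u z ((x , y) ∷ E)) (Fin.punchIn-punchOut y≢x)
      (treeFormula-contract u z y a E (formula E)
        (matrixTree (push y a u) (push y a z) (contractEdges y a E)))
      where a = punchOut y≢x

  -- The Laplacian of a graph as a sum over its edges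

  sumList : {A : Set} → (A → Carrier) → List A → Carrier
  sumList f []       = 0#
  sumList f (x ∷ xs) = f x + sumList f xs

  sumList-++ : ∀ {A : Set} (f : A → Carrier) xs ys → sumList f (xs ++ ys) ≈ sumList f xs + sumList f ys
  sumList-++ f []       ys = sym (+-identityˡ _)
  sumList-++ f (x ∷ xs) ys = trans (+-congˡ (sumList-++ f xs ys)) (sym (+-assoc _ _ _))

  sumList-map : ∀ {A B : Set} (f : B → Carrier) (g : A → B) xs →
                sumList f (map g xs) ≈ sumList (f ∘ g) xs
  sumList-map f g []       = refl
  sumList-map f g (x ∷ xs) = +-congˡ (sumList-map f g xs)

  sumList-cartesianProduct : ∀ {A B : Set} (f : A × B → Carrier) xs ys →
    sumList f (cartesianProduct xs ys) ≈ sumList (λ x → sumList (λ y → f (x , y)) ys) xs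
  sumList-cartesianProduct f []       ys = refl
  sumList-cartesianProduct f (x ∷ xs) ys = trans (sumList-++ f (map (x ,_) ys) _)
    (+-cong (sumList-map f (x ,_) ys) (sumList-cartesianProduct f xs ys))

  sumList-tabulate : ∀ {A : Set} {n} (f : A → Carrier) (g : Fin n → A) →
                     sumList f (tabulate g) ≈ sum (f ∘ g)
  sumList-tabulate {n = zero}  f g = refl
  sumList-tabulate {n = suc n} f g = +-congˡ (sumList-tabulate f (g ∘ suc))

  indicator : Bool → Carrier
  indicator p = if p then 1# else 0#

  sumList-filter : ∀ {A : Set} {P : Pred A 0ℓ} (P? : Decidable P) (f : A → Carrier) xs →
    sumList f (filter P? xs) ≈ sumList (λ x → indicator (does (P? x)) * f x) xs
  sumList-filter P? f []       = refl
  sumList-filter P? f (x ∷ xs) with does (P? x)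
  ... | true  = +-cong (sym (*-identityˡ _)) (sumList-filter P? f xs)
  ... | false = trans (sumList-filter P? f xs) (sym (trans (+-congʳ (zeroˡ _)) (+-identityˡ _)))

  sum-indicator : ∀ {n} (p : Fin n → Bool) → sum (indicator ∘ p) ≈ ι ∣ Vec.tabulate p ∣
  sum-indicator {zero}  p = refl
  sum-indicator {suc n} p with p zero
  ... | true  = +-congˡ (sum-indicator (p ∘ suc))
  ... | false = trans (+-identityˡ _) (sum-indicator (p ∘ suc))

  sum-δ′ : ∀ {n} (i : Fin n) (f : Fin n → Carrier) → sum (λ u → δ i u * f u) ≈ f i
  sum-δ′ i f = trans (sum-cong λ u → *-congʳ {f u} (δ-sym i u)) (sum-δ i f)

  module _ {n} (G : Graph n) where

    adjacency : Matrix n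
    adjacency i j = indicator (adj G i j)

    laplacian : Matrix n
    laplacian i j = δ j i * ι (degree G i) + - 1# * adjacency i j

    private
      c′ : Fin n → Fin n → Carrier
      c′ u v = indicator (does (edge? G (u , v)))

      symmetrize : ∀ u v → c′ u v + c′ v u ≈ adjacency u v
      symmetrize u v with adj G u v in uv | adj G v u in vu
      ... | true | false = contradiction (≡.trans (≡.sym uv) (≡.trans (adj-sym G u v) vu)) λ ()
      ... | false | true = contradiction (≡.trans (≡.sym uv) (≡.trans (adj-sym G u v) vu)) λ ()
      ... | false | false rewrite Bool.∧-zeroʳ (does (u Fin.<? v)) | Bool.∧-zeroʳ (does (v Fin.<? u))
        = +-identityˡ 0#
      ... | true | true with Fin.<-cmp u v
      ...   | tri< u<v _ v≮u rewrite dec-true (u Fin.<? v) u<v | dec-false (v Fin.<? u) v≮u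
        = +-identityʳ 1#
      ...   | tri> u≮v _ v<u rewrite dec-false (u Fin.<? v) u≮v | dec-true (v Fin.<? u) v<u
        = +-identityˡ 1#
      ...   | tri≈ _ ≡.refl _ = contradiction (≡.trans (≡.sym uv) (no-loop G u)) λ ()

      module _ (i j : Fin n) where

        sum-both-tails : ∀ (d : Matrix n) → sum² (λ u v → δ i u * (δ j u * d u v)) ≈ δ j i * sum (d i)
        sum-both-tails d = begin
          sum² (λ u v → δ i u * (δ j u * d u v))
            ≈⟨ sum-cong (λ u → *-distribˡ-sum (δ i u) λ v → δ j u * d u v) ⟨
          sum (λ u → δ i u * sum (λ v → δ j u * d u v))
            ≈⟨ sum-δ′ i (λ u → sum λ v → δ j u * d u v) ⟩
          sum (λ v → δ j i * d i v)
            ≈⟨ *-distribˡ-sum (δ j i) (d i) ⟨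
          δ j i * sum (d i) ∎

        sum-tail-head : ∀ (d : Matrix n) → sum² (λ u v → δ i u * (δ j v * d u v)) ≈ d i j
        sum-tail-head d = begin
          sum² (λ u v → δ i u * (δ j v * d u v))
            ≈⟨ sum-cong (λ u → *-distribˡ-sum (δ i u) λ v → δ j v * d u v) ⟨
          sum (λ u → δ i u * sum (λ v → δ j v * d u v))
            ≈⟨ sum-δ′ i (λ u → sum λ v → δ j v * d u v) ⟩
          sum (λ v → δ j v * d i v)
            ≈⟨ sum-δ′ j (d i) ⟩
          d i j ∎

      sum²-+ : ∀ (f g : Fin n → Fin n → Carrier) → sum² (λ u v → f u v + g u v) ≈ sum² f + sum² g
      sum²-+ f g = trans (sum-cong λ u → ∑-distrib-+ (f u) (g u))
                         (∑-distrib-+ (sum ∘ f) (sum ∘ g))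

    -- In the product of two incidence vectors the tail-tail and head-head terms give the degree,
    -- the mixed terms the adjacency. Each edge is listed with u < v only; adding the two
    -- orientations removes this asymmetry.
    edges-laplacian : ∀ i j →
      sumList (λ e → edgeVector e i * edgeVector e j) (edges G) ≈ laplacian i j
    edges-laplacian i j = begin
      sumList f (edges G)
        ≈⟨ sumList-filter (edge? G) f (cartesianProduct (allFin n) (allFin n)) ⟩
      sumList g (cartesianProduct (allFin n) (allFin n))
        ≈⟨ sumList-cartesianProduct g (allFin n) (allFin n) ⟩
      sumList (λ u → sumList (λ v → g (u , v)) (allFin n)) (allFin n)
        ≈⟨ sumList-tabulate (λ u → sumList (λ v → g (u , v)) (allFin n)) id ⟩
      sum (λ u → sumList (λ v → g (u , v)) (allFin n))
        ≈⟨ sum-cong (λ u → sumList-tabulate (λ v → g (u , v)) id) ⟩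
      sum² (λ u v → c′ u v * ((δ i u + - 1# * δ i v) * (δ j u + - 1# * δ j v)))
        ≈⟨ sum²-cong (λ u v → trans
             (solve 6 (λ e c p q r s → c :* ((p :+ e :* q) :* (r :+ e :* s))
                        := (p :* (r :* c) :+ (e :* e) :* (q :* (s :* c)))
                         :+ (p :* (s :* (e :* c)) :+ q :* (r :* (e :* c))))
               refl (- 1#) (c′ u v) (δ i u) (δ i v) (δ j u) (δ j v))
             (+-congʳ (+-congˡ (trans (*-congʳ -1*-1≈1) (*-identityˡ _))))) ⟩
      sum² (λ u v → (a₁ u v + a₂ v u) + (a₃ u v + a₄ v u))
        ≈⟨ trans (sum²-+ (λ u v → a₁ u v + a₂ v u) (λ u v → a₃ u v + a₄ v u))
                 (+-cong (sum²-+ a₁ (λ u v → a₂ v u)) (sum²-+ a₃ (λ u v → a₄ v u))) ⟩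
      (sum² a₁ + sum² (λ u v → a₂ v u)) + (sum² a₃ + sum² (λ u v → a₄ v u))
        -- `a₂` and `a₄` take the head first, so that after exchanging the sums the index tied to
        -- `i` is always the outer one.
        ≈⟨ +-cong (+-congˡ (∑-comm a₂)) (+-congˡ (∑-comm a₄)) ⟨
      (sum² a₁ + sum² a₂) + (sum² a₃ + sum² a₄)
        ≈⟨ +-cong (+-cong (sum-both-tails i j c′) (sum-both-tails i j (λ v u → c′ u v)))
                  (+-cong (sum-tail-head i j (λ u v → - 1# * c′ u v))
                          (sum-tail-head i j (λ v u → - 1# * c′ u v))) ⟩
      (δ j i * sum (c′ i) + δ j i * sum (λ v → c′ v i)) + (- 1# * c′ i j + - 1# * c′ j i)
        ≈⟨ +-cong (sym (distribˡ _ _ _)) (sym (distribˡ _ _ _)) ⟩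
      δ j i * (sum (c′ i) + sum (λ v → c′ v i)) + - 1# * (c′ i j + c′ j i)
        ≈⟨ +-cong (*-congˡ (∑-distrib-+ (c′ i) (λ v → c′ v i))) (*-congˡ (sym (symmetrize i j))) ⟨
      δ j i * sum (λ v → c′ i v + c′ v i) + - 1# * adjacency i j
        ≈⟨ +-congʳ (*-congˡ (trans (sum-cong (symmetrize i)) (sum-indicator (adj G i)))) ⟩
      laplacian i j ∎
      where
      f g : Edge {n} → Carrier
      f e = edgeVector e i * edgeVector e j
      g e = indicator (does (edge? G e)) * f e
      a₁ a₂ a₃ a₄ : Fin n → Fin n → Carrier
      a₁ u v = δ i u * (δ j u * c′ u v)
      a₂ v u = δ i v * (δ j v * c′ u v)
      a₃ u v = δ i u * (δ j v * (- 1# * c′ u v))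
      a₄ v u = δ i v * (δ j u * (- 1# * c′ u v))

  weightedLaplacian-sum : ∀ {n} (u z : Fin n → Carrier) E i j →
    weightedLaplacian u z E i j ≈ u i * z j + sumList (λ e → edgeVector e i * edgeVector e j) E
  weightedLaplacian-sum u z []      i j = sym (+-identityʳ _)
  weightedLaplacian-sum u z (e ∷ E) i j = trans (+-congˡ (weightedLaplacian-sum u z E i j))
    (solve 3 (λ a b c → a :+ (b :+ c) := b :+ (a :+ c)) refl _ _ _)

  weighted-matrixTree : ∀ {n} (G : Graph (suc n)) u z →
    det (λ i j → u i * z j + laplacian G i j) ≈ sum u * sum z * ι (τ G)
  weighted-matrixTree G u z = begin
    det (λ i j → u i * z j + laplacian G i j)
      ≈⟨ det-cong (λ i j → trans (weightedLaplacian-sum u z (edges G) i j)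
                                 (+-congˡ (edges-laplacian G i j))) ⟨
    det (weightedLaplacian u z (edges G))
      ≈⟨ matrixTree u z (edges G) ⟩
    sum u * sum z * ι (treeCount (edges G))
      ≡⟨ ≡.cong (λ t → sum u * sum z * ι t) (≡.sym (τ-treeCount G)) ⟩
    sum u * sum z * ι (τ G) ∎

  -- The Laplacian of a join

  -- A diagonal block of the Laplacian of a join: each vertex gains the `s` vertices of the other
  -- graph as neighbours.
  shiftedLaplacian : ∀ {n} → Graph n → ℕ → Matrix n
  shiftedLaplacian G s i j = δ j i * ι (degree G i ℕ.+ s) + - 1# * adjacency G i j

  τ-join : ∀ {m n} (G : Graph (suc m)) (H : Graph n) →
    ι (suc m) * ι n * ι (τ (G ∨ H)) ≈ det (shiftedLaplacian G n) * det (shiftedLaplacian H (suc m))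
  τ-join {m} {n} G H = begin
    ι (suc m) * ι n * ι (τ (G ∨ H))
      ≈⟨ *-congʳ (*-cong sum-u sum-z) ⟨
    sum u * sum z * ι (τ (G ∨ H))
      ≈⟨ weighted-matrixTree (G ∨ H) u z ⟨
    det M
      ≈⟨ det-block-triangular (suc m) M upper-right ⟩
    det (λ i j → M (i ↑ˡ n) (j ↑ˡ n)) * det (λ i j → M (suc m ↑ʳ i) (suc m ↑ʳ j))
      ≈⟨ *-cong (det-cong upper-left) (det-cong lower-right) ⟩
    det (shiftedLaplacian G n) * det (shiftedLaplacian H (suc m)) ∎
    where
    u z : Fin (suc m ℕ.+ n) → Carrier
    u = [ const 1# , const 0# ]′ ∘ splitAt (suc m)
    z = [ const 0# , const 1# ]′ ∘ splitAt (suc m)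

    M : Matrix (suc m ℕ.+ n)
    M i j = u i * z j + laplacian (G ∨ H) i j

    left : ∀ i → splitAt (suc m) (i ↑ˡ n) ≡ inj₁ i
    left i = Fin.splitAt-↑ˡ (suc m) i n
    right : ∀ j → splitAt (suc m) (suc m ↑ʳ j) ≡ inj₂ j
    right j = Fin.splitAt-↑ʳ (suc m) n j

    sum-blocks : ∀ (f : Fin (suc m ℕ.+ n) → Carrier) {x y} → sum (λ i → f (i ↑ˡ n)) ≈ x →
                 sum (λ j → f (suc m ↑ʳ j)) ≈ y → sum f ≈ x + y
    sum-blocks f l r = trans (sum-split (suc m) f) (+-cong l r)

    sum-u : sum u ≈ ι (suc m)
    sum-u = trans (sum-blocks u
      (trans (sum-cong λ i → reflexive (≡.cong [ const 1# , const 0# ]′ (left i))) (sum-replicate (suc m)))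
      (sum-zero λ j → reflexive (≡.cong [ const 1# , const 0# ]′ (right j)))) (+-identityʳ _)

    sum-z : sum z ≈ ι n
    sum-z = trans (sum-blocks z
      (sum-zero λ i → reflexive (≡.cong [ const 0# , const 1# ]′ (left i)))
      (trans (sum-cong λ j → reflexive (≡.cong [ const 0# , const 1# ]′ (right j))) (sum-replicate n)))
      (+-identityˡ _)

    adj-ll : ∀ i j → adj (G ∨ H) (i ↑ˡ n) (j ↑ˡ n) ≡ adj G i j
    adj-ll i j rewrite left i | left j = ≡.refl
    adj-lr : ∀ i j → adj (G ∨ H) (i ↑ˡ n) (suc m ↑ʳ j) ≡ true
    adj-lr i j rewrite left i | right j = ≡.refl
    adj-rl : ∀ i j → adj (G ∨ H) (suc m ↑ʳ i) (j ↑ˡ n) ≡ true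
    adj-rl i j rewrite right i | left j = ≡.refl
    adj-rr : ∀ i j → adj (G ∨ H) (suc m ↑ʳ i) (suc m ↑ʳ j) ≡ adj H i j
    adj-rr i j rewrite right i | right j = ≡.refl

    degree-l : ∀ i → ι (degree (G ∨ H) (i ↑ˡ n)) ≈ ι (degree G i ℕ.+ n)
    degree-l i = begin
      ι (degree (G ∨ H) (i ↑ˡ n))
        ≈⟨ sum-indicator (adj (G ∨ H) (i ↑ˡ n)) ⟨
      sum (indicator ∘ adj (G ∨ H) (i ↑ˡ n))
        ≈⟨ sum-blocks (indicator ∘ adj (G ∨ H) (i ↑ˡ n))
             (trans (sum-cong λ j → reflexive (≡.cong indicator (adj-ll i j))) (sum-indicator (adj G i)))
             (trans (sum-cong λ j → reflexive (≡.cong indicator (adj-lr i j))) (sum-replicate n)) ⟩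
      ι (degree G i) + ι n
        ≈⟨ ×-homo-+ 1# (degree G i) n ⟨
      ι (degree G i ℕ.+ n) ∎

    degree-r : ∀ i → ι (degree (G ∨ H) (suc m ↑ʳ i)) ≈ ι (degree H i ℕ.+ suc m)
    degree-r i = begin
      ι (degree (G ∨ H) (suc m ↑ʳ i))
        ≈⟨ sum-indicator (adj (G ∨ H) (suc m ↑ʳ i)) ⟨
      sum (indicator ∘ adj (G ∨ H) (suc m ↑ʳ i))
        ≈⟨ sum-blocks (indicator ∘ adj (G ∨ H) (suc m ↑ʳ i))
             (trans (sum-cong λ j → reflexive (≡.cong indicator (adj-rl i j))) (sum-replicate (suc m)))
             (trans (sum-cong λ j → reflexive (≡.cong indicator (adj-rr i j))) (sum-indicator (adj H i))) ⟩
      ι (suc m) + ι (degree H i)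
        ≈⟨ +-comm _ _ ⟩
      ι (degree H i) + ι (suc m)
        ≈⟨ ×-homo-+ 1# (degree H i) (suc m) ⟨
      ι (degree H i ℕ.+ suc m) ∎

    upper-right : ∀ i j → M (i ↑ˡ n) (suc m ↑ʳ j) ≈ 0#
    upper-right i j = trans (+-cong
      (*-cong (reflexive (≡.cong [ const 1# , const 0# ]′ (left i)))
              (reflexive (≡.cong [ const 0# , const 1# ]′ (right j))))
      (+-cong (*-congʳ (δ-≢ (distinct i j)))
              (*-congˡ (reflexive (≡.cong indicator (adj-lr i j))))))
      (trans (solve 2 (λ d e → con 1 :* con 1 :+ (con 0 :* d :+ e :* con 1) := con 1 :+ e) refl _ (- 1#)) (-‿inverseʳ 1#))
      where
      distinct : ∀ i j → suc m ↑ʳ j ≢ i ↑ˡ n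
      distinct i j eq with ≡.trans (≡.sym (right j)) (≡.trans (≡.cong (splitAt (suc m)) eq) (left i))
      ... | ()

    upper-left : ∀ i j → M (i ↑ˡ n) (j ↑ˡ n) ≈ shiftedLaplacian G n i j
    upper-left i j = trans (+-cong
      (trans (*-congˡ (reflexive (≡.cong [ const 0# , const 1# ]′ (left j)))) (zeroʳ _))
      (+-cong (*-cong (δ-injective (_↑ˡ n) (λ {i} {j} → Fin.↑ˡ-injective n i j) j i) (degree-l i))
              (*-congˡ (reflexive (≡.cong indicator (adj-ll i j))))))
      (+-identityˡ _)

    lower-right : ∀ i j → M (suc m ↑ʳ i) (suc m ↑ʳ j) ≈ shiftedLaplacian H (suc m) i j
    lower-right i j = trans (+-cong
      (trans (*-congʳ (reflexive (≡.cong [ const 1# , const 0# ]′ (right i)))) (zeroˡ _))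
      (+-cong (*-cong (δ-injective (suc m ↑ʳ_) (λ {i} {j} → Fin.↑ʳ-injective (suc m) i j) j i) (degree-r i))
              (*-congˡ (reflexive (≡.cong indicator (adj-rr i j))))))
      (+-identityˡ _)

-- Cancellation, symmetric spectra and polynomial functions

module SemiRegularSpectrum {c ℓ} (R : CommutativeRing c ℓ) where

  open CommutativeRing R hiding (zero)
  open Determinant rawRing using (Matrix; det)
  open Determinants R
  open MatrixTree R
  open import Algebra.Properties.Semiring.Sum semiring using (sum)
  open import Algebra.Properties.Semiring.Exp semiring using (_^_; ^-homo-*; ^-congˡ)
  open import Algebra.Properties.CommutativeSemiring.Exp commutativeSemiring using (^-distrib-*)
  open import Algebra.Properties.Semiring.Mult semiring using (×-homo-+; ×1-homo-*)
  open import Algebra.Properties.Ring ring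
    using (-1*x≈-x; -‿involutive; -0#≈0#; x∙y⁻¹≈ε⇒x≈y)
  open import Algebra.Solver.Ring.NaturalCoefficients.Default commutativeSemiring
    using (solve; _:=_; _:+_; _:*_; con)
  open import Relation.Binary.Reasoning.Setoid setoid

  -- Stands in for invertibility: it is closed under products, and a positive real has it without a
  -- reciprocal being formed.
  Cancellable : Carrier → Set _
  Cancellable x = ∀ {y} → x * y ≈ 0# → y ≈ 0#

  cancellable-* : ∀ {x y} → Cancellable x → Cancellable y → Cancellable (x * y)
  cancellable-* cx cy xyz≈0 = cy (cx (trans (sym (*-assoc _ _ _)) xyz≈0))

  cancellable-1 : Cancellable 1#
  cancellable-1 1y≈0 = trans (sym (*-identityˡ _)) 1y≈0

  cancellable-^ : ∀ {x} → Cancellable x → ∀ n → Cancellable (x ^ n)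
  cancellable-^ cx zero    = cancellable-1
  cancellable-^ cx (suc n) = cancellable-* cx (cancellable-^ cx n)

  cancel : ∀ {x y z} → Cancellable x → x * y ≈ x * z → y ≈ z
  cancel {x} {y} {z} cx xy≈xz = x∙y⁻¹≈ε⇒x≈y y z (cx (begin
    x * (y + - z)        ≈⟨ distribˡ x y (- z) ⟩
    x * y + x * - z      ≈⟨ +-cong xy≈xz (*-congˡ (sym (-1*x≈-x z))) ⟩
    x * z + x * (- 1# * z) ≈⟨ +-congˡ (solve 3 (λ x e z → x :* (e :* z) := e :* (x :* z)) refl _ _ _) ⟩
    x * z + - 1# * (x * z) ≈⟨ x+-1*x≈0 (x * z) ⟩
    0# ∎))

  prodList : List Carrier → Carrier
  prodList = foldr _*_ 1#

  spectralProduct : Carrier → List Carrier → Carrier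
  spectralProduct y ls = prodList (map (λ l → y - l * l) ls)

  spectralProduct-cong : ∀ {x y} → x ≈ y → ∀ ls → spectralProduct x ls ≈ spectralProduct y ls
  spectralProduct-cong x≈y []       = refl
  spectralProduct-cong x≈y (l ∷ ls) = *-cong (+-congʳ x≈y) (spectralProduct-cong x≈y ls)

  difference-of-squares : ∀ x l → (x - l) * (x - - l) ≈ x * x - l * l
  difference-of-squares x l = begin
    (x - l) * (x - - l)
      ≈⟨ *-cong (+-congˡ (sym (-1*x≈-x l))) (+-congˡ (-‿involutive l)) ⟩
    (x + - 1# * l) * (x + l)
      ≈⟨ solve 3 (λ x l e → (x :+ e :* l) :* (x :+ l)
                         := x :* x :+ e :* (l :* l) :+ (x :* l :+ e :* (x :* l))) refl x l (- 1#) ⟩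
    x * x + - 1# * (l * l) + (x * l + - 1# * (x * l))
      ≈⟨ +-cong (+-congˡ (-1*x≈-x (l * l))) (x+-1*x≈0 (x * l)) ⟩
    x * x - l * l + 0#
      ≈⟨ +-identityʳ _ ⟩
    x * x - l * l ∎

  private
    prodList-++ : ∀ (f : Carrier → Carrier) xs ys →
      prodList (map f (xs ++ ys)) ≈ prodList (map f xs) * prodList (map f ys)
    prodList-++ f []       ys = sym (*-identityˡ _)
    prodList-++ f (x ∷ xs) ys = trans (*-congˡ (prodList-++ f xs ys)) (sym (*-assoc _ _ _))

    prodList-zeros : ∀ x m → prodList (map (λ t → x - t) (replicate m 0#)) ≈ x ^ m
    prodList-zeros x zero    = refl
    prodList-zeros x (suc m) = *-cong (trans (+-congˡ -0#≈0#) (+-identityʳ x)) (prodList-zeros x m)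

    prodList-pairs : ∀ x ls →
      prodList (map (λ t → x - t) ls) * prodList (map (λ t → x - t) (map -_ ls)) ≈ spectralProduct (x * x) ls
    prodList-pairs x []       = *-identityˡ 1#
    prodList-pairs x (l ∷ ls) = trans
      (solve 4 (λ a b c d → a :* b :* (c :* d) := a :* c :* (b :* d)) refl _ _ _ _)
      (*-cong (difference-of-squares x l) (prodList-pairs x ls))

  prodList-spectrum : ∀ x ls m →
    prodList (map (λ t → x - t) (ls ++ map -_ ls ++ replicate m 0#)) ≈ x ^ m * spectralProduct (x * x) ls
  prodList-spectrum x ls m = begin
    prodList (map (λ t → x - t) (ls ++ map -_ ls ++ replicate m 0#))
      ≈⟨ trans (prodList-++ (λ t → x - t) ls _) (*-congˡ (prodList-++ (λ t → x - t) (map -_ ls) _)) ⟩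
    prodList (map (λ t → x - t) ls) * (prodList (map (λ t → x - t) (map -_ ls)) * prodList (map (λ t → x - t) (replicate m 0#)))
      ≈⟨ solve 3 (λ a b c → a :* (b :* c) := c :* (a :* b)) refl _ _ _ ⟩
    prodList (map (λ t → x - t) (replicate m 0#)) * (prodList (map (λ t → x - t) ls) * prodList (map (λ t → x - t) (map -_ ls)))
      ≈⟨ *-cong (prodList-zeros x m) (prodList-pairs x ls) ⟩
    x ^ m * spectralProduct (x * x) ls ∎

  -- Polynomial functions

  eval : List Carrier → Carrier → Carrier
  eval []       x = 0#
  eval (c ∷ cs) x = c + x * eval cs x

  -- Vanishing leading coefficients cannot be recognised, so there is no degree to speak of;
  -- arguments recurse on the length of the coefficient list instead.
  Polynomial : (Carrier → Carrier) → Set _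
  Polynomial f = ∃[ cs ] ∀ x → f x ≈ eval cs x

  polynomial-const : ∀ c → Polynomial (λ _ → c)
  polynomial-const c = c ∷ [] , λ x → sym (trans (+-congˡ (zeroʳ x)) (+-identityʳ c))

  polynomial-id : Polynomial (λ x → x)
  polynomial-id = 0# ∷ 1# ∷ [] , λ x →
    solve 1 (λ x → x := con 0 :+ x :* (con 1 :+ x :* con 0)) refl x

  private
    _⊕_ : List Carrier → List Carrier → List Carrier
    []       ⊕ ds       = ds
    (c ∷ cs) ⊕ []       = c ∷ cs
    (c ∷ cs) ⊕ (d ∷ ds) = (c + d) ∷ (cs ⊕ ds)

    eval-⊕ : ∀ cs ds x → eval (cs ⊕ ds) x ≈ eval cs x + eval ds x
    eval-⊕ []       ds       x = sym (+-identityˡ _)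
    eval-⊕ (c ∷ cs) []       x = sym (+-identityʳ _)
    eval-⊕ (c ∷ cs) (d ∷ ds) x = trans (+-congˡ (*-congˡ (eval-⊕ cs ds x)))
      (solve 5 (λ c d x p q → c :+ d :+ x :* (p :+ q) := c :+ x :* p :+ (d :+ x :* q)) refl _ _ _ _ _)

    eval-scale : ∀ c ds x → eval (map (c *_) ds) x ≈ c * eval ds x
    eval-scale c []       x = sym (zeroʳ c)
    eval-scale c (d ∷ ds) x = trans (+-congˡ (*-congˡ (eval-scale c ds x)))
      (solve 4 (λ c d x p → c :* d :+ x :* (c :* p) := c :* (d :+ x :* p)) refl _ _ _ _)

    _⊛_ : List Carrier → List Carrier → List Carrier
    []       ⊛ ds = []
    (c ∷ cs) ⊛ ds = map (c *_) ds ⊕ (0# ∷ (cs ⊛ ds))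

    eval-⊛ : ∀ cs ds x → eval (cs ⊛ ds) x ≈ eval cs x * eval ds x
    eval-⊛ []       ds x = sym (zeroˡ _)
    eval-⊛ (c ∷ cs) ds x = begin
      eval (map (c *_) ds ⊕ (0# ∷ (cs ⊛ ds))) x
        ≈⟨ eval-⊕ (map (c *_) ds) (0# ∷ (cs ⊛ ds)) x ⟩
      eval (map (c *_) ds) x + (0# + x * eval (cs ⊛ ds) x)
        ≈⟨ +-cong (eval-scale c ds x) (+-congˡ (*-congˡ (eval-⊛ cs ds x))) ⟩
      c * eval ds x + (0# + x * (eval cs x * eval ds x))
        ≈⟨ solve 4 (λ c x p q → c :* q :+ (con 0 :+ x :* (p :* q)) := (c :+ x :* p) :* q) refl _ _ _ _ ⟩
      (c + x * eval cs x) * eval ds x ∎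

  polynomial-+ : ∀ {f g} → Polynomial f → Polynomial g → Polynomial (λ x → f x + g x)
  polynomial-+ (cs , f≈) (ds , g≈) =
    cs ⊕ ds , λ x → trans (+-cong (f≈ x) (g≈ x)) (sym (eval-⊕ cs ds x))

  polynomial-* : ∀ {f g} → Polynomial f → Polynomial g → Polynomial (λ x → f x * g x)
  polynomial-* (cs , f≈) (ds , g≈) =
    cs ⊛ ds , λ x → trans (*-cong (f≈ x) (g≈ x)) (sym (eval-⊛ cs ds x))

  polynomial-neg : ∀ {f} → Polynomial f → Polynomial (λ x → - f x)
  polynomial-neg {f} poly with polynomial-* (polynomial-const (- 1#)) poly
  ... | cs , eq = cs , λ x → trans (sym (-1*x≈-x (f x))) (eq x)

  polynomial-^ : ∀ {f} → Polynomial f → ∀ n → Polynomial (λ x → f x ^ n)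
  polynomial-^ poly zero    = polynomial-const 1#
  polynomial-^ poly (suc n) = polynomial-* poly (polynomial-^ poly n)

  polynomial-sum : ∀ {n} {f : Fin n → Carrier → Carrier} → (∀ i → Polynomial (f i)) →
                   Polynomial (λ x → sum λ i → f i x)
  polynomial-sum {zero}  poly = polynomial-const 0#
  polynomial-sum {suc n} poly = polynomial-+ (poly zero) (polynomial-sum (poly ∘ suc))

  polynomial-det : ∀ {n} {M : Carrier → Matrix n} → (∀ i j → Polynomial (λ x → M x i j)) →
                   Polynomial (λ x → det (M x))
  polynomial-det {zero}  poly = polynomial-const 1#
  polynomial-det {suc n} poly = polynomial-sum λ j →
    polynomial-* (polynomial-* (polynomial-const (sgn (toℕ j))) (poly zero j))
                 (polynomial-det λ i k → poly (suc i) (punchIn j k))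

  polynomial-spectralProduct : ∀ {f} → Polynomial f → ∀ ls →
                               Polynomial (λ x → spectralProduct (f x) ls)
  polynomial-spectralProduct poly []       = polynomial-const 1#
  polynomial-spectralProduct poly (l ∷ ls) = polynomial-*
    (polynomial-+ poly (polynomial-const (- (l * l)))) (polynomial-spectralProduct poly ls)

  private
    -- Horner's scheme for dividing x times `cs` by x - a. The same list is the quotient of
    -- `c ∷ cs`, since the constant term affects only the remainder; it is shorter than `c ∷ cs` by
    -- one.
    quotient : List Carrier → Carrier → List Carrier
    quotient []       a = []
    quotient (c ∷ cs) a = eval (c ∷ cs) a ∷ quotient cs a

    length-quotient : ∀ cs a → length (quotient cs a) ≡ length cs
    length-quotient []       a = ≡.refl
    length-quotient (c ∷ cs) a = ≡.cong suc (length-quotient cs a)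

    divide : ∀ cs a x → x * eval cs x ≈ a * eval cs a + (x - a) * eval (quotient cs a) x
    divide []       a x = solve 3 (λ x a y → x :* con 0 := a :* con 0 :+ y :* con 0) refl x a (x - a)
    divide (c ∷ cs) a x = begin
      x * (c + x * eval cs x)
        ≈⟨ *-congˡ (+-congˡ (divide cs a x)) ⟩
      x * (c + (a * eval cs a + (x - a) * Q))
        ≈⟨ solve 6 (λ x c a e y q → x :* (c :+ (a :* e :+ y :* q))
                                 := x :* (c :+ a :* e) :+ y :* (x :* q)) refl x c a _ (x - a) Q ⟩
      x * E + (x - a) * (x * Q)
        ≈⟨ +-congʳ (*-congʳ x≈) ⟩
      (a + (x - a)) * E + (x - a) * (x * Q)
        ≈⟨ solve 5 (λ a y e x q → (a :+ y) :* e :+ y :* (x :* q) := a :* e :+ y :* (e :+ x :* q))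
             refl a (x - a) E x Q ⟩
      a * E + (x - a) * (E + x * Q) ∎
      where
      E = eval (c ∷ cs) a
      Q = eval (quotient cs a) x
      x≈ : x ≈ a + (x - a)
      x≈ = sym (trans (solve 3 (λ a x y → a :+ (x :+ y) := x :+ (a :+ y)) refl a x (- a))
                      (trans (+-congˡ (-‿inverseʳ a)) (+-identityʳ x)))

  module _ (ι-cancellable : ∀ n → Cancellable (ι (suc n))) where

    private
      difference-cancellable : ∀ {m n} → m ℕ.< n → Cancellable (ι n - ι m)
      difference-cancellable {m} {n} m<n {y} eq = ι-cancellable d (trans (*-congʳ (sym ι-d)) eq)
        where
        d = proj₁ (ℕ.m≤n⇒∃[o]m+o≡n m<n)
        n≡ : n ≡ suc d ℕ.+ m
        n≡ = ≡.trans (≡.sym (proj₂ (ℕ.m≤n⇒∃[o]m+o≡n m<n))) (≡.cong suc (ℕ.+-comm m d))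
        ι-d : ι n - ι m ≈ ι (suc d)
        ι-d = begin
          ι n - ι m                  ≡⟨ ≡.cong (λ k → ι k - ι m) n≡ ⟩
          ι (suc d ℕ.+ m) - ι m      ≈⟨ +-congʳ (×-homo-+ 1# (suc d) m) ⟩
          ι (suc d) + ι m - ι m      ≈⟨ +-assoc _ _ _ ⟩
          ι (suc d) + (ι m - ι m)    ≈⟨ trans (+-congˡ (-‿inverseʳ _)) (+-identityʳ _) ⟩
          ι (suc d) ∎

      -- The first node is divided out; the later ones are roots of the quotient, because
      -- differences of nodes are positive integers and hence cancellable. The recursion runs on the
      -- length `n`, as the quotient is not a subterm of the list.
      eval-vanishes : ∀ n cs → length cs ≡ n → (p : ℕ → ℕ) → (∀ j → p j ℕ.< p (suc j)) →
        (∀ j → eval cs (ι (p j)) ≈ 0#) → ∀ x → eval cs x ≈ 0#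
      eval-vanishes n       []       len p mono roots x = refl
      eval-vanishes (suc n) (c ∷ cs) len p mono roots x = begin
        c + x * eval cs x
          ≈⟨ expand x ⟩
        (x - a) * eval (quotient cs a) x
          ≈⟨ *-congˡ (eval-vanishes n (quotient cs a)
               (≡.trans (length-quotient cs a) (ℕ.suc-injective len)) (p ∘ suc) (mono ∘ suc)
               (λ j → difference-cancellable (before j)
                 (trans (sym (expand (ι (p (suc j))))) (roots (suc j)))) x) ⟩
        (x - a) * 0#
          ≈⟨ zeroʳ _ ⟩
        0# ∎
        where
        a = ι (p 0)
        before : ∀ j → p 0 ℕ.< p (suc j)
        before zero    = mono 0
        before (suc j) = ℕ.<-trans (before j) (mono (suc j))
        expand : ∀ x → c + x * eval cs x ≈ (x - a) * eval (quotient cs a) x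
        expand x = begin
          c + x * eval cs x
            ≈⟨ +-congˡ (divide cs a x) ⟩
          c + (a * eval cs a + (x - a) * eval (quotient cs a) x)
            ≈⟨ +-assoc _ _ _ ⟨
          eval (c ∷ cs) a + (x - a) * eval (quotient cs a) x
            ≈⟨ +-congʳ (roots 0) ⟩
          0# + (x - a) * eval (quotient cs a) x
            ≈⟨ +-identityˡ _ ⟩
          (x - a) * eval (quotient cs a) x ∎

    polynomial-identity : ∀ {f g} → Polynomial f → Polynomial g →
      (p : ℕ → ℕ) → (∀ j → p j ℕ.< p (suc j)) →
      (∀ j → f (ι (p j)) ≈ g (ι (p j))) → ∀ x → f x ≈ g x
    polynomial-identity {f} {g} polyf polyg p mono agree x
      with polynomial-+ polyf (polynomial-neg polyg)
    ... | cs , f-g≈ = x∙y⁻¹≈ε⇒x≈y (f x) (g x) (trans (f-g≈ x)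
      (eval-vanishes (length cs) cs ≡.refl p mono
        (λ j → trans (sym (f-g≈ (ι (p j)))) (trans (+-congʳ (agree j)) (-‿inverseʳ _))) x))

  -- The two-variable determinant of a semi-regular bipartite graph

  module _ {n} (G : Graph n) (V₁ : Subset n) where

    inV₁ : Fin n → Bool
    inV₁ = Vec.lookup V₁

    bipartiteMatrix : Carrier → Carrier → Matrix n
    bipartiteMatrix a b i j = δ j i * (if inV₁ i then a else b) + - 1# * adjacency G i j

  product-side : ∀ {n} (V : Subset n) s →
    product (λ i → if Vec.lookup V i then s else 1#) ≈ s ^ ∣ V ∣
  product-side Vec.[]            s = refl
  product-side (true Vec.∷ V)  s = *-congˡ (product-side V s)
  product-side (false Vec.∷ V) s = trans (*-identityˡ _) (product-side V s)

  module _ {n} {G : Graph n} {V₁ V₂ : Subset n} {q₁ q₂} (semi : SemiRegular G V₁ V₂ q₁ q₂) where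

    open SemiRegular semi

    private
      ∈⇒true : ∀ {V : Subset n} {v} → v ∈ˢ V → Vec.lookup V v ≡ true
      ∈⇒true = Vec.[]=⇒lookup

      lookup-V₂ : ∀ v → Vec.lookup V₂ v ≡ not (Vec.lookup V₁ v)
      lookup-V₂ v = ≡.trans (≡.cong (λ V → Vec.lookup V v) partition) (Vec.lookup-map v not V₁)

      ∈V₂⇒false : ∀ {v} → v ∈ˢ V₂ → Vec.lookup V₁ v ≡ false
      ∈V₂⇒false {v} v∈ with Vec.lookup V₁ v | lookup-V₂ v
      ... | false | _  = ≡.refl
      ... | true  | eq = contradiction (≡.trans (≡.sym (∈⇒true v∈)) eq) λ ()

      degree-true : ∀ v → Vec.lookup V₁ v ≡ true → degree G v ≡ q₁
      degree-true v eq = degree₁ v (Vec.lookup⇒[]= v V₁ eq)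

      degree-false : ∀ v → Vec.lookup V₁ v ≡ false → degree G v ≡ q₂
      degree-false v eq = degree₂ v (Vec.lookup⇒[]= v V₂ (≡.trans (lookup-V₂ v) (≡.cong not eq)))

    shiftedLaplacian-bipartite : ∀ s i j →
      shiftedLaplacian G s i j ≈ bipartiteMatrix G V₁ (ι (q₁ ℕ.+ s)) (ι (q₂ ℕ.+ s)) i j
    shiftedLaplacian-bipartite s i j with Vec.lookup V₁ i in side
    ... | true  rewrite degree-true i side  = refl
    ... | false rewrite degree-false i side = refl

    ∣V₁∣+∣V₂∣ : ∣ V₁ ∣ ℕ.+ ∣ V₂ ∣ ≡ n
    ∣V₁∣+∣V₂∣ rewrite partition | Subset.∣∁p∣≡n∸∣p∣ V₁ = ℕ.m+[n∸m]≡n (Subset.∣p∣≤n V₁)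

    -- Multiplying the columns of V₂ by s on the left amounts to multiplying
    -- the rows of V₁ by s on the right.
    scale-sides : ∀ s a b → s ^ ∣ V₂ ∣ * det (bipartiteMatrix G V₁ (s * a) b)
                          ≈ s ^ ∣ V₁ ∣ * det (bipartiteMatrix G V₁ a (s * b))
    scale-sides s a b = begin
      s ^ ∣ V₂ ∣ * det M
        ≈⟨ *-congʳ (product-side V₂ s) ⟨
      product column * det M
        ≈⟨ det-scale-columns column M ⟨
      det (λ i j → column j * M i j)
        ≈⟨ det-cong entry ⟩
      det (λ i j → row i * N i j)
        ≈⟨ det-scale-rows row N ⟩
      product row * det N
        ≈⟨ *-congʳ (product-side V₁ s) ⟩
      s ^ ∣ V₁ ∣ * det N ∎
      where
      M N : Matrix n
      M = bipartiteMatrix G V₁ (s * a) b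
      N = bipartiteMatrix G V₁ a (s * b)
      row column : Fin n → Carrier
      row i    = if Vec.lookup V₁ i then s else 1#
      column j = if Vec.lookup V₂ j then s else 1#

      diagonal : ∀ i → column i * (if Vec.lookup V₁ i then s * a else b)
                     ≈ row i * (if Vec.lookup V₁ i then a else s * b)
      diagonal i rewrite lookup-V₂ i with Vec.lookup V₁ i
      ... | true  = *-identityˡ _
      ... | false = sym (*-identityˡ _)

      weighted-δ : ∀ i j → δ j i * (column j * (if Vec.lookup V₁ i then s * a else b))
                         ≈ δ j i * (row i * (if Vec.lookup V₁ i then a else s * b))
      weighted-δ i j with j Fin.≟ i
      ... | yes ≡.refl = *-congˡ (diagonal i)
      ... | no  _      = trans (zeroˡ _) (sym (zeroˡ _))

      weighted-adjacency : ∀ i j → column j * adjacency G i j ≈ row i * adjacency G i j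
      weighted-adjacency i j with adj G i j in eq
      ... | false = trans (zeroʳ _) (sym (zeroʳ _))
      ... | true with bipartite i j eq
      ...   | inj₁ (i∈V₁ , j∈V₂) rewrite ∈⇒true i∈V₁ | ∈⇒true j∈V₂ = refl
      ...   | inj₂ (i∈V₂ , j∈V₁) rewrite ∈V₂⇒false i∈V₂ | lookup-V₂ j | ∈⇒true j∈V₁ = refl

      entry : ∀ i j → column j * M i j ≈ row i * N i j
      entry i j = begin
        column j * M i j
          ≈⟨ solve 5 (λ c d x e y → c :* (d :* x :+ e :* y) := d :* (c :* x) :+ e :* (c :* y))
               refl _ (δ j i) _ (- 1#) _ ⟩
        δ j i * (column j * (if Vec.lookup V₁ i then s * a else b)) + - 1# * (column j * adjacency G i j)
          ≈⟨ +-cong (weighted-δ i j) (*-congˡ (weighted-adjacency i j)) ⟩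
        δ j i * (row i * (if Vec.lookup V₁ i then a else s * b)) + - 1# * (row i * adjacency G i j)
          ≈⟨ solve 5 (λ c d x e y → c :* (d :* x :+ e :* y) := d :* (c :* x) :+ e :* (c :* y))
               refl _ (δ j i) _ (- 1#) _ ⟨
        row i * N i j ∎

    private
      if-cong : ∀ {p} {a b c d : Carrier} → a ≈ c → b ≈ d → (if p then a else b) ≈ (if p then c else d)
      if-cong {true}  a≈c b≈d = a≈c
      if-cong {false} a≈c b≈d = b≈d

    F : Carrier → Carrier → Carrier
    F a b = det (bipartiteMatrix G V₁ a b)

    F-cong : ∀ {a b c d} → a ≈ c → b ≈ d → F a b ≈ F c d
    F-cong a≈c b≈d = det-cong λ i j → +-congʳ (*-congˡ {δ j i} (if-cong {Vec.lookup V₁ i} a≈c b≈d))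

    polynomial-F : ∀ {f} b → Polynomial f → Polynomial (λ x → F (f x) b)
    polynomial-F {f} b poly = polynomial-det λ i j →
      polynomial-+ (polynomial-* (polynomial-const (δ j i)) (side i))
                   (polynomial-const (- 1# * adjacency G i j))
      where
      side : ∀ i → Polynomial (λ x → if Vec.lookup V₁ i then f x else b)
      side i with Vec.lookup V₁ i
      ... | true  = poly
      ... | false = polynomial-const b

    module _ (ι-cancellable : ∀ n → Cancellable (ι (suc n))) (1≉0 : ¬ 1# ≈ 0#)
             (ls : List Carrier) (ls-cancellable : All Cancellable ls)
             (θ-length : length (ls ++ map -_ ls ++ replicate (n ℕ.∸ 2 ℕ.* length ls) 0#) ≡ n)
             (spectrum : ∀ x → F x x ≈
               prodList (map (λ t → x - t) (ls ++ map -_ ls ++ replicate (n ℕ.∸ 2 ℕ.* length ls) 0#)))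
             where

      private
        k n₁ n₂ r : ℕ
        k = length ls
        n₁ = ∣ V₁ ∣
        n₂ = ∣ V₂ ∣
        r = n ℕ.∸ 2 ℕ.* k

        2k+r≡n : k ℕ.+ (k ℕ.+ r) ≡ n
        2k+r≡n = ≡.trans (≡.sym (≡.trans (length-++ ls)
          (≡.cong (k ℕ.+_) (≡.trans (length-++ (map -_ ls))
            (≡.cong₂ ℕ._+_ (length-map -_ ls) (length-replicate r)))))) θ-length

        F-diagonal : ∀ x → F x x ≈ x ^ r * spectralProduct (x * x) ls
        F-diagonal x = trans (spectrum x) (prodList-spectrum x ls r)

        F-scaled : ∀ s b → s ^ n₂ * F (s * (s * b)) b
                         ≈ s ^ n₁ * ((s * b) ^ r * spectralProduct ((s * b) * (s * b)) ls)
        F-scaled s b = trans (scale-sides s (s * b) b) (*-congˡ (F-diagonal (s * b)))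

        -- Up to sign the value is the product of the squares of the eigenvalues. The form `0# * 0#`
        -- is what substituting s = 0 into s * s produces.
        spectralProduct-0 : ∀ {ls} → All Cancellable ls → Cancellable (spectralProduct (0# * 0#) ls)
        spectralProduct-0 []       = cancellable-1
        spectralProduct-0 (_∷_ {l} cl cls) = cancellable-* factor (spectralProduct-0 cls)
          where
          factor : Cancellable (0# * 0# - l * l)
          factor {y} eq = cl (cl (begin
            l * (l * y)
              ≈⟨ solve 2 (λ l y → l :* (l :* y) := con 1 :* (l :* l :* y)) refl l y ⟩
            1# * (l * l * y)
              ≈⟨ *-congʳ -1*-1≈1 ⟨
            (- 1# * - 1#) * (l * l * y)
              ≈⟨ solve 3 (λ e l y → (e :* e) :* (l :* l :* y)
                                 := e :* ((con 0 :* con 0 :+ e :* (l :* l)) :* y)) refl (- 1#) l y ⟩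
            - 1# * ((0# * 0# + - 1# * (l * l)) * y)
              ≈⟨ *-congˡ (trans (*-congʳ (+-congˡ (-1*x≈-x (l * l)))) eq) ⟩
            - 1# * 0#
              ≈⟨ zeroʳ _ ⟩
            0# ∎))

      -- Otherwise s ^ suc d * F (s²) 1 = ∏ (s² - l²) for all s ≠ 0, hence
      -- also for s = 0.
      k≤∣V₁∣ : k ℕ.≤ n₁
      k≤∣V₁∣ with k ℕ.≤? n₁
      ... | yes k≤n₁ = k≤n₁
      ... | no  k≰n₁ = contradiction (spectralProduct-0 ls-cancellable (begin
          spectralProduct (0# * 0#) ls * 1#
            ≈⟨ *-congʳ (at-all 0#) ⟨
          0# ^ suc d * F (0# * 0#) 1# * 1#
            ≈⟨ solve 2 (λ x y → con 0 :* x :* y :* con 1 := con 0) refl _ _ ⟩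
          0# ∎)) 1≉0
        where
        c′ = proj₁ (ℕ.m≤n⇒∃[o]m+o≡n (ℕ.≰⇒> k≰n₁))
        k≡ : k ≡ suc n₁ ℕ.+ c′
        k≡ = ≡.sym (proj₂ (ℕ.m≤n⇒∃[o]m+o≡n (ℕ.≰⇒> k≰n₁)))
        -- `suc d` is 2 (k - n₁), the surplus of the exponent n₂ on one side of the scaling law over
        -- n₁ + r on the other.
        d = suc (c′ ℕ.+ c′)
        n₂≡ : n₂ ≡ (n₁ ℕ.+ r) ℕ.+ suc d
        n₂≡ = ℕ.+-cancelˡ-≡ n₁ _ _ (≡.trans ∣V₁∣+∣V₂∣ (≡.trans (≡.sym 2k+r≡n)
          (≡.trans (≡.cong (λ k → k ℕ.+ (k ℕ.+ r)) k≡)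
            (ℕS.solve 3 (λ n c r → (ℕS.con 1 ℕS.:+ n ℕS.:+ c) ℕS.:+ ((ℕS.con 1 ℕS.:+ n ℕS.:+ c) ℕS.:+ r)
               ℕS.:= n ℕS.:+ ((n ℕS.:+ r) ℕS.:+ (ℕS.con 2 ℕS.:+ (c ℕS.:+ c)))) ≡.refl n₁ c′ r))))

        at-point : ∀ {s} → Cancellable s → s ^ suc d * F (s * s) 1# ≈ spectralProduct (s * s) ls
        at-point {s} cs = cancel (cancellable-^ cs (n₁ ℕ.+ r)) (begin
          s ^ (n₁ ℕ.+ r) * (s ^ suc d * F (s * s) 1#)
            ≈⟨ *-assoc _ _ _ ⟨
          s ^ (n₁ ℕ.+ r) * s ^ suc d * F (s * s) 1#
            ≈⟨ *-cong (sym (^-homo-* s (n₁ ℕ.+ r) (suc d)))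
                      (F-cong (*-congˡ (sym (*-identityʳ s))) refl) ⟩
          s ^ ((n₁ ℕ.+ r) ℕ.+ suc d) * F (s * (s * 1#)) 1#
            ≡⟨ ≡.cong (λ m → s ^ m * F (s * (s * 1#)) 1#) (≡.sym n₂≡) ⟩
          s ^ n₂ * F (s * (s * 1#)) 1#
            ≈⟨ F-scaled s 1# ⟩
          s ^ n₁ * ((s * 1#) ^ r * spectralProduct ((s * 1#) * (s * 1#)) ls)
            ≈⟨ *-congˡ (*-cong (^-congˡ r (*-identityʳ s))
                 (spectralProduct-cong (*-cong (*-identityʳ s) (*-identityʳ s)) ls)) ⟩
          s ^ n₁ * (s ^ r * spectralProduct (s * s) ls)
            ≈⟨ *-assoc _ _ _ ⟨
          s ^ n₁ * s ^ r * spectralProduct (s * s) ls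
            ≈⟨ *-congʳ (^-homo-* s n₁ r) ⟨
          s ^ (n₁ ℕ.+ r) * spectralProduct (s * s) ls ∎)

        at-all : ∀ s → s ^ suc d * F (s * s) 1# ≈ spectralProduct (s * s) ls
        at-all = polynomial-identity ι-cancellable
          (polynomial-* (polynomial-^ polynomial-id (suc d))
                        (polynomial-F 1# (polynomial-* polynomial-id polynomial-id)))
          (polynomial-spectralProduct (polynomial-* polynomial-id polynomial-id) ls)
          -- The nodes are 1, 2, 3, ...; zero is left out because `at-point` cancels a power of s.
          suc (λ j → ℕ.n<1+n (suc j)) (λ j → at-point (ι-cancellable j))

      module _ (n₁≤n₂ : n₁ ℕ.≤ n₂) where

        private
          e f : ℕ
          e = n₁ ℕ.∸ k
          f = n₂ ℕ.∸ k

          n₁≡ : n₁ ≡ k ℕ.+ e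
          n₁≡ = ≡.sym (ℕ.m+[n∸m]≡n k≤∣V₁∣)
          n₂≡ : n₂ ≡ k ℕ.+ f
          n₂≡ = ≡.sym (ℕ.m+[n∸m]≡n (ℕ.≤-trans k≤∣V₁∣ n₁≤n₂))

          r≡ : r ≡ e ℕ.+ f
          r≡ = ℕ.+-cancelˡ-≡ (k ℕ.+ k) _ _ (≡.trans (ℕ.+-assoc k k r)
            (≡.trans 2k+r≡n (≡.trans (≡.sym ∣V₁∣+∣V₂∣) (≡.trans (≡.cong₂ ℕ._+_ n₁≡ n₂≡)
              (ℕS.solve 3 (λ k e f → (k ℕS.:+ e) ℕS.:+ (k ℕS.:+ f) ℕS.:= (k ℕS.:+ k) ℕS.:+ (e ℕS.:+ f))
                 ≡.refl k e f)))))

          -- With n₁ = k + e, n₂ = k + f and r = e + f, the powers s^n₁ (s b)^r regroup as s^n₂ (s²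
          -- b)^e b^f, and s^n₂ cancels.
          at-point : ∀ {s} → Cancellable s → ∀ b →
            F (s * (s * b)) b ≈ (s * (s * b)) ^ e * b ^ f * spectralProduct (s * (s * b) * b) ls
          at-point {s} cs b = cancel (cancellable-^ cs n₂) (begin
            s ^ n₂ * F (s * (s * b)) b
              ≈⟨ F-scaled s b ⟩
            s ^ n₁ * ((s * b) ^ r * spectralProduct ((s * b) * (s * b)) ls)
              ≈⟨ *-cong (trans (reflexive (≡.cong (s ^_) n₁≡)) (^-homo-* s k e))
                   (*-cong (trans (reflexive (≡.cong ((s * b) ^_) r≡))
                             (trans (^-homo-* (s * b) e f) (*-congˡ (^-distrib-* s b f))))
                           (spectralProduct-cong
                             (solve 2 (λ s b → s :* b :* (s :* b) := s :* (s :* b) :* b) refl s b) ls)) ⟩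
            (s ^ k * s ^ e) * ((s * b) ^ e * (s ^ f * b ^ f) * P)
              ≈⟨ solve 6 (λ sk se sf sbe bf p → (sk :* se) :* (sbe :* (sf :* bf) :* p)
                                              := (sk :* sf) :* ((se :* sbe) :* bf :* p))
                   refl (s ^ k) (s ^ e) (s ^ f) ((s * b) ^ e) (b ^ f) P ⟩
            (s ^ k * s ^ f) * ((s ^ e * (s * b) ^ e) * b ^ f * P)
              ≈⟨ *-cong (trans (reflexive (≡.cong (s ^_) n₂≡)) (^-homo-* s k f))
                        (*-congʳ (*-congʳ (^-distrib-* s (s * b) e))) ⟨
            s ^ n₂ * ((s * (s * b)) ^ e * b ^ f * P) ∎)
            where P = spectralProduct (s * (s * b) * b) ls

        -- The second argument is fixed at a positive integer B, so that the nodes s² B for s = 1,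
        -- 2, 3, ... are images of strictly increasing natural numbers, as `polynomial-identity`
        -- demands. The first argument is then arbitrary.
        F-formula : ∀ b a → F a (ι (suc b)) ≈
          a ^ (n₁ ℕ.∸ k) * ι (suc b) ^ (n₂ ℕ.∸ k) * spectralProduct (a * ι (suc b)) ls
        F-formula b = polynomial-identity ι-cancellable
          (polynomial-F B polynomial-id)
          (polynomial-* (polynomial-* (polynomial-^ polynomial-id e) (polynomial-const (B ^ f)))
             (polynomial-spectralProduct (polynomial-* polynomial-id (polynomial-const B)) ls))
          point mono λ j → begin
            F (ι (point j)) B
              ≈⟨ F-cong (ι-point j) refl ⟩
            F (ι (suc j) * (ι (suc j) * B)) B
              ≈⟨ at-point (ι-cancellable j) B ⟩
            (ι (suc j) * (ι (suc j) * B)) ^ e * B ^ f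
              * spectralProduct (ι (suc j) * (ι (suc j) * B) * B) ls
              ≈⟨ *-cong (*-congʳ (^-congˡ e (ι-point j)))
                        (spectralProduct-cong (*-congʳ (ι-point j)) ls) ⟨
            ι (point j) ^ e * B ^ f * spectralProduct (ι (point j) * B) ls ∎
          where
          B = ι (suc b)
          point : ℕ → ℕ
          point j = suc j ℕ.* (suc j ℕ.* suc b)
          mono : ∀ j → point j ℕ.< point (suc j)
          mono j = ℕ.*-mono-< (ℕ.n<1+n (suc j)) (ℕ.*-monoˡ-< (suc b) (ℕ.n<1+n (suc j)))
          ι-point : ∀ j → ι (point j) ≈ ι (suc j) * (ι (suc j) * B)
          ι-point j = trans (×1-homo-* (suc j) (suc j ℕ.* suc b)) (*-congˡ (×1-homo-* (suc j) (suc b)))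

        det-shiftedLaplacian : ∀ s → det (shiftedLaplacian G s) ≈
          ι (q₁ ℕ.+ s) ^ (n₁ ℕ.∸ k) * ι (q₂ ℕ.+ s) ^ (n₂ ℕ.∸ k)
          * spectralProduct (ι ((q₁ ℕ.+ s) ℕ.* (q₂ ℕ.+ s))) ls
        -- `q₂≥1` makes `q₂ + s` a successor even for s = 0, the form that `F-formula` asks of its
        -- second argument.
        det-shiftedLaplacian s with q₂ ℕ.+ s in eq | ℕ.≤-trans q₂≥1 (ℕ.m≤m+n q₂ s)
        ... | suc b | _ = begin
          det (shiftedLaplacian G s)
            ≈⟨ det-cong (shiftedLaplacian-bipartite s) ⟩
          F (ι (q₁ ℕ.+ s)) (ι (q₂ ℕ.+ s))
            ≡⟨ ≡.cong (λ m → F (ι (q₁ ℕ.+ s)) (ι m)) eq ⟩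
          F (ι (q₁ ℕ.+ s)) (ι (suc b))
            ≈⟨ F-formula b (ι (q₁ ℕ.+ s)) ⟩
          ι (q₁ ℕ.+ s) ^ e * ι (suc b) ^ f * spectralProduct (ι (q₁ ℕ.+ s) * ι (suc b)) ls
            ≈⟨ *-congˡ (spectralProduct-cong (×1-homo-* (q₁ ℕ.+ s) (suc b)) ls) ⟨
          ι (q₁ ℕ.+ s) ^ e * ι (suc b) ^ f * spectralProduct (ι ((q₁ ℕ.+ s) ℕ.* suc b)) ls ∎

open import Data.Nat.Base using (_+_; _*_; _∸_; _^_; _≤_)

-- The spanning tree formula over a general ring

module JoinFormula {c ℓ} (R : CommutativeRing c ℓ) where

  open CommutativeRing R hiding (zero) renaming (_+_ to _⊹_; _*_ to _∙_)
  open Determinant rawRing using (Matrix; det)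
  open Determinants R
  open MatrixTree R
  open SemiRegularSpectrum R
  open import Algebra.Properties.Semiring.Exp semiring using () renaming (_^_ to _^ᴿ_)
  open import Algebra.Properties.Semiring.Mult semiring using (×-homo-+; ×1-homo-*)
  open import Algebra.Properties.Ring ring using (-1*x≈-x)
  open import Algebra.Solver.Ring.NaturalCoefficients.Default commutativeSemiring
    using (solve; _:=_; _:*_)
  open import Relation.Binary.Reasoning.Setoid setoid

  ι-^ : ∀ m k → ι (m ^ k) ≈ ι m ^ᴿ k
  ι-^ m zero    = +-identityʳ 1#
  ι-^ m (suc k) = trans (×1-homo-* m (m ^ k)) (*-congˡ (ι-^ m k))

  characteristicMatrix : ∀ {n} → Graph n → Carrier → Matrix n
  characteristicMatrix G x i j = (if does (i Fin.≟ j) then x else 0#) - adjacency G i j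

  bipartiteMatrix-diagonal : ∀ {n} (G : Graph n) V x i j →
    bipartiteMatrix G V x x i j ≈ characteristicMatrix G x i j
  bipartiteMatrix-diagonal G V x i j = +-cong diagonal (-1*x≈-x _)
    where
    same : ∀ p → (if p then x else x) ≈ x
    same true  = refl
    same false = refl
    diagonal : δ j i ∙ (if Vec.lookup V i then x else x) ≈ (if does (i Fin.≟ j) then x else 0#)
    diagonal with i Fin.≟ j
    ... | yes ≡.refl = trans (*-cong (δ-refl i) (same (Vec.lookup V i))) (*-identityˡ x)
    ... | no  i≢j    = trans (*-congʳ (δ-≢ λ j≡i → i≢j (≡.sym j≡i))) (zeroˡ _)

  -- The largest eigenvalue contributes (q₁ + s) (q₂ + s) - q₁ q₂ = s (q₁ + q₂ + s).
  largest-factor : ∀ q₁ q₂ s {l} → l ∙ l ≈ ι (q₁ * q₂) →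
    ι ((q₁ + s) * (q₂ + s)) - l ∙ l ≈ ι s ∙ ι (q₁ + q₂ + s)
  largest-factor q₁ q₂ s {l} l²≈ = begin
    ι ((q₁ + s) * (q₂ + s)) - l ∙ l
      ≡⟨ ≡.cong (λ m → ι m - l ∙ l)
           (ℕS.solve 3 (λ q r s → (q ℕS.:+ s) ℕS.:* (r ℕS.:+ s)
                              ℕS.:= s ℕS.:* (q ℕS.:+ r ℕS.:+ s) ℕS.:+ q ℕS.:* r) ≡.refl q₁ q₂ s) ⟩
    ι (s * (q₁ + q₂ + s) + q₁ * q₂) - l ∙ l
      ≈⟨ +-cong (×-homo-+ 1# (s * (q₁ + q₂ + s)) (q₁ * q₂)) (-‿cong l²≈) ⟩
    ι (s * (q₁ + q₂ + s)) ⊹ ι (q₁ * q₂) - ι (q₁ * q₂)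
      ≈⟨ trans (+-assoc _ _ _) (trans (+-congˡ (-‿inverseʳ _)) (+-identityʳ _)) ⟩
    ι (s * (q₁ + q₂ + s))
      ≈⟨ ×1-homo-* s (q₁ + q₂ + s) ⟩
    ι s ∙ ι (q₁ + q₂ + s) ∎

  eigenvalues : ℕ → List Carrier → List Carrier
  eigenvalues n ls = ls ++ map -_ ls ++ replicate (n ∸ 2 * length ls) 0#

  module _ (ι-cancellable : ∀ n → Cancellable (ι (suc n))) (1≉0 : ¬ 1# ≈ 0#) where

    det-shiftedLaplacian-semiregular :
      ∀ {n} {G : Graph n} {V₁ V₂ : Subset n} {q₁ q₂} → SemiRegular G V₁ V₂ q₁ q₂ →
      ∣ V₁ ∣ ≤ ∣ V₂ ∣ → ∀ l ls → All Cancellable (l ∷ ls) → l ∙ l ≈ ι (q₁ * q₂) →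
      length (eigenvalues n (l ∷ ls)) ≡ n →
      (∀ x → det (characteristicMatrix G x) ≈ prodList (map (λ t → x - t) (eigenvalues n (l ∷ ls)))) →
      ∀ s → det (shiftedLaplacian G s) ≈
        ι s ∙ (ι (q₁ + q₂ + s) ∙ (ι (q₁ + s) ^ᴿ (∣ V₁ ∣ ∸ suc (length ls))
                                 ∙ ι (q₂ + s) ^ᴿ (∣ V₂ ∣ ∸ suc (length ls))
                                 ∙ spectralProduct (ι ((q₁ + s) * (q₂ + s))) ls))
    det-shiftedLaplacian-semiregular {G = G} {V₁} {V₂} {q₁} {q₂}
      semi V₁≤V₂ l ls cls l²≈ len spectrum s = begin
      det (shiftedLaplacian G s)
        ≈⟨ det-shiftedLaplacian semi ι-cancellable 1≉0 (l ∷ ls) cls len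
             (λ x → trans (det-cong (bipartiteMatrix-diagonal G V₁ x)) (spectrum x)) V₁≤V₂ s ⟩
      X ∙ Y ∙ ((ι ((q₁ + s) * (q₂ + s)) - l ∙ l) ∙ S)
        ≈⟨ *-congˡ (*-congʳ (largest-factor q₁ q₂ s l²≈)) ⟩
      X ∙ Y ∙ (ι s ∙ ι (q₁ + q₂ + s) ∙ S)
        ≈⟨ solve 5 (λ x y a b p → x :* y :* (a :* b :* p) := a :* (b :* (x :* y :* p))) refl X Y _ _ S ⟩
      ι s ∙ (ι (q₁ + q₂ + s) ∙ (X ∙ Y ∙ S)) ∎
      where
      X = ι (q₁ + s) ^ᴿ (∣ V₁ ∣ ∸ suc (length ls))
      Y = ι (q₂ + s) ^ᴿ (∣ V₂ ∣ ∸ suc (length ls))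
      S = spectralProduct (ι ((q₁ + s) * (q₂ + s))) ls

    -- The embedding of ℕ, the product and the spectral products are arbitrary up
    -- to ≈, because for ℝ the conversion checker must not compare, say, _-ᵣ_ with
    -- the subtraction of the ring ℝ: it would unfold the moduli of convergence.
    τ-join-semiregular :
      (emb : ℕ → Carrier) → (∀ n → emb n ≈ ι n) →
      (_⊛_ : Carrier → Carrier → Carrier) → (∀ x y → x ∙ y ≈ x ⊛ y) →
      (spec : Carrier → List Carrier → Carrier) → (∀ x ls → spectralProduct x ls ≈ spec x ls) →
      ∀ {m n} (G₁ : Graph (suc m)) (G₂ : Graph (suc n))
        (V₁ V₂ : Subset (suc m)) (V₃ V₄ : Subset (suc n)) q₁ q₂ q₃ q₄ l₁ m₁ ls ms →
      let ν₁ = suc m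
          ν₂ = suc n
          k₁ = length (l₁ ∷ ls)
          k₂ = length (m₁ ∷ ms)
      in
      SemiRegular G₁ V₁ V₂ q₁ q₂ → SemiRegular G₂ V₃ V₄ q₃ q₄ →
      ∣ V₁ ∣ ≤ ∣ V₂ ∣ → ∣ V₃ ∣ ≤ ∣ V₄ ∣ →
      length (eigenvalues ν₁ (l₁ ∷ ls)) ≡ ν₁ →
      (∀ x → det (characteristicMatrix G₁ x) ≈ prodList (map (λ t → x - t) (eigenvalues ν₁ (l₁ ∷ ls)))) →
      length (eigenvalues ν₂ (m₁ ∷ ms)) ≡ ν₂ →
      (∀ x → det (characteristicMatrix G₂ x) ≈ prodList (map (λ t → x - t) (eigenvalues ν₂ (m₁ ∷ ms)))) →
      l₁ ∙ l₁ ≈ emb (q₁ * q₂) → m₁ ∙ m₁ ≈ emb (q₃ * q₄) →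
      All Cancellable (l₁ ∷ ls) → All Cancellable (m₁ ∷ ms) →
      emb (τ (G₁ ∨ G₂)) ≈
        ((emb ((q₁ + q₂ + ν₂) * (q₃ + q₄ + ν₁)
           * (q₁ + ν₂) ^ (∣ V₁ ∣ ∸ k₁) * (q₂ + ν₂) ^ (∣ V₂ ∣ ∸ k₁)
           * (q₃ + ν₁) ^ (∣ V₃ ∣ ∸ k₂) * (q₄ + ν₁) ^ (∣ V₄ ∣ ∸ k₂))
        ⊛ spec (emb ((q₁ + ν₂) * (q₂ + ν₂))) ls)
        ⊛ spec (emb ((q₃ + ν₁) * (q₄ + ν₁))) ms)
    τ-join-semiregular emb emb≈ι _⊛_ ∙≈⊛ spec ≈spec {m} {n} G₁ G₂ V₁ V₂ V₃ V₄ q₁ q₂ q₃ q₄ l₁ m₁ ls ms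
      semi₁ semi₂ V₁≤V₂ V₃≤V₄ len₁ spec₁ len₂ spec₂ l₁² m₁² cls cms =
      begin
        emb (τ (G₁ ∨ G₂))
          ≈⟨ emb≈ι (τ (G₁ ∨ G₂)) ⟩
        ι (τ (G₁ ∨ G₂))
          ≈⟨ in-ι ⟩
        ι N ∙ S₁ ∙ S₂
          ≈⟨ *-cong (*-cong (emb≈ι N) (in-spec (c₁ * c₂) ls)) (in-spec (c₃ * c₄) ms) ⟨
        emb N ∙ spec (emb (c₁ * c₂)) ls ∙ spec (emb (c₃ * c₄)) ms
          ≈⟨ trans (*-congʳ (∙≈⊛ _ _)) (∙≈⊛ _ _) ⟩
        ((emb N ⊛ spec (emb (c₁ * c₂)) ls) ⊛ spec (emb (c₃ * c₄)) ms) ∎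
      where
      ν₁ ν₂ a b c₁ c₂ c₃ c₄ e₁ e₂ e₃ e₄ N : ℕ
      ν₁ = suc m
      ν₂ = suc n
      a = q₁ + q₂ + ν₂
      b = q₃ + q₄ + ν₁
      c₁ = q₁ + ν₂
      c₂ = q₂ + ν₂
      c₃ = q₃ + ν₁
      c₄ = q₄ + ν₁
      e₁ = ∣ V₁ ∣ ∸ suc (length ls)
      e₂ = ∣ V₂ ∣ ∸ suc (length ls)
      e₃ = ∣ V₃ ∣ ∸ suc (length ms)
      e₄ = ∣ V₄ ∣ ∸ suc (length ms)
      N = a * b * c₁ ^ e₁ * c₂ ^ e₂ * c₃ ^ e₃ * c₄ ^ e₄
      S₁ = spectralProduct (ι (c₁ * c₂)) ls
      S₂ = spectralProduct (ι (c₃ * c₄)) ms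
      ι-*^ : ∀ x c e {y} → ι x ≈ y → ι (x * c ^ e) ≈ y ∙ ι c ^ᴿ e
      ι-*^ x c e ιx≈y = trans (×1-homo-* x (c ^ e)) (*-cong ιx≈y (ι-^ c e))
      in-spec : ∀ x ls → spec (emb x) ls ≈ spectralProduct (ι x) ls
      in-spec x ls = trans (sym (≈spec (emb x) ls)) (spectralProduct-cong (emb≈ι x) ls)
      in-ι : ι (τ (G₁ ∨ G₂)) ≈ ι N ∙ S₁ ∙ S₂
      in-ι = cancel (cancellable-* (ι-cancellable m) (ι-cancellable n)) (begin
        ι ν₁ ∙ ι ν₂ ∙ ι (τ (G₁ ∨ G₂))
          ≈⟨ τ-join G₁ G₂ ⟩
        det (shiftedLaplacian G₁ ν₂) ∙ det (shiftedLaplacian G₂ ν₁)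
          ≈⟨ *-cong
               (det-shiftedLaplacian-semiregular semi₁ V₁≤V₂ l₁ ls cls
                 (trans l₁² (emb≈ι (q₁ * q₂))) len₁ spec₁ ν₂)
               (det-shiftedLaplacian-semiregular semi₂ V₃≤V₄ m₁ ms cms
                 (trans m₁² (emb≈ι (q₃ * q₄))) len₂ spec₂ ν₁) ⟩
        ι ν₂ ∙ (ι a ∙ (ι c₁ ^ᴿ e₁ ∙ ι c₂ ^ᴿ e₂ ∙ S₁)) ∙ (ι ν₁ ∙ (ι b ∙ (ι c₃ ^ᴿ e₃ ∙ ι c₄ ^ᴿ e₄ ∙ S₂)))
          ≈⟨ solve 10 (λ x y a b p q r s u v →
                 y :* (a :* (p :* q :* u)) :* (x :* (b :* (r :* s :* v)))
              := x :* y :* (a :* b :* p :* q :* r :* s :* u :* v))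
               refl (ι ν₁) (ι ν₂) (ι a) (ι b)
               (ι c₁ ^ᴿ e₁) (ι c₂ ^ᴿ e₂) (ι c₃ ^ᴿ e₃) (ι c₄ ^ᴿ e₄) S₁ S₂ ⟩
        ι ν₁ ∙ ι ν₂ ∙ (ι a ∙ ι b ∙ ι c₁ ^ᴿ e₁ ∙ ι c₂ ^ᴿ e₂ ∙ ι c₃ ^ᴿ e₃ ∙ ι c₄ ^ᴿ e₄ ∙ S₁ ∙ S₂)
          ≈⟨ *-congˡ (*-congʳ (*-congʳ
               (ι-*^ (a * b * c₁ ^ e₁ * c₂ ^ e₂ * c₃ ^ e₃) c₄ e₄
               (ι-*^ (a * b * c₁ ^ e₁ * c₂ ^ e₂) c₃ e₃
               (ι-*^ (a * b * c₁ ^ e₁) c₂ e₂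
               (ι-*^ (a * b) c₁ e₁ (×1-homo-* a b))))))) ⟨
        ι ν₁ ∙ ι ν₂ ∙ (ι (a * b * c₁ ^ e₁ * c₂ ^ e₂ * c₃ ^ e₃ * c₄ ^ e₄) ∙ S₁ ∙ S₂) ∎)

-- The reals as a commutative ring

module RealRing where

  open ≡ using (refl; sym; trans; cong; subst)
  open ℚ-Solver.+-*-Solver using (solve; _:=_; _:+_; _:*_; _:-_; :-_)

  -- `x ≃ y` unfolds to `Null` of the termwise difference, so congruence laws become closure
  -- properties of null sequences.
  Null : (ℕ → ℚ) → Set
  Null f = ∀ δ → 0ℚ ℚ.< δ → ∃[ N ] ∀ n → N ℕ.≤ n → ℚ.∣ f n ∣ ℚ.< δ

  Bounded : (ℕ → ℚ) → Set
  Bounded f = ∃[ K ] 0ℚ ℚ.< K × ∃[ N ] ∀ n → N ℕ.≤ n → ℚ.∣ f n ∣ ℚ.≤ K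

  null-cong : ∀ {f g} → (∀ n → f n ≡ g n) → Null f → Null g
  null-cong f≗g null δ 0<δ with null δ 0<δ
  ... | N , small = N , λ n N≤n → subst (λ q → ℚ.∣ q ∣ ℚ.< δ) (f≗g n) (small n N≤n)

  null-0 : Null λ _ → 0ℚ
  null-0 δ 0<δ = 0 , λ _ _ → 0<δ

  null-+ : ∀ {f g} → Null f → Null g → Null λ n → f n ℚ.+ g n
  null-+ {f} {g} nullf nullg δ 0<δ = M ℕ.⊔ N , λ n p → begin-strict
    ℚ.∣ f n ℚ.+ g n ∣
      ≤⟨ ℚ.∣p+q∣≤∣p∣+∣q∣ (f n) (g n) ⟩
    ℚ.∣ f n ∣ ℚ.+ ℚ.∣ g n ∣
      <⟨ ℚ.+-mono-< (smallf n (ℕ.m⊔n≤o⇒m≤o M N p)) (smallg n (ℕ.m⊔n≤o⇒n≤o M N p)) ⟩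
    ½ ℚ.* δ ℚ.+ ½ ℚ.* δ
      ≡⟨ trans (sym (ℚ.*-distribʳ-+ δ ½ ½)) (ℚ.*-identityˡ δ) ⟩
    δ ∎
    where
    open ℚ.≤-Reasoning
    0<½δ : 0ℚ ℚ.< ½ ℚ.* δ
    0<½δ = subst (ℚ._< ½ ℚ.* δ) (ℚ.*-zeroʳ ½) (ℚ.*-monoʳ-<-pos ½ 0<δ)
    M = proj₁ (nullf (½ ℚ.* δ) 0<½δ)
    N = proj₁ (nullg (½ ℚ.* δ) 0<½δ)
    smallf = proj₂ (nullf (½ ℚ.* δ) 0<½δ)
    smallg = proj₂ (nullg (½ ℚ.* δ) 0<½δ)

  null-* : ∀ {f g} → Bounded f → Null g → Null λ n → f n ℚ.* g n
  null-* {f} {g} (K , 0<K , M , f≤K) null δ 0<δ = M ℕ.⊔ N , λ n p → begin-strict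
    ℚ.∣ f n ℚ.* g n ∣
      ≡⟨ ℚ.∣p*q∣≡∣p∣*∣q∣ (f n) (g n) ⟩
    ℚ.∣ f n ∣ ℚ.* ℚ.∣ g n ∣
      ≤⟨ ℚ.*-monoʳ-≤-nonNeg ℚ.∣ g n ∣ {{nonNegative (ℚ.0≤∣p∣ (g n))}}
           (f≤K n (ℕ.m⊔n≤o⇒m≤o M N p)) ⟩
    K ℚ.* ℚ.∣ g n ∣
      <⟨ ℚ.*-monoʳ-<-pos K (small n (ℕ.m⊔n≤o⇒n≤o M N p)) ⟩
    K ℚ.* (K⁻¹ ℚ.* δ)
      ≡⟨ trans (sym (ℚ.*-assoc K K⁻¹ δ))
           (trans (cong (ℚ._* δ) (ℚ.*-inverseʳ K)) (ℚ.*-identityˡ δ)) ⟩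
    δ ∎
    where
    open ℚ.≤-Reasoning
    instance
      K-positive : ℚ.Positive K
      K-positive = positive 0<K
      K-nonZero : ℚ.NonZero K
      K-nonZero = ℚ.pos⇒nonZero K
    K⁻¹ = ℚ.1/ K
    0<K⁻¹δ : 0ℚ ℚ.< K⁻¹ ℚ.* δ
    0<K⁻¹δ = subst (ℚ._< K⁻¹ ℚ.* δ) (ℚ.*-zeroʳ K⁻¹)
                   (ℚ.*-monoʳ-<-pos K⁻¹ {{ℚ.1/pos⇒pos K}} 0<δ)
    N = proj₁ (null (K⁻¹ ℚ.* δ) 0<K⁻¹δ)
    small = proj₂ (null (K⁻¹ ℚ.* δ) 0<K⁻¹δ)

  bounded : ∀ x → Bounded (seq x)
  bounded x with cauchy x 1ℚ (ℚ.positive⁻¹ 1ℚ)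
  ... | N , near = 1ℚ ℚ.+ ℚ.∣ a ∣
      , ℚ.+-mono-<-≤ (ℚ.positive⁻¹ 1ℚ) (ℚ.0≤∣p∣ a)
      , N , λ n N≤n → begin
        ℚ.∣ seq x n ∣
          ≡⟨ cong ℚ.∣_∣ (split (seq x n) a) ⟩
        ℚ.∣ (seq x n ℚ.- a) ℚ.+ a ∣
          ≤⟨ ℚ.∣p+q∣≤∣p∣+∣q∣ (seq x n ℚ.- a) a ⟩
        ℚ.∣ seq x n ℚ.- a ∣ ℚ.+ ℚ.∣ a ∣
          ≤⟨ ℚ.+-monoˡ-≤ ℚ.∣ a ∣ (ℚ.<⇒≤ (near n N N≤n ℕ.≤-refl)) ⟩
        1ℚ ℚ.+ ℚ.∣ a ∣ ∎
    where
    open ℚ.≤-Reasoning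
    a = seq x N
    split : ∀ p q → p ≡ (p ℚ.- q) ℚ.+ q
    split = solve 2 (λ p q → p := (p :- q) :+ q) refl

  null-neg : ∀ {f} → Null f → Null λ n → ℚ.- f n
  null-neg {f} null δ 0<δ with null δ 0<δ
  ... | N , small = N , λ n N≤n → subst (ℚ._< δ) (sym (ℚ.∣-p∣≡∣p∣ (f n))) (small n N≤n)

  -- The operations act term by term, so each ring law holds exactly at every index; only the
  -- congruences involve limits.
  pointwise⇒≃ : ∀ {x y} → (∀ n → seq x n ≡ seq y n) → x ≃ y
  pointwise⇒≃ {x} {y} x≗y = null-cong
    (λ n → sym (trans (cong (ℚ._- seq y n) (x≗y n)) (ℚ.+-inverseʳ (seq y n)))) null-0

  ≃-sym : ∀ {x y} → x ≃ y → y ≃ x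
  ≃-sym {x} {y} x≃y = null-cong
    (λ n → solve 2 (λ p q → :- (p :- q) := q :- p) refl (seq x n) (seq y n)) (null-neg x≃y)

  ≃-trans : ∀ {x y z} → x ≃ y → y ≃ z → x ≃ z
  ≃-trans {x} {y} {z} x≃y y≃z = null-cong
    (λ n → solve 3 (λ p q r → (p :- q) :+ (q :- r) := p :- r) refl (seq x n) (seq y n) (seq z n))
    (null-+ x≃y y≃z)

  +ᵣ-cong : ∀ {x x′ y y′} → x ≃ x′ → y ≃ y′ → x +ᵣ y ≃ x′ +ᵣ y′
  +ᵣ-cong {x} {x′} {y} {y′} x≃ y≃ = null-cong
    (λ n → solve 4 (λ p p′ q q′ → (p :- p′) :+ (q :- q′) := (p :+ q) :- (p′ :+ q′)) refl
             (seq x n) (seq x′ n) (seq y n) (seq y′ n))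
    (null-+ x≃ y≃)

  -ᵣ-cong : ∀ {x y} → x ≃ y → -ᵣ x ≃ -ᵣ y
  -ᵣ-cong {x} {y} x≃y = null-cong
    (λ n → solve 2 (λ p q → :- (p :- q) := (:- p) :- (:- q)) refl (seq x n) (seq y n)) (null-neg x≃y)

  *ᵣ-cong : ∀ {x x′ y y′} → x ≃ x′ → y ≃ y′ → x *ᵣ y ≃ x′ *ᵣ y′
  *ᵣ-cong {x} {x′} {y} {y′} x≃ y≃ = null-cong
    (λ n → solve 4 (λ p p′ q q′ → p :* (q :- q′) :+ q′ :* (p :- p′) := p :* q :- p′ :* q′) refl
             (seq x n) (seq x′ n) (seq y n) (seq y′ n))
    (null-+ (null-* (bounded x) y≃) (null-* (bounded y′) x≃))

  ℝ-commutativeRing : CommutativeRing 0ℓ 0ℓ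
  ℝ-commutativeRing = record
    { Carrier = ℝ ; _≈_ = _≃_ ; _+_ = _+ᵣ_ ; _*_ = _*ᵣ_ ; -_ = -ᵣ_ ; 0# = 0ᵣ ; 1# = 1ᵣ
    ; isCommutativeRing = record
      { isRing = record
        { +-isAbelianGroup = record
          { isGroup = record
            { isMonoid = record
              { isSemigroup = record
                { isMagma = record
                  { isEquivalence = record
                    { refl  = λ {x} → pointwise⇒≃ {x} {x} λ _ → refl
                    ; sym   = λ {x} {y} → ≃-sym {x} {y}
                    ; trans = λ {x} {y} {z} → ≃-trans {x} {y} {z} }
                  ; ∙-cong = λ {x} {x′} {y} {y′} → +ᵣ-cong {x} {x′} {y} {y′} }
                ; assoc = λ x y z → pointwise⇒≃ {(x +ᵣ y) +ᵣ z} {x +ᵣ (y +ᵣ z)}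
                    λ n → ℚ.+-assoc (seq x n) (seq y n) (seq z n) }
              ; identity = (λ x → pointwise⇒≃ {0ᵣ +ᵣ x} {x} λ n → ℚ.+-identityˡ (seq x n))
                         , (λ x → pointwise⇒≃ {x +ᵣ 0ᵣ} {x} λ n → ℚ.+-identityʳ (seq x n)) }
            ; inverse = (λ x → pointwise⇒≃ {(-ᵣ x) +ᵣ x} {0ᵣ} λ n → ℚ.+-inverseˡ (seq x n))
                      , (λ x → pointwise⇒≃ {x +ᵣ (-ᵣ x)} {0ᵣ} λ n → ℚ.+-inverseʳ (seq x n))
            ; ⁻¹-cong = λ {x} {y} → -ᵣ-cong {x} {y} }
          ; comm = λ x y → pointwise⇒≃ {x +ᵣ y} {y +ᵣ x} λ n → ℚ.+-comm (seq x n) (seq y n) }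
        ; *-cong = λ {x} {x′} {y} {y′} → *ᵣ-cong {x} {x′} {y} {y′}
        ; *-assoc = λ x y z → pointwise⇒≃ {(x *ᵣ y) *ᵣ z} {x *ᵣ (y *ᵣ z)}
            λ n → ℚ.*-assoc (seq x n) (seq y n) (seq z n)
        ; *-identity = (λ x → pointwise⇒≃ {1ᵣ *ᵣ x} {x} λ n → ℚ.*-identityˡ (seq x n))
                     , (λ x → pointwise⇒≃ {x *ᵣ 1ᵣ} {x} λ n → ℚ.*-identityʳ (seq x n))
        ; distrib =
            (λ x y z → pointwise⇒≃ {x *ᵣ (y +ᵣ z)} {(x *ᵣ y) +ᵣ (x *ᵣ z)}
              λ n → ℚ.*-distribˡ-+ (seq x n) (seq y n) (seq z n))
          , (λ x y z → pointwise⇒≃ {(y +ᵣ z) *ᵣ x} {(y *ᵣ x) +ᵣ (z *ᵣ x)}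
              λ n → ℚ.*-distribʳ-+ (seq x n) (seq y n) (seq z n)) }
      ; *-comm = λ x y → pointwise⇒≃ {x *ᵣ y} {y *ᵣ x} λ n → ℚ.*-comm (seq x n) (seq y n) } }

  1≄0 : ¬ 1ᵣ ≃ 0ᵣ
  1≄0 1≃0 with 1≃0 ½ (ℚ.positive⁻¹ ½)
  ... | N , small = ℚ.<-asym (small N ℕ.≤-refl) (ℚ.*<* (ℤ.+<+ (ℕ.s≤s (ℕ.s≤s ℕ.z≤n))))

  -- Positivity provides a rational δ that eventually bounds x from below, so |x y| < δ ε forces |y|
  -- < ε.
  positive⇒cancellable : ∀ {x} → 0ᵣ <ᵣ x → ∀ {y} → x *ᵣ y ≃ 0ᵣ → y ≃ 0ᵣ
  positive⇒cancellable {x} (δ , 0<δ , M , δ≤x) {y} xy≃0 ε 0<ε = M ℕ.⊔ N , λ n p →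
    ℚ.*-cancelˡ-<-nonNeg δ {{ℚ.pos⇒nonNeg δ}} (begin-strict
      δ ℚ.* ℚ.∣ seq y n ℚ.- 0ℚ ∣
        ≡⟨ cong (λ q → δ ℚ.* ℚ.∣ q ∣) (ℚ.+-identityʳ (seq y n)) ⟩
      δ ℚ.* ℚ.∣ seq y n ∣
        ≤⟨ ℚ.*-monoʳ-≤-nonNeg ℚ.∣ seq y n ∣ {{nonNegative (ℚ.0≤∣p∣ (seq y n))}}
             (bound n (ℕ.m⊔n≤o⇒m≤o M N p)) ⟩
      ℚ.∣ seq x n ∣ ℚ.* ℚ.∣ seq y n ∣
        ≡⟨ ℚ.∣p*q∣≡∣p∣*∣q∣ (seq x n) (seq y n) ⟨
      ℚ.∣ seq x n ℚ.* seq y n ∣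
        ≡⟨ cong ℚ.∣_∣ (ℚ.+-identityʳ (seq x n ℚ.* seq y n)) ⟨
      ℚ.∣ seq x n ℚ.* seq y n ℚ.- 0ℚ ∣
        <⟨ small n (ℕ.m⊔n≤o⇒n≤o M N p) ⟩
      δ ℚ.* ε ∎)
    where
    open ℚ.≤-Reasoning
    instance
      δ-positive : ℚ.Positive δ
      δ-positive = positive 0<δ
    0<δε : 0ℚ ℚ.< δ ℚ.* ε
    0<δε = subst (ℚ._< δ ℚ.* ε) (ℚ.*-zeroʳ δ) (ℚ.*-monoʳ-<-pos δ 0<ε)
    N = proj₁ (xy≃0 (δ ℚ.* ε) 0<δε)
    small = proj₂ (xy≃0 (δ ℚ.* ε) 0<δε)
    bound : ∀ n → M ℕ.≤ n → δ ℚ.≤ ℚ.∣ seq x n ∣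
    bound n M≤n = ℚ.≤-trans δ≤ (ℚ.≤-reflexive (sym (ℚ.0≤p⇒∣p∣≡p (ℚ.≤-trans (ℚ.<⇒≤ 0<δ) δ≤))))
      where
      δ≤ : δ ℚ.≤ seq x n
      δ≤ = subst (ℚ._≤ seq x n) (ℚ.+-identityˡ δ) (δ≤x n M≤n)

  open MatrixTree ℝ-commutativeRing using (ι)

  -- `+ n / 1` is normalised by a gcd that does not compute for a variable `n`. Coprimality with 1
  -- supplies the normal form, after which the sum on the right computes.
  fromℕ-suc : ∀ n → + suc n ℚ./ 1 ≡ 1ℚ ℚ.+ (+ n ℚ./ 1)
  fromℕ-suc n = trans (cong (λ i → (+ 1 ℤ.+ i) ℚ./ 1) (sym (ℤ.*-identityʳ (+ n))))
    (sym (cong (1ℚ ℚ.+_) (ℚ.normalize-coprime (Coprime.sym (Coprime.1-coprimeTo n)))))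

  fromℕ≃ι : ∀ n → fromℕ n ≃ ι n
  fromℕ≃ι n = pointwise⇒≃ {fromℕ n} {ι n} (same n)
    where
    same : ∀ n k → seq (fromℕ n) k ≡ seq (ι n) k
    same zero    k = refl
    same (suc n) k = trans (fromℕ-suc n) (cong (1ℚ ℚ.+_) (same n k))

  ι-positive : ∀ n → 0ᵣ <ᵣ ι (suc n)
  ι-positive n = 1ℚ , ℚ.positive⁻¹ 1ℚ , 0 , λ k _ → ℚ.≤-trans (ℚ.≤-reflexive (ℚ.+-comm 0ℚ 1ℚ))
      (ℚ.+-monoʳ-≤ 1ℚ (nonneg n k))
    where
    nonneg : ∀ n k → 0ℚ ℚ.≤ seq (ι n) k
    nonneg zero    k = ℚ.≤-refl
    nonneg (suc n) k = ℚ.≤-trans (nonneg n k)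
      (ℚ.≤-trans (ℚ.≤-reflexive (sym (ℚ.+-identityˡ (seq (ι n) k)))) (ℚ.+-monoˡ-≤ (seq (ι n) k) (ℚ.<⇒≤ (ℚ.positive⁻¹ 1ℚ))))

  open CommutativeRing ℝ-commutativeRing using (_-_; rawRing) renaming (_*_ to _∙_)
  open Determinant rawRing using (det)
  open Determinants ℝ-commutativeRing using (det-cong)
  open SemiRegularSpectrum ℝ-commutativeRing using (prodList; spectralProduct)
  open JoinFormula ℝ-commutativeRing using (characteristicMatrix; eigenvalues)

  charPoly≃ : ∀ {n} (G : Graph n) x → det (characteristicMatrix G x) ≃ charPoly G x
  charPoly≃ G x = det-cong {A = characteristicMatrix G x}
    {B = λ u v → scalarMatrix x u v -ᵣ adjacencyMatrix G u v} λ u v →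
      pointwise⇒≃ {characteristicMatrix G x u v} {scalarMatrix x u v -ᵣ adjacencyMatrix G u v}
        λ _ → refl

  prodᵣ-minus : ∀ x θ → prodᵣ (map (λ t → x -ᵣ t) θ) ≃ prodList (map (λ t → x - t) θ)
  prodᵣ-minus x []      = pointwise⇒≃ {1ᵣ} {1ᵣ} λ _ → refl
  prodᵣ-minus x (t ∷ θ) = *ᵣ-cong
    {x -ᵣ t} {x - t} {prodᵣ (map (λ t → x -ᵣ t) θ)} {prodList (map (λ t → x - t) θ)}
    (pointwise⇒≃ {x -ᵣ t} {x - t} λ _ → refl) (prodᵣ-minus x θ)

  prodᵣ-spectral : ∀ x ls → spectralProduct x ls ≃ prodᵣ (map (λ l → x -ᵣ l *ᵣ l) ls)
  prodᵣ-spectral x []       = pointwise⇒≃ {1ᵣ} {1ᵣ} λ _ → refl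
  prodᵣ-spectral x (l ∷ ls) = *ᵣ-cong
    {x - l ∙ l} {x -ᵣ l *ᵣ l} {spectralProduct x ls} {prodᵣ (map (λ l → x -ᵣ l *ᵣ l) ls)}
    (pointwise⇒≃ {x - l ∙ l} {x -ᵣ l *ᵣ l} λ _ → refl) (prodᵣ-spectral x ls)

  spectrum-ring : ∀ {n} (G : Graph n) ls →
    Spec G (ls ++ map -ᵣ_ ls ++ replicate (n ∸ 2 * length ls) 0ᵣ) →
    length (eigenvalues n ls) ≡ n ×
    (∀ x → det (characteristicMatrix G x) ≃ prodList (map (λ t → x - t) (eigenvalues n ls)))
  spectrum-ring {n} G ls (len , spectrum) = len , λ x →
    ≃-trans {det (characteristicMatrix G x)} {charPoly G x}
            {prodList (map (λ t → x - t) (eigenvalues n ls))}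
      (charPoly≃ G x)
      (≃-trans {charPoly G x} {prodᵣ (map (λ t → x -ᵣ t) θ)} {prodList (map (λ t → x - t) θ)}
        (spectrum x) (prodᵣ-minus x θ))
    where θ = ls ++ map -ᵣ_ ls ++ replicate (n ∸ 2 * length ls) 0ᵣ

  ∙≃*ᵣ : ∀ x y → x ∙ y ≃ x *ᵣ y
  ∙≃*ᵣ x y = pointwise⇒≃ {x ∙ y} {x *ᵣ y} λ _ → refl

open RealRing

theorem4p1 :
  ∀ {ν₁ ν₂ : ℕ} (G₁ : Graph ν₁) (G₂ : Graph ν₂)
    (V₁ V₂ : Subset ν₁) (V₃ V₄ : Subset ν₂)
    (q₁ q₂ q₃ q₄ : ℕ) (λ₁ μ₁ : ℝ) (λs μs : List ℝ) →
  let n₁ = ∣ V₁ ∣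
      n₂ = ∣ V₂ ∣
      n₃ = ∣ V₃ ∣
      n₄ = ∣ V₄ ∣
      k₁ = length (λ₁ ∷ λs)
      k₂ = length (μ₁ ∷ μs)
  in
  SemiRegular G₁ V₁ V₂ q₁ q₂ →
  SemiRegular G₂ V₃ V₄ q₃ q₄ →
  n₁ ≤ n₂ →
  n₃ ≤ n₄ →
  Spec G₁ ((λ₁ ∷ λs) ++ map -ᵣ_ (λ₁ ∷ λs) ++ replicate (ν₁ ∸ 2 * k₁) 0ᵣ) →
  Spec G₂ ((μ₁ ∷ μs) ++ map -ᵣ_ (μ₁ ∷ μs) ++ replicate (ν₂ ∸ 2 * k₂) 0ᵣ) →
  λ₁ *ᵣ λ₁ ≃ fromℕ (q₁ * q₂) →
  μ₁ *ᵣ μ₁ ≃ fromℕ (q₃ * q₄) →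
  Linked _≥ᵣ_ (λ₁ ∷ λs) →
  Linked _≥ᵣ_ (μ₁ ∷ μs) →
  All (0ᵣ <ᵣ_) (λ₁ ∷ λs) →
  All (0ᵣ <ᵣ_) (μ₁ ∷ μs) →
  fromℕ (τ (G₁ ∨ G₂)) ≃
    fromℕ ((q₁ + q₂ + ν₂) * (q₃ + q₄ + ν₁)
           * (q₁ + ν₂) ^ (n₁ ∸ k₁) * (q₂ + ν₂) ^ (n₂ ∸ k₁)
           * (q₃ + ν₁) ^ (n₃ ∸ k₂) * (q₄ + ν₁) ^ (n₄ ∸ k₂))
    *ᵣ prodᵣ (map (λ l → fromℕ ((q₁ + ν₂) * (q₂ + ν₂)) -ᵣ l *ᵣ l) λs)
    *ᵣ prodᵣ (map (λ m → fromℕ ((q₃ + ν₁) * (q₄ + ν₁)) -ᵣ m *ᵣ m) μs)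
-- A spectrum with a largest eigenvalue is nonempty, so its length excludes a graph without
-- vertices.
theorem4p1 {zero} G₁ G₂ V₁ V₂ V₃ V₄ q₁ q₂ q₃ q₄ λ₁ μ₁ λs μs _ _ _ _ (() , _)
theorem4p1 {suc m} {zero} G₁ G₂ V₁ V₂ V₃ V₄ q₁ q₂ q₃ q₄ λ₁ μ₁ λs μs _ _ _ _ _ (() , _)
theorem4p1 {suc m} {suc n} G₁ G₂ V₁ V₂ V₃ V₄ q₁ q₂ q₃ q₄ λ₁ μ₁ λs μs
  semi₁ semi₂ n₁≤n₂ n₃≤n₄ spec₁ spec₂ λ₁² μ₁² _ _ λ>0 μ>0 =
  τ-join-semiregular
    (λ k {y} → positive⇒cancellable {ι (suc k)} (ι-positive k) {y}) 1≄0
    fromℕ fromℕ≃ι _*ᵣ_ ∙≃*ᵣ (λ x ls → prodᵣ (map (λ l → x -ᵣ l *ᵣ l) ls)) prodᵣ-spectral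
    G₁ G₂ V₁ V₂ V₃ V₄ q₁ q₂ q₃ q₄ λ₁ μ₁ λs μs semi₁ semi₂ n₁≤n₂ n₃≤n₄
    (proj₁ θ) (proj₂ θ) (proj₁ η) (proj₂ η) λ₁² μ₁²
    (All.map (λ {l} 0<l {y} → positive⇒cancellable {l} 0<l {y}) λ>0)
    (All.map (λ {l} 0<l {y} → positive⇒cancellable {l} 0<l {y}) μ>0)
  where
  open JoinFormula ℝ-commutativeRing
  open MatrixTree ℝ-commutativeRing using (ι)
  θ = spectrum-ring G₁ (λ₁ ∷ λs) spec₁
  η = spectrum-ring G₂ (μ₁ ∷ μs) spec₂
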